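{- For an integer $k>2$, let $Q_2(2k)$ denote the number of Goldbach partitions of $2k$, i.e. the number of unordered pairs $\{p,q\}$ (with $p\le q$) of odd primes with $p+q=2k$. For an integer $n>2$, let $\Sigma_{2n}$ be the set of all Goldbach partitions of all even integers $2k$ with $4<2k\le 2n$, so that $|\Sigma_{2n}|=\sum_{2<k\le n}Q_2(2k)$. Select an element of $\Sigma_{2n}$ uniformly at random (each partition having probability $1/|\Sigma_{2n}|$), and let $2G_n$ be the even integer partitioned by the selected partition; thus $G_n$ is the random variable with $$\mathbb{P}(G_n=k)=\frac{Q_2(2k)}{\sum_{2<j\le n}Q_2(2j)},\qquad 2<k\le n.$$ Then $$\text{(i)}\quad \lim_{n\to\infty}\frac{1}{n}\mathbb{E}(G_n)=\frac{2}{3},\qquad\qquad \text{(ii)}\quad \lim_{n\to\infty}\frac{1}{n^2}\mathrm{Var}(G_n)=\frac{1}{18}.$$ (These are the mean $\mu_T$ and variance $\sigma_T^2$ of $T=\max\{U_1,U_2\}$, where $U_1,U_2$ are independent uniform random variables on $(0,1)$, whose distribution function is $F(u)=u^2$ for $0<u<1$.)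
   Context: Primes considered are odd primes only. Expectation $\mathbb{E}$ and variance $\mathrm{Var}$ are taken with respect to the uniform probability measure $\mathbb{P}$ on $\Sigma_{2n}$. -}

module Defs where

open import Data.Nat as ℕ using (ℕ; zero; suc; _+_; _*_; _∸_; _≤_)
open import Data.Nat.Primality using (prime?)
open import Data.Nat using (_≤?_)
open import Data.List using (List; length; filter; map; upTo)
open import Data.Nat.ListAction using (sum)
open import Data.Integer using (+_)
open import Data.Rational as ℚ using (ℚ; 0ℚ; 1ℚ; _/_; ∣_∣; _-_; _<_)
open import Data.Product using (∃; _×_)
open import Relation.Nullary.Decidable using (_×-dec_)

-- p is a "small part" of a Goldbach partition {p , 2k - p} of 2k (p ≤ q):
-- 3 ≤ p ≤ k, p prime, 2k - p prime  (both then odd primes, p ≤ q = 2k - p).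
-- Q₂ k  =  Q_2(2k) : number of Goldbach partitions of 2k into odd primes p ≤ q.
Q₂ : ℕ → ℕ
Q₂ k = length (filter (λ p → (3 ≤? p) ×-dec ((p ≤? k) ×-dec (prime? p ×-dec prime? (2 * k ∸ p))))
                      (upTo (suc k)))

range : ℕ → List ℕ
range n = map (λ i → 3 + i) (upTo (n ∸ 2))

card : ℕ → ℕ
card n = sum (map Q₂ (range n))

moment : ℕ → ℕ → ℕ
moment j n = sum (map (λ k → k ℕ.^ j * Q₂ k) (range n))

-- total division of a natural by a natural into ℚ (returns 0 for denominator 0;
-- this case never occurs below since card n ≥ Q₂ 3 = 1 for n ≥ 3)
_÷ℕ_ : ℕ → ℕ → ℚ
a ÷ℕ zero = 0ℚ
a ÷ℕ suc d = + a / suc d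

𝔼G : ℕ → ℚ
𝔼G n = moment 1 n ÷ℕ card n

VarG : ℕ → ℚ
VarG n = moment 2 n ÷ℕ card n ℚ.- 𝔼G n ℚ.* 𝔼G n

_/ℕ_ : ℚ → ℕ → ℚ
q /ℕ zero = 0ℚ
q /ℕ suc m = q ℚ.* (+ 1 / suc m)

ConvergesTo : (ℕ → ℚ) → ℚ → Set
ConvergesTo a L = ∀ (ε : ℚ) → 0ℚ < ε → ∃ λ N → ∀ n → N ≤ n → ∣ a n - L ∣ < ε

{-# OPTIONS --safe #-}
-- The limits follow from the prime number theorem ψ(x) = x + o(x), proved in Selberg's elementary way.
-- Logarithms are replaced by a rational, completely additive ℓ with 1/(n+1) ≤ ℓ(n+1) - ℓ(n) ≤ 1/n for n < X;
-- all estimates are uniform in ℓ and X.  With R(x) = ψ(x) - x, the Tatuzawa–Iseki identity bounds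
-- R(x) ℓ(x) + Σ Λ(k) R(x/k) by O(x), and iterating it gives ℓ(x)² |R(x)| ≤ Σ Λ₂(n) |R(x/n)| + O(x ℓ(x)),
-- where Λ₂ = Λ ℓ + Λ * Λ has summatory function 2 x ℓ(x) + O(x).  Because ψ is monotone and
-- Σ R(m) / (m (m+1)) is bounded, every interval (y, K y] contains a proportional one on which R(m)/m is small,
-- so a bound |R(m)| ≤ α m + B improves to one with α - η, and finitely many steps make α arbitrarily small.
-- Weighting pairs of odd primes by ℓ(p) ℓ(q) then shows that the number of partitions of numbers up to 2t is
-- (t² + o(n²)) / ℓ(2n)² uniformly for t ≤ n.  Summation by parts turns this into the limits 2/3 and 1/2 of the
-- scaled first and second moments, and 1/2 - (2/3)² = 1/18.
module Submission where

open import Defs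
open import Data.Nat as ℕ using (ℕ; zero; suc; pred; z≤n; s≤s; z<s; _≤′_; ≤′-reflexive; ≤′-step; >-nonZero;
    >-nonZero⁻¹; nonTrivial⇒n>1) renaming (_+_ to _+ⁿ_; _*_ to _*ⁿ_; _∸_ to _∸ⁿ_; _≤_ to _≤ⁿ_; _<_ to _<ⁿ_;
    _^_ to _^ⁿ_; _/_ to _/ⁿ_)
import Data.Nat.Properties as ℕP
import Data.Nat.DivMod as DM
import Data.Nat.Tactic.RingSolver as NS
open import Data.Nat.Divisibility using (_∣_; _∣?_; divides)
import Data.Nat.Divisibility as ND
open import Data.Nat.Coprimality using (Coprime; coprime-divisor)
open import Data.Nat.Primality using (Prime; prime?; euclidsLemma; prime⇒irreducible; ¬prime[1];
    prime⇒nonZero; prime⇒nonTrivial; productOfPrimes≥1)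
open import Data.Nat.Primality.Factorisation using (PrimeFactorisation; factorise; factorisationUnique;
    factorisationHasAllPrimeFactors)
open import Data.Nat.ListAction using (product; sum)
open import Data.Nat.ListAction.Properties using (product-++; ∈⇒∣product)
import Data.Integer as ℤ
import Data.Integer.Properties as ℤP
open import Data.Rational as ℚ using (ℚ; 0ℚ; 1ℚ; _+_; _*_; _-_; -_; _≤_; _<_; 1/_; _/_)
open import Data.Rational.Properties as ℚP using (≤-refl; ≤-trans; ≤-reflexive; <⇒≤; <-≤-trans; ≤-<-trans;
    +-mono-≤; _≤?_; ≰⇒>; +-identityʳ; +-identityˡ; *-identityˡ; *-identityʳ; *-comm; *-assoc; +-comm;
    +-assoc; *-zeroˡ; *-zeroʳ; *-distribˡ-+)
import Data.Rational.Unnormalised as ℚᵘ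
import Data.Rational.Unnormalised.Properties as ℚᵘP
open import Data.List using (List; _∷_; []; _++_; length; filter; map; upTo; applyUpTo)
import Data.List.Properties as LP
open import Data.List.Relation.Unary.All as All using (All)
import Data.List.Relation.Unary.All.Properties as AllP
open import Data.List.Relation.Unary.Any using (here; there)
open import Data.List.Membership.Propositional using (_∈_)
open import Data.List.Membership.DecPropositional ℕP._≟_ using (_∈?_)
open import Data.List.Relation.Binary.Permutation.Propositional as Perm using (_↭_; ↭-sym; prep; swap)
open import Data.List.Relation.Binary.Permutation.Propositional.Properties using (∈-resp-↭)
open import Data.Maybe using (Maybe; just; nothing)
open import Data.Product using (∃; _×_; _,_; proj₁; proj₂)
open import Data.Sum using (_⊎_; inj₁; inj₂)
open import Data.Empty using (⊥; ⊥-elim)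
open import Level using (0ℓ)
open import Relation.Binary.PropositionalEquality using (_≡_; _≢_; refl; sym; trans; cong; cong₂; subst;
    subst₂)
open import Relation.Nullary using (¬_; Dec; yes; no)
open import Relation.Nullary.Decidable using (_×-dec_)
open import Relation.Unary using (Decidable)
open import Tactic.RingSolver using (solve; solve-∀)
open import Tactic.RingSolver.Core.AlmostCommutativeRing using (AlmostCommutativeRing; fromCommutativeRing)
open PrimeFactorisation

-- Rational arithmetic and finite sums

-- Two demands on a rational logarithm pull apart. The divisor identities behind `Λ` use additivity
-- exactly, whereas the analytic estimates use only bounds on the increments, which leave room.
-- Hence harmonic sums, additive up to a small error, are summed over prime factors: additivity
-- becomes exact, and the error disappears in the slack of the increments. As the admissible error
-- shrinks with the range, `ℓ` exists only up to a cutoff `X` and changes with it. No limit can be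
-- taken along a fixed `ℓ`, so constants are explicit and thresholds are natural numbers that depend
-- on neither `ℓ` nor `X`. The descent for `R` ends after finitely many steps because the gain at
-- precision `N` is the same `η N` for all slopes between `4 / N` and 4. The factor `ℓ(2n)²` that
-- relates the number of partitions to `t²` is never evaluated: it occurs alike in the moments and
-- in the cardinality and cancels in their quotients, so the limits involve rational numbers only.

0≟ : (x : ℚ) → Maybe (0ℚ ≡ x)
0≟ x with 0ℚ ℚP.≟ x
... | yes p = just p
... | no _ = nothing

ℚR : AlmostCommutativeRing 0ℓ 0ℓ
ℚR = fromCommutativeRing ℚP.+-*-commutativeRing 0≟

infixl 6 _+≤_

infixr 7 _·≤_

_+≤_ : ∀ {a b c d} → a ≤ b → c ≤ d → a + c ≤ b + d
_+≤_ = +-mono-≤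

_·≤_ : ∀ {a b c} → 0ℚ ≤ c → a ≤ b → c * a ≤ c * b
_·≤_ {a} {b} {c} h k = ℚP.*-monoˡ-≤-nonNeg c {{ℚ.nonNegative h}} k

+-cancel-≤ : ∀ r p q → p + r ≤ q + r → p ≤ q
+-cancel-≤ r p q h = subst₂ _≤_ (e p) (e q) (ℚP.+-monoˡ-≤ (- r) h)
  where
  e : ∀ p → p + r + - r ≡ p
  e p = solve (p ∷ r ∷ []) ℚR

-- Pattern of most inequalities below: `A ≤ B` is a sum of hypotheses with nonnegative multipliers,
-- and the ring solver checks that `y - x` equals `B - A`. Products of hypotheses enter as further
-- summands.
lin : ∀ {A B x y} → A ≤ B → x + B ≡ y + A → x ≤ y
lin {A} {B} {x} {y} h e = +-cancel-≤ A x y (subst (x + A ≤_) e (ℚP.+-monoʳ-≤ x h))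

0≤1 : 0ℚ ≤ 1ℚ
0≤1 = ℚ.*≤* (ℤ.+≤+ z≤n)

0<1 : 0ℚ < 1ℚ
0<1 = ℚ.*<* (ℤ.+<+ z<s)

*≥0 : ∀ {a b} → 0ℚ ≤ a → 0ℚ ≤ b → 0ℚ ≤ a * b
*≥0 {a} {b} h k = subst (_≤ a * b) (*-zeroʳ a) (h ·≤ k)

+≥0 : ∀ {a b} → 0ℚ ≤ a → 0ℚ ≤ b → 0ℚ ≤ a + b
+≥0 h k = h +≤ k

*-mono : ∀ {a b c d} → 0ℚ ≤ a → a ≤ b → 0ℚ ≤ c → c ≤ d → a * c ≤ b * d
*-mono {a} {b} {c} {d} 0≤a h 0≤c k =
  ≤-trans (0≤a ·≤ k) (subst₂ _≤_ (*-comm d a) (*-comm d b) (≤-trans 0≤c k ·≤ h))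

*-monoʳ : ∀ {a b} c → 0ℚ ≤ c → a ≤ b → a * c ≤ b * c
*-monoʳ {a} {b} c 0≤c h = subst₂ _≤_ (*-comm c a) (*-comm c b) (0≤c ·≤ h)

neg-≤ : ∀ {a b} → a ≤ b → - b ≤ - a
neg-≤ {a} {b} h = lin h (solve (a ∷ b ∷ []) ℚR)

diff≥0 : ∀ {a b} → a ≤ b → 0ℚ ≤ b - a
diff≥0 {a} {b} h = lin h (solve (a ∷ b ∷ []) ℚR)

-- Recursive rather than `+ n / 1`, so that `ι (suc n)` is `1ℚ + ι n` by definition and induction
-- steps reach the ring solver directly; `ι≡/1` compares the two.
ι : ℕ → ℚ
ι zero = 0ℚ
ι (suc n) = 1ℚ + ι n

ι-+ : ∀ m n → ι (m +ⁿ n) ≡ ι m + ι n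
ι-+ zero n = sym (+-identityˡ (ι n))
ι-+ (suc m) n = trans (cong (1ℚ +_) (ι-+ m n)) (sym (+-assoc 1ℚ (ι m) (ι n)))

ι-* : ∀ m n → ι (m *ⁿ n) ≡ ι m * ι n
ι-* zero n = sym (*-zeroˡ (ι n))
ι-* (suc m) n = trans (ι-+ n (m *ⁿ n)) (trans (cong (ι n +_) (ι-* m n)) (e (ι m) (ι n)))
  where
  e : ∀ a b → b + a * b ≡ (1ℚ + a) * b
  e = solve-∀ ℚR

ι≥0 : ∀ n → 0ℚ ≤ ι n
ι≥0 zero = ≤-refl
ι≥0 (suc n) = 0≤1 +≤ ι≥0 n

ι-mono : ∀ {m n} → m ≤ⁿ n → ι m ≤ ι n
ι-mono {n = n} z≤n = ι≥0 n
ι-mono (s≤s h) = ≤-refl {1ℚ} +≤ ι-mono h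

ι-cancel : ∀ {m n} → ι m ≤ ι n → m ≤ⁿ n
ι-cancel {m} {n} h with ℕP.≤-total m n
... | inj₁ p = p
... | inj₂ p with ℕP.≤⇒≤′ p
...   | ≤′-reflexive refl = ℕP.≤-refl
...   | ≤′-step {m′} q = ⊥-elim (ℚP.<-irrefl refl (<-≤-trans lt h))
  where
  lt : ι n < ι (suc m′)
  lt = ≤-<-trans (ι-mono (ℕP.≤′⇒≤ q))
    (subst (_< 1ℚ + ι m′) (+-identityˡ (ι m′)) (ℚP.+-monoˡ-< (ι m′) 0<1))

ι>0 : ∀ n → 0ℚ < ι (suc n)
ι>0 n = <-≤-trans 0<1 (ι-mono {1} {suc n} z<s)

ι-nonZero : ∀ n → ℚ.NonZero (ι (suc n))
ι-nonZero n = ℚ.>-nonZero (ι>0 n)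

-- The value 0 at 0 agrees with the convention of `_÷ℕ_` and `_/ℕ_`.
inv : ℕ → ℚ
inv zero = 0ℚ
inv (suc n) = (1/ ι (suc n)) {{ι-nonZero n}}

ι*inv : ∀ {n} → 1 ≤ⁿ n → ι n * inv n ≡ 1ℚ
ι*inv {suc n} _ = ℚP.*-inverseʳ (ι (suc n)) {{ι-nonZero n}}

inv*ι : ∀ {n} → 1 ≤ⁿ n → inv n * ι n ≡ 1ℚ
inv*ι {n} h = trans (*-comm (inv n) (ι n)) (ι*inv h)

inv≥0 : ∀ n → 0ℚ ≤ inv n
inv≥0 zero = ≤-refl
inv≥0 (suc n) = <⇒≤ (ℚP.positive⁻¹ _ {{ℚP.1/pos⇒pos (ι (suc n)) {{ℚ.positive (ι>0 n)}}}})

ι-cancelˡ : ∀ {n a b} → 1 ≤ⁿ n → ι n * a ≤ ι n * b → a ≤ b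
ι-cancelˡ {n} {a} {b} h k = subst₂ _≤_ (e a) (e b) (inv≥0 n ·≤ k)
  where
  e : ∀ a → inv n * (ι n * a) ≡ a
  e a = trans (sym (*-assoc (inv n) (ι n) a)) (trans (cong (_* a) (inv*ι h)) (*-identityˡ a))

ι*inv* : ∀ {n} a → 1 ≤ⁿ n → ι n * (inv n * a) ≡ a
ι*inv* {n} a h = trans (sym (*-assoc (ι n) (inv n) a)) (trans (cong (_* a) (ι*inv h)) (*-identityˡ a))

inv-* : ∀ {a b} → 1 ≤ⁿ a → 1 ≤ⁿ b → inv (a *ⁿ b) ≡ inv a * inv b
inv-* {a} {b} ha hb = trans (sym (*-identityʳ _)) (trans (cong (inv (a *ⁿ b) *_) (sym e1))
    (trans (sym (*-assoc (inv (a *ⁿ b)) (ι (a *ⁿ b)) (inv a * inv b)))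
    (trans (cong (_* (inv a * inv b)) (inv*ι (ℕP.*-mono-≤ ha hb))) (*-identityˡ _))))
  where
  r : ∀ x y u v → x * y * (u * v) ≡ x * u * (y * v)
  r = solve-∀ ℚR
  e1 : ι (a *ⁿ b) * (inv a * inv b) ≡ 1ℚ
  e1 = trans (cong (_* (inv a * inv b)) (ι-* a b)) (trans (r (ι a) (ι b) (inv a) (inv b))
      (trans (cong₂ _*_ (ι*inv ha) (ι*inv hb)) (*-identityˡ 1ℚ)))

inv-anti : ∀ {m n} → 1 ≤ⁿ m → m ≤ⁿ n → inv n ≤ inv m
inv-anti {m} {n} hm h = ι-cancelˡ hm (ι-cancelˡ hn (subst₂ _≤_ (sym e1) (sym e2) (ι-mono h)))
  where
  hn = ℕP.≤-trans hm h
  e1 : ι n * (ι m * inv n) ≡ ι m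
  e1 = trans (r (ι n) (ι m) (inv n)) (ι*inv* (ι m) hn)
    where
    r : ∀ x y z → x * (y * z) ≡ x * (z * y)
    r = solve-∀ ℚR
  e2 : ι n * (ι m * inv m) ≡ ι n
  e2 = trans (cong (ι n *_) (ι*inv hm)) (*-identityʳ (ι n))

inv≤1 : ∀ n → inv n ≤ 1ℚ
inv≤1 zero = 0≤1
inv≤1 (suc n) = inv-anti {1} {suc n} z<s z<s

Σ : ℕ → (ℕ → ℚ) → ℚ
Σ zero f = 0ℚ
Σ (suc n) f = Σ n f + f (suc n)

Σ-cong : ∀ n {f g : ℕ → ℚ} → (∀ i → 1 ≤ⁿ i → i ≤ⁿ n → f i ≡ g i) → Σ n f ≡ Σ n g
Σ-cong zero h = refl
Σ-cong (suc n) h = cong₂ _+_ (Σ-cong n (λ i a b → h i a (ℕP.m≤n⇒m≤1+n b))) (h (suc n) z<s ℕP.≤-refl)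

Σ-mono : ∀ n {f g : ℕ → ℚ} → (∀ i → 1 ≤ⁿ i → i ≤ⁿ n → f i ≤ g i) → Σ n f ≤ Σ n g
Σ-mono zero h = ≤-refl
Σ-mono (suc n) h = Σ-mono n (λ i a b → h i a (ℕP.m≤n⇒m≤1+n b)) +≤ h (suc n) z<s ℕP.≤-refl

Σ-0 : ∀ n → Σ n (λ _ → 0ℚ) ≡ 0ℚ
Σ-0 zero = refl
Σ-0 (suc n) = trans (+-identityʳ _) (Σ-0 n)

Σ-≥0 : ∀ n {f : ℕ → ℚ} → (∀ i → 1 ≤ⁿ i → i ≤ⁿ n → 0ℚ ≤ f i) → 0ℚ ≤ Σ n f
Σ-≥0 n {f} h = subst (_≤ Σ n f) (Σ-0 n) (Σ-mono n h)

Σ-+ : ∀ n (f g : ℕ → ℚ) → Σ n (λ i → f i + g i) ≡ Σ n f + Σ n g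
Σ-+ zero f g = refl
Σ-+ (suc n) f g = trans (cong (_+ (f (suc n) + g (suc n))) (Σ-+ n f g))
    (e (Σ n f) (Σ n g) (f (suc n)) (g (suc n)))
  where
  e : ∀ a b c d → a + b + (c + d) ≡ a + c + (b + d)
  e = solve-∀ ℚR

Σ-*ˡ : ∀ n c (f : ℕ → ℚ) → Σ n (λ i → c * f i) ≡ c * Σ n f
Σ-*ˡ zero c f = sym (*-zeroʳ c)
Σ-*ˡ (suc n) c f = trans (cong (_+ c * f (suc n)) (Σ-*ˡ n c f)) (sym (*-distribˡ-+ c (Σ n f) (f (suc n))))

Σ-*ʳ : ∀ n c (f : ℕ → ℚ) → Σ n (λ i → f i * c) ≡ Σ n f * c
Σ-*ʳ n c f = trans (Σ-cong n (λ i _ _ → *-comm (f i) c)) (trans (Σ-*ˡ n c f) (*-comm c (Σ n f)))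

Σ-neg : ∀ n (f : ℕ → ℚ) → Σ n (λ i → - f i) ≡ - Σ n f
Σ-neg zero f = refl
Σ-neg (suc n) f = trans (cong (_+ - f (suc n)) (Σ-neg n f)) (e (Σ n f) (f (suc n)))
  where
  e : ∀ a b → - a + - b ≡ - (a + b)
  e = solve-∀ ℚR

Σ-- : ∀ n (f g : ℕ → ℚ) → Σ n (λ i → f i - g i) ≡ Σ n f - Σ n g
Σ-- n f g = trans (Σ-+ n f (λ i → - g i)) (cong (Σ n f +_) (Σ-neg n g))

Σ-const : ∀ n c → Σ n (λ _ → c) ≡ ι n * c
Σ-const zero c = sym (*-zeroˡ c)
Σ-const (suc n) c = trans (cong (_+ c) (Σ-const n c)) (e (ι n) c)
  where
  e : ∀ a b → a * b + b ≡ (1ℚ + a) * b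
  e = solve-∀ ℚR

Σ-swap : ∀ m n (f : ℕ → ℕ → ℚ) → Σ m (λ i → Σ n (λ j → f i j)) ≡ Σ n (λ j → Σ m (λ i → f i j))
Σ-swap zero n f = sym (Σ-0 n)
Σ-swap (suc m) n f = trans (cong (_+ Σ n (f (suc m))) (Σ-swap m n f))
    (sym (Σ-+ n (λ j → Σ m (λ i → f i j)) (f (suc m))))

Σ-extend : ∀ {m n} (f : ℕ → ℚ) → m ≤ⁿ n → (∀ i → m <ⁿ i → i ≤ⁿ n → f i ≡ 0ℚ) → Σ n f ≡ Σ m f
Σ-extend {m} {n} f h z = go (ℕP.≤⇒≤′ h) z
  where
  go : ∀ {n} → m ≤′ n → (∀ i → m <ⁿ i → i ≤ⁿ n → f i ≡ 0ℚ) → Σ n f ≡ Σ m f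
  go (≤′-reflexive refl) z = refl
  go (≤′-step {n} h) z = trans (cong₂ _+_ (go h (λ i a b → z i a (ℕP.m≤n⇒m≤1+n b)))
      (z (suc n) (s≤s (ℕP.≤′⇒≤ h)) ℕP.≤-refl)) (+-identityʳ _)

Σ-grow : ∀ {m n} (f : ℕ → ℚ) → m ≤ⁿ n → (∀ i → m <ⁿ i → i ≤ⁿ n → 0ℚ ≤ f i) → Σ m f ≤ Σ n f
Σ-grow {m} {n} f h z = go (ℕP.≤⇒≤′ h) z
  where
  go : ∀ {n} → m ≤′ n → (∀ i → m <ⁿ i → i ≤ⁿ n → 0ℚ ≤ f i) → Σ m f ≤ Σ n f
  go (≤′-reflexive refl) z = ≤-refl
  go (≤′-step {n} h) z = subst (_≤ Σ n f + f (suc n)) (+-identityʳ _)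
      (go h (λ i a b → z i a (ℕP.m≤n⇒m≤1+n b)) +≤ z (suc n) (s≤s (ℕP.≤′⇒≤ h)) ℕP.≤-refl)

Σ-head : ∀ n (f : ℕ → ℚ) → Σ (suc n) f ≡ f 1 + Σ n (λ i → f (suc i))
Σ-head zero f = trans (+-identityˡ (f 1)) (sym (+-identityʳ (f 1)))
Σ-head (suc n) f = trans (cong (_+ f (suc (suc n))) (Σ-head n f)) (+-assoc (f 1) _ _)

Σ-single : ∀ {n k} (f : ℕ → ℚ) → 1 ≤ⁿ k → k ≤ⁿ n → (∀ i → i ≢ k → f i ≡ 0ℚ) → Σ n f ≡ f k
Σ-single {n} {suc k} f _ h z = trans (Σ-extend f h (λ i a _ → z i (ℕP.>⇒≢ a)))
  (trans (cong (_+ f (suc k)) (trans (Σ-cong k (λ i _ b → z i (ℕP.<⇒≢ (s≤s b)))) (Σ-0 k))) (+-identityˡ _))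

-- The Iverson bracket. Conditions on an index become factors, so that sums over divisors, multiples
-- or prime powers run over full ranges and `Σ-swap` exchanges them.
χ : ∀ {a} {P : Set a} → Dec P → ℚ
χ (yes _) = 1ℚ
χ (no _) = 0ℚ

χ≥0 : ∀ {a} {P : Set a} (d : Dec P) → 0ℚ ≤ χ d
χ≥0 (yes _) = 0≤1
χ≥0 (no _) = ≤-refl

χ≤1 : ∀ {a} {P : Set a} (d : Dec P) → χ d ≤ 1ℚ
χ≤1 (yes _) = ≤-refl
χ≤1 (no _) = 0≤1

χ-yes : ∀ {a} {P : Set a} (d : Dec P) → P → χ d ≡ 1ℚ
χ-yes (yes _) p = refl
χ-yes (no ¬p) p = ⊥-elim (¬p p)

χ-no : ∀ {a} {P : Set a} (d : Dec P) → ¬ P → χ d ≡ 0ℚ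
χ-no (yes p) ¬p = ⊥-elim (¬p p)
χ-no (no _) ¬p = refl

χ-⇔ : ∀ {a b} {P : Set a} {Q : Set b} (d : Dec P) (e : Dec Q) → (P → Q) → (Q → P) → χ d ≡ χ e
χ-⇔ (yes p) e f g = sym (χ-yes e (f p))
χ-⇔ (no ¬p) e f g = sym (χ-no e (λ q → ¬p (g q)))

-- Total floor division, with value 0 for divisor 0.
infixl 7 _÷_

_÷_ : ℕ → ℕ → ℕ
x ÷ zero = 0
x ÷ suc k = x /ⁿ suc k

÷-lo : ∀ x k → k *ⁿ (x ÷ k) ≤ⁿ x
÷-lo x zero = z≤n
÷-lo x (suc k) = subst (_≤ⁿ x) (ℕP.*-comm (x /ⁿ suc k) (suc k)) (DM.m/n*n≤m x (suc k))

÷-hi : ∀ x {k} → 1 ≤ⁿ k → x <ⁿ k *ⁿ suc (x ÷ k)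
÷-hi x {suc k} _ = subst (x <ⁿ_) (trans (ℕP.+-comm (suc k) _)
    (trans (cong (_+ⁿ suc k) (ℕP.*-comm (x /ⁿ suc k) (suc k)))
    (trans (ℕP.+-comm _ (suc k)) (sym (ℕP.*-suc (suc k) (x /ⁿ suc k))))))
  (subst (_<ⁿ suc k +ⁿ (x /ⁿ suc k) *ⁿ suc k) (sym (DM.m≡m%n+[m/n]*n x (suc k)))
      (ℕP.+-monoˡ-< _ (DM.m%n<n x (suc k))))

÷-unique : ∀ {x k m} → k *ⁿ m ≤ⁿ x → x <ⁿ k *ⁿ suc m → x ÷ k ≡ m
÷-unique {x} {zero} p q = ⊥-elim (ℕP.n≮0 q)
÷-unique {x} {suc k} {m} p q = ℕP.≤-antisym
  (ℕP.≤-pred (ℕP.*-cancelˡ-< (suc k) _ _ (ℕP.≤-<-trans (÷-lo x (suc k)) q)))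
  (ℕP.≤-pred (ℕP.*-cancelˡ-< (suc k) _ _ (ℕP.≤-<-trans p (÷-hi x z<s))))

÷-÷ : ∀ x {a b} → 1 ≤ⁿ a → 1 ≤ⁿ b → (x ÷ a) ÷ b ≡ x ÷ (a *ⁿ b)
÷-÷ x {suc a} {suc b} _ _ = DM.m/n/o≡m/[n*o] x (suc a) (suc b)

*÷ : ∀ {k} j → 1 ≤ⁿ k → (k *ⁿ j) ÷ k ≡ j
*÷ {suc k} j _ = ÷-unique {k = suc k} ℕP.≤-refl (ℕP.*-monoʳ-< (suc k) (ℕP.n<1+n j))

÷-anti : ∀ x {j k} → 1 ≤ⁿ j → j ≤ⁿ k → x ÷ k ≤ⁿ x ÷ j
÷-anti x {suc j} {suc k} _ h = DM./-monoʳ-≤ x h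

÷-≥1 : ∀ {x k} → 1 ≤ⁿ k → k ≤ⁿ x → 1 ≤ⁿ x ÷ k
÷-≥1 {x} {suc k} _ h = DM.m≥n⇒m/n>0 h

÷-1 : ∀ x → x ÷ 1 ≡ x
÷-1 x = DM.n/1≡n x

÷≤ : ∀ x k → x ÷ k ≤ⁿ x
÷≤ x zero = z≤n
÷≤ x (suc k) = DM.m/n≤m x (suc k)

÷-big : ∀ {x k} → x <ⁿ k → x ÷ k ≡ 0
÷-big {x} {suc k} h = DM.m<n⇒m/n≡0 h

÷-lo-ℚ : ∀ x {k} → 1 ≤ⁿ k → ι (x ÷ k) ≤ ι x * inv k
÷-lo-ℚ x {k} h = ι-cancelˡ h (subst₂ _≤_ (ι-* k (x ÷ k)) e (ι-mono (÷-lo x k)))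
  where
  e : ι x ≡ ι k * (ι x * inv k)
  e = sym (trans (cong (ι k *_) (*-comm (ι x) (inv k))) (ι*inv* (ι x) h))

÷-hi-ℚ : ∀ x {k} → 1 ≤ⁿ k → ι x * inv k ≤ ι (x ÷ k) + 1ℚ
÷-hi-ℚ x {k} h = ι-cancelˡ h (subst₂ _≤_ e (trans (ι-* k (suc (x ÷ k)))
    (cong (ι k *_) (+-comm 1ℚ (ι (x ÷ k))))) (ι-mono (ℕP.<⇒≤ (÷-hi x h))))
  where
  e : ι x ≡ ι k * (ι x * inv k)
  e = sym (trans (cong (ι k *_) (*-comm (ι x) (inv k))) (ι*inv* (ι x) h))

-- Induction on `x`: passing to `suc x` raises the quotient by `a` exactly when `a` divides `suc x`,
-- and then by one.
Σ-multiples : ∀ x {a} (φ : ℕ → ℚ) → 1 ≤ⁿ a → Σ (x ÷ a) (λ b → φ (a *ⁿ b)) ≡ Σ x (λ m → χ (a ∣? m) * φ m)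
Σ-multiples zero {a} φ h = cong (λ n → Σ n (λ b → φ (a *ⁿ b))) (÷-big h)
Σ-multiples (suc x) {a} φ h with a ∣? suc x
... | yes (divides zero ())
... | yes (divides (suc q) e) = trans (cong (λ n → Σ n (λ b → φ (a *ⁿ b))) e1)
      (cong₂ _+_ (trans (cong (λ n → Σ n (λ b → φ (a *ⁿ b))) (sym e2)) (Σ-multiples x φ h))
        (trans (cong φ (sym e′)) (sym (*-identityˡ (φ (suc x))))))
  where
  e′ : suc x ≡ a *ⁿ suc q
  e′ = trans e (ℕP.*-comm (suc q) a)
  e1 : suc x ÷ a ≡ suc q
  e1 = trans (cong (_÷ a) e′) (*÷ (suc q) h)
  e2 : x ÷ a ≡ q
  e2 = ÷-unique {k = a} (ℕP.≤-pred (subst (a *ⁿ q <ⁿ_) (sym e′)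
      (subst (a *ⁿ q <ⁿ_) (sym (ℕP.*-suc a q)) (ℕP.m<n+m (a *ⁿ q) h)))) (subst (x <ⁿ_) e′ (ℕP.n<1+n x))
... | no ¬d = trans (cong (λ n → Σ n (λ b → φ (a *ⁿ b))) e1)
    (trans (Σ-multiples x φ h) (sym (trans (cong (Σ x (λ m → χ (a ∣? m) * φ m) +_) (*-zeroˡ (φ (suc x))))
    (+-identityʳ _))))
  where
  e1 : suc x ÷ a ≡ x ÷ a
  e1 = ÷-unique {k = a} (ℕP.m≤n⇒m≤1+n (÷-lo x a)) (ℕP.≤∧≢⇒< (÷-hi x h)
      (λ eq → ¬d (divides (suc (x ÷ a)) (trans eq (ℕP.*-comm a (suc (x ÷ a)))))))

-- The Möbius and von Mangoldt functions

fac : ℕ → List ℕ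
fac zero = []
fac (suc n) = factors (factorise (suc n))

fac-prime : ∀ n → All Prime (fac n)
fac-prime zero = All.[]
fac-prime (suc n) = factorsPrime (factorise (suc n))

fac-product : ∀ {n} → 1 ≤ⁿ n → product (fac n) ≡ n
fac-product {suc n} _ = sym (isFactorisation (factorise (suc n)))

fac-unique : ∀ {n} (ps : List ℕ) → All Prime ps → 1 ≤ⁿ n → product ps ≡ n → fac n ↭ ps
fac-unique {suc n} ps pr _ e = factorisationUnique (factorise (suc n))
    (record { factors = ps ; isFactorisation = sym e ; factorsPrime = pr })

fac-* : ∀ {a b} → 1 ≤ⁿ a → 1 ≤ⁿ b → fac (a *ⁿ b) ↭ fac a ++ fac b
fac-* {a} {b} ha hb = fac-unique (fac a ++ fac b) (AllP.++⁺ (fac-prime a) (fac-prime b)) (ℕP.*-mono-≤ ha hb)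
  (trans (product-++ (fac a) (fac b)) (cong₂ _*ⁿ_ (fac-product ha) (fac-product hb)))

prime≥2 : ∀ {p} → Prime p → 2 ≤ⁿ p
prime≥2 {p} pr = nonTrivial⇒n>1 p {{prime⇒nonTrivial pr}}

prime≥1 : ∀ {p} → Prime p → 1 ≤ⁿ p
prime≥1 pr = ℕP.≤-trans z<s (prime≥2 pr)

fac-∷ : ∀ {p e} → Prime p → 1 ≤ⁿ e → fac (p *ⁿ e) ↭ p ∷ fac e
fac-∷ {p} {e} pr he = fac-unique (p ∷ fac e) (pr All.∷ fac-prime e) (ℕP.*-mono-≤ (prime≥1 pr) he)
    (cong (p *ⁿ_) (fac-product he))

∈fac⇒∣ : ∀ {p e} → 1 ≤ⁿ e → p ∈ fac e → p ∣ e
∈fac⇒∣ {p} {e} he h = subst (p ∣_) (fac-product he) (∈⇒∣product h)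

∣⇒∈fac : ∀ {p e} → Prime p → 1 ≤ⁿ e → p ∣ e → p ∈ fac e
∣⇒∈fac {p} {e} pr he h = factorisationHasAllPrimeFactors pr (subst (p ∣_) (sym (fac-product he)) h)
    (fac-prime e)

-- The Möbius function on a list of primes: every entry contributes a sign, and one that recurs
-- later contributes 0. Factorisations are unique only up to permutation, hence `μL-↭`.
μL : List ℕ → ℚ
μL [] = 1ℚ
μL (p ∷ ps) = - ((1ℚ - χ (p ∈? ps)) * μL ps)

μL-∷ : ∀ x {ps qs} → ps ↭ qs → μL ps ≡ μL qs → μL (x ∷ ps) ≡ μL (x ∷ qs)
μL-∷ x {ps} {qs} h e = cong -_ (cong₂ (λ a b → (1ℚ - a) * b)
    (χ-⇔ (x ∈? ps) (x ∈? qs) (∈-resp-↭ h) (∈-resp-↭ (↭-sym h))) e)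

μL-↭ : ∀ {ps qs} → ps ↭ qs → μL ps ≡ μL qs
μL-↭ Perm.refl = refl
μL-↭ (prep x h) = μL-∷ x h (μL-↭ h)
μL-↭ (Perm.trans h k) = trans (μL-↭ h) (μL-↭ k)
μL-↭ (swap {ps} {qs} x y h) = go (x ℕP.≟ y)
  where
  f : ℚ → ℚ → ℚ
  f a b = - (a * b)
  r : ∀ a b c → - (a * - (b * c)) ≡ - (b * - (a * c))
  r = solve-∀ ℚR
  drop : ∀ {a b} {l : List ℕ} → a ≢ b → a ∈ b ∷ l → a ∈ l
  drop ne (here e) = ⊥-elim (ne e)
  drop ne (there m) = m
  ex : x ≢ y → χ (x ∈? (y ∷ ps)) ≡ χ (x ∈? qs)
  ex x≢y = χ-⇔ (x ∈? (y ∷ ps)) (x ∈? qs) (λ m → ∈-resp-↭ h (drop x≢y m)) (λ m → there (∈-resp-↭ (↭-sym h) m))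
  ey : x ≢ y → χ (y ∈? ps) ≡ χ (y ∈? (x ∷ qs))
  ey x≢y = χ-⇔ (y ∈? ps) (y ∈? (x ∷ qs)) (λ m → there (∈-resp-↭ h m))
      (λ m → ∈-resp-↭ (↭-sym h) (drop (λ e → x≢y (sym e)) m))
  go : Dec (x ≡ y) → μL (x ∷ y ∷ ps) ≡ μL (y ∷ x ∷ qs)
  go (yes refl) = μL-∷ x (prep x h) (μL-∷ x h (μL-↭ h))
  go (no x≢y) = trans (cong₂ f (cong (λ z → 1ℚ - z) (ex x≢y))
      (cong₂ f (cong (λ z → 1ℚ - z) (ey x≢y)) (μL-↭ h))) (r (1ℚ - χ (x ∈? qs)) (1ℚ - χ (y ∈? (x ∷ qs)))
      (μL qs))

μL≤1 : ∀ ps → (- 1ℚ ≤ μL ps) × (μL ps ≤ 1ℚ)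
μL≤1 [] = lin (0≤1 +≤ 0≤1) refl , ≤-refl
μL≤1 (p ∷ ps) = go (p ∈? ps)
  where
  go : (d : Dec (p ∈ ps)) → (- 1ℚ ≤ - ((1ℚ - χ d) * μL ps)) × (- ((1ℚ - χ d) * μL ps) ≤ 1ℚ)
  go (yes _) = subst (λ z → (- 1ℚ ≤ - z) × (- z ≤ 1ℚ)) (sym (*-zeroˡ (μL ps))) (lin 0≤1 refl , 0≤1)
  go (no _) = subst (λ z → (- 1ℚ ≤ - z) × (- z ≤ 1ℚ)) (sym (*-identityˡ (μL ps)))
    (neg-≤ (proj₂ (μL≤1 ps)) , neg-≤ (proj₁ (μL≤1 ps)))

μ : ℕ → ℚ
μ n = μL (fac n)

μ≤1 : ∀ n → (- 1ℚ ≤ μ n) × (μ n ≤ 1ℚ)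
μ≤1 n = μL≤1 (fac n)

μ-prime* : ∀ {p e} → Prime p → 1 ≤ⁿ e → μ (p *ⁿ e) ≡ - ((1ℚ - χ (p ∣? e)) * μ e)
μ-prime* {p} {e} pr he = trans (μL-↭ (fac-∷ pr he)) (cong (λ z → - ((1ℚ - z) * μ e))
    (χ-⇔ (p ∈? fac e) (p ∣? e) (∈fac⇒∣ he) (∣⇒∈fac pr he)))

divSum : ℕ → (ℕ → ℚ) → ℚ
divSum n f = Σ n (λ d → χ (d ∣? n) * f d)

prime-coprime : ∀ {p d} → Prime p → ¬ (p ∣ d) → Coprime d p
prime-coprime {p} {d} pr h {i} (a , b) with prime⇒irreducible pr b
... | inj₁ e = e
... | inj₂ refl = ⊥-elim (h a)

∤-extend : ∀ {n d} → 1 ≤ⁿ n → n <ⁿ d → ¬ (d ∣ n)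
∤-extend {suc n} h k d = ℕP.<⇒≱ k (ND.∣⇒≤ d)

-- Pairing each divisor e of m prime to p with the divisor p e of p m.
divSum-μ-prime* : ∀ {p m} (g : ℕ → ℚ) → Prime p → 1 ≤ⁿ m →
  divSum (p *ⁿ m) (λ d → μ d * g d) ≡ divSum m (λ e → (1ℚ - χ (p ∣? e)) * μ e * (g e - g (p *ⁿ e)))
divSum-μ-prime* {p} {m} g pr hm = trans split (trans (cong₂ _+_ partA partB)
    (trans (sym (Σ-+ m _ _)) (Σ-cong m (λ e _ _ → r2 (χ (e ∣? m)) (1ℚ - χ (p ∣? e)) (μ e) (g e)
    (g (p *ⁿ e))))))
  where
  n = p *ⁿ m
  hp = prime≥1 pr
  r1 : ∀ c a f → a * f ≡ c * (a * f) + (1ℚ - c) * (a * f)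
  r1 = solve-∀ ℚR
  r2 : ∀ a c u x y → a * (- (c * u) * y) + a * (c * (u * x)) ≡ a * (c * u * (x - y))
  r2 = solve-∀ ℚR
  r3 : ∀ a c f → c * (a * f) ≡ a * (c * f)
  r3 = solve-∀ ℚR
  split : divSum n (λ d → μ d * g d) ≡ Σ n (λ d → χ (p ∣? d) * (χ (d ∣? n) * (μ d * g d))) + Σ n
      (λ d → (1ℚ - χ (p ∣? d)) * (χ (d ∣? n) * (μ d * g d)))
  split = trans (Σ-cong n (λ d _ _ → r1 (χ (p ∣? d)) (χ (d ∣? n)) (μ d * g d))) (Σ-+ n _ _)
  partA : Σ n (λ d → χ (p ∣? d) * (χ (d ∣? n) * (μ d * g d))) ≡ Σ m
      (λ e → χ (e ∣? m) * (- ((1ℚ - χ (p ∣? e)) * μ e) * g (p *ⁿ e)))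
  partA = trans (sym (Σ-multiples n (λ d → χ (d ∣? n) * (μ d * g d)) hp))
    (trans (cong (λ z → Σ z (λ b → χ (p *ⁿ b ∣? n) * (μ (p *ⁿ b) * g (p *ⁿ b)))) (*÷ m hp))
      (Σ-cong m (λ e he _ → cong₂ _*_ (χ-⇔ (p *ⁿ e ∣? n) (e ∣? m) (ND.*-cancelˡ-∣ p {{prime⇒nonZero pr}})
          (ND.*-monoʳ-∣ p)) (cong (_* g (p *ⁿ e)) (μ-prime* pr he)))))
  term : ∀ d (c : Dec (p ∣ d)) → (1ℚ - χ c) * (χ (d ∣? n) * (μ d * g d)) ≡ χ (d ∣? m) *
      ((1ℚ - χ c) * (μ d * g d))
  term d (yes _) = trans (*-zeroˡ (χ (d ∣? n) * (μ d * g d)))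
      (sym (trans (cong (χ (d ∣? m) *_) (*-zeroˡ (μ d * g d))) (*-zeroʳ (χ (d ∣? m)))))
  term d (no p∤d) = trans (r3 (χ (d ∣? n)) (1ℚ - 0ℚ) (μ d * g d))
      (cong (_* ((1ℚ - 0ℚ) * (μ d * g d))) (χ-⇔ (d ∣? n) (d ∣? m) (coprime-divisor (prime-coprime pr p∤d))
      (ND.∣n⇒∣m*n p)))
  partB : Σ n (λ d → (1ℚ - χ (p ∣? d)) * (χ (d ∣? n) * (μ d * g d))) ≡ Σ m
      (λ d → χ (d ∣? m) * ((1ℚ - χ (p ∣? d)) * (μ d * g d)))
  partB = trans (Σ-cong n (λ d _ _ → term d (p ∣? d))) (Σ-extend _ (ℕP.m≤n*m m p {{prime⇒nonZero pr}})
      (λ d a _ → trans (cong (_* ((1ℚ - χ (p ∣? d)) * (μ d * g d))) (χ-no (d ∣? m) (∤-extend hm a)))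
      (*-zeroˡ ((1ℚ - χ (p ∣? d)) * (μ d * g d)))))

prime-divisor : ∀ {n} → 2 ≤ⁿ n → ∃ λ p → ∃ λ m → Prime p × (1 ≤ⁿ m) × (n ≡ p *ⁿ m)
prime-divisor {n} h = go (fac n) (fac-prime n) (fac-product (ℕP.≤-trans z<s h))
  where
  go : ∀ ps → All Prime ps → product ps ≡ n → ∃ λ p → ∃ λ m → Prime p × (1 ≤ⁿ m) × (n ≡ p *ⁿ m)
  go [] _ e = ⊥-elim (ℕP.<⇒≢ h e)
  go (p ∷ ps) (pr All.∷ prs) e = p , product ps , pr , productOfPrimes≥1 prs , sym e

-- For a prime `p` dividing `n`, the pairing of `divSum-μ-prime*` with constant weight turns each
-- pair `e`, `p e` into a difference `1 - 1`.
divSum-μ : ∀ {n} → 2 ≤ⁿ n → divSum n μ ≡ 0ℚ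
divSum-μ {n} h = go (prime-divisor h)
  where
  r : ∀ a b → a * (b * (1ℚ - 1ℚ)) ≡ 0ℚ
  r = solve-∀ ℚR
  go : (∃ λ p → ∃ λ m → Prime p × (1 ≤ⁿ m) × (n ≡ p *ⁿ m)) → divSum n μ ≡ 0ℚ
  go (p , m , pr , hm , refl) = trans (Σ-cong n (λ d _ _ → cong (χ (d ∣? n) *_) (sym (*-identityʳ (μ d)))))
    (trans (divSum-μ-prime* (λ _ → 1ℚ) pr hm) (trans (Σ-cong m
        (λ e _ _ → r (χ (e ∣? m)) ((1ℚ - χ (p ∣? e)) * μ e))) (Σ-0 m)))

divSum-μ-χ : ∀ {n} → 1 ≤ⁿ n → divSum n μ ≡ χ (n ℕP.≟ 1)
divSum-μ-χ {n} h = go (n ℕP.≟ 1)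
  where
  go : (d : Dec (n ≡ 1)) → divSum n μ ≡ χ d
  go (yes refl) = refl
  go (no ne) = divSum-μ (ℕP.≤∧≢⇒< h (λ e → ne (sym e)))

factor≥1 : ∀ {n q d} → 1 ≤ⁿ n → n ≡ q *ⁿ d → 1 ≤ⁿ q
factor≥1 {n} {zero} hn eq = ⊥-elim (ℕP.<⇒≱ hn (ℕP.≤-reflexive eq))
factor≥1 {n} {suc _} hn eq = s≤s z≤n

k<p^k : ∀ {p} k → 2 ≤ⁿ p → k <ⁿ p ^ⁿ k
k<p^k zero h = s≤s z≤n
k<p^k {p} (suc k) h = ℕP.≤-trans (subst (2 +ⁿ k ≤ⁿ_) (cong (suc k +ⁿ_) (sym (ℕP.+-identityʳ (suc k))))
    (ℕP.+-monoˡ-≤ (suc k) {1} {suc k} z<s)) (ℕP.*-mono-≤ h (k<p^k k h))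

p≤p^k : ∀ {p k} → 1 ≤ⁿ p → 1 ≤ⁿ k → p ≤ⁿ p ^ⁿ k
p≤p^k {p} {suc k} hp _ = ℕP.m≤m*n p (p ^ⁿ k) {{ℕP.m^n≢0 p k {{>-nonZero hp}}}}

1≤p^k : ∀ {p} k → 1 ≤ⁿ p → 1 ≤ⁿ p ^ⁿ k
1≤p^k {p} k hp = >-nonZero⁻¹ _ {{ℕP.m^n≢0 p k {{>-nonZero hp}}}}

module Mangoldt (ℓ : ℕ → ℚ) (ℓ-* : ∀ {a b} → 1 ≤ⁿ a → 1 ≤ⁿ b → ℓ (a *ⁿ b) ≡ ℓ a + ℓ b) where

  π? : ℕ → ℚ
  π? p = χ (prime? p)

  ppow : ℕ → ℕ → ℕ → ℚ
  ppow n p k = π? p * ℓ p * χ (p ^ⁿ k ℕP.≟ n)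

  -- Von Mangoldt's function as a sum over all solutions of `p ^ k = n` with `p` prime, of which
  -- there is at most one. In this form it is nonnegative term by term and exchanges with other
  -- sums.
  Λ : ℕ → ℚ
  Λ n = Σ n (λ p → Σ n (λ k → ppow n p k))

  ℓ-1 : ℓ 1 ≡ 0ℚ
  ℓ-1 = trans (r (ℓ 1)) (trans (cong (λ z → z - ℓ 1) (sym (ℓ-* {1} {1} z<s z<s))) (r′ (ℓ 1)))
    where
    r : ∀ a → a ≡ (a + a) - a
    r = solve-∀ ℚR
    r′ : ∀ a → a - a ≡ 0ℚ
    r′ = solve-∀ ℚR

  Λ≥0 : (∀ p → 0ℚ ≤ ℓ p) → ∀ n → 0ℚ ≤ Λ n
  Λ≥0 h n = Σ-≥0 n (λ p _ _ → Σ-≥0 n (λ k _ _ → *≥0 (lem p) (χ≥0 (p ^ⁿ k ℕP.≟ n))))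
    where
    go : ∀ p (d : Dec (Prime p)) → 0ℚ ≤ χ d * ℓ p
    go p (yes _) = subst (0ℚ ≤_) (sym (*-identityˡ (ℓ p))) (h p)
    go p (no _) = ≤-reflexive (sym (*-zeroˡ (ℓ p)))
    lem : ∀ p → 0ℚ ≤ π? p * ℓ p
    lem p = go p (prime? p)

  -- `p ^ k` is at least `p` and exceeds `k`; this lets the ranges of `p` and `k` in `Λ` be enlarged
  -- to a common bound.
  ppow-0 : ∀ {n p k} → 1 ≤ⁿ k → (n <ⁿ p ⊎ n <ⁿ k) → ppow n p k ≡ 0ℚ
  ppow-0 {n} {p} {k} hk h = go (prime? p)
    where
    no-eq : Prime p → (n <ⁿ p ⊎ n <ⁿ k) → p ^ⁿ k ≢ n
    no-eq pr (inj₁ a) refl = ℕP.<⇒≱ a (p≤p^k (prime≥1 pr) hk)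
    no-eq pr (inj₂ a) refl = ℕP.<⇒≱ a (ℕP.<⇒≤ (k<p^k k (prime≥2 pr)))
    go : (d : Dec (Prime p)) → χ d * ℓ p * χ (p ^ⁿ k ℕP.≟ n) ≡ 0ℚ
    go (no _) = trans (cong (_* χ (p ^ⁿ k ℕP.≟ n)) (*-zeroˡ (ℓ p))) (*-zeroˡ (χ (p ^ⁿ k ℕP.≟ n)))
    go (yes pr) = trans (cong (1ℚ * ℓ p *_) (χ-no (p ^ⁿ k ℕP.≟ n) (no-eq pr h))) (*-zeroʳ (1ℚ * ℓ p))

  Λ-extend : ∀ {n N} → n ≤ⁿ N → Λ n ≡ Σ N (λ p → Σ N (λ k → ppow n p k))
  Λ-extend {n} {N} h = sym (trans (Σ-extend _ h (λ p a _ → trans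
      (Σ-cong N (λ k hk _ → ppow-0 {n} {p} {k} hk (inj₁ a))) (Σ-0 N)))
    (Σ-cong n (λ p _ _ → Σ-extend _ h (λ k a _ → ppow-0 {n} {p} {k} (ℕP.≤-trans z<s a) (inj₂ a)))))

  Σ-Λ : ∀ N (f : ℕ → ℚ) → Σ N (λ d → Λ d * f d) ≡ Σ N (λ p →
      Σ N (λ k → π? p * ℓ p * Σ N (λ d → χ (p ^ⁿ k ℕP.≟ d) * f d)))
  Σ-Λ N f = trans (Σ-cong N (λ d _ h → trans (cong (_* f d) (Λ-extend h))
      (trans (sym (Σ-*ʳ N (f d) _)) (Σ-cong N (λ p _ _ → sym (Σ-*ʳ N (f d) _))))))
    (trans (Σ-swap N N (λ d p → Σ N (λ k → ppow d p k * f d)))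
        (Σ-cong N (λ p _ _ → trans (Σ-swap N N (λ d k → ppow d p k * f d))
      (Σ-cong N (λ k _ _ → trans (Σ-cong N (λ d _ _ → *-assoc (π? p * ℓ p) (χ (p ^ⁿ k ℕP.≟ d)) (f d)))
          (Σ-*ˡ N (π? p * ℓ p) _))))))

  -- The sum of `v_p(n) ℓ(p)` over primes `p`, the valuation being counted as the number of `k ≥ 1`
  -- for which `p ^ k` divides `n`. The range `N` is separate from `n` so that it stays fixed while
  -- prime factors are split off `n`.
  valuationSum : ℕ → ℕ → ℚ
  valuationSum N n = Σ N (λ p → π? p * ℓ p * Σ N (λ k → χ (p ^ⁿ k ∣? n)))

  divSum-Λ-valuationSum : ∀ {n} → 1 ≤ⁿ n → divSum n Λ ≡ valuationSum n n
  divSum-Λ-valuationSum {n} hn = trans (Σ-cong n (λ d _ _ → *-comm (χ (d ∣? n)) (Λ d)))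
      (trans (Σ-Λ n (λ d → χ (d ∣? n)))
    (Σ-cong n (λ p _ _ → trans (Σ-*ˡ n (π? p * ℓ p) _) (lem p))))
    where
    z : ∀ {q} → ¬ (q ∣ n) → ∀ d (c : Dec (q ≡ d)) → χ c * χ (d ∣? n) ≡ 0ℚ
    z ¬dv d (yes refl) = trans (*-identityˡ _) (χ-no (d ∣? n) ¬dv)
    z ¬dv d (no _) = *-zeroˡ (χ (d ∣? n))
    inner : ∀ q → 1 ≤ⁿ q → (c : Dec (q ∣ n)) → Σ n (λ d → χ (q ℕP.≟ d) * χ (d ∣? n)) ≡ χ c
    inner q hq (yes dv) = trans (Σ-single (λ d → χ (q ℕP.≟ d) * χ (d ∣? n)) hq (ND.∣⇒≤ {{>-nonZero hn}} dv)
             (λ i ne → trans (cong (_* χ (i ∣? n)) (χ-no (q ℕP.≟ i) (λ e → ne (sym e))))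
                 (*-zeroˡ (χ (i ∣? n)))))
             (cong₂ _*_ (χ-yes (q ℕP.≟ q) refl) (χ-yes (q ∣? n) dv))
    inner q hq (no ¬dv) = trans (Σ-cong n (λ d _ _ → z ¬dv d (q ℕP.≟ d))) (Σ-0 n)
    go : ∀ p (c : Dec (Prime p)) → χ c * ℓ p * Σ n (λ k → Σ n (λ d → χ (p ^ⁿ k ℕP.≟ d) * χ (d ∣? n))) ≡
        χ c * ℓ p * Σ n (λ k → χ (p ^ⁿ k ∣? n))
    go p (yes pr) = cong (1ℚ * ℓ p *_) (Σ-cong n (λ k _ _ → inner (p ^ⁿ k) (1≤p^k k (prime≥1 pr))
        (p ^ⁿ k ∣? n)))
    go p (no _) = zero-both (ℓ p) (Σ n (λ k → Σ n (λ d → χ (p ^ⁿ k ℕP.≟ d) * χ (d ∣? n))))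
        (Σ n (λ k → χ (p ^ⁿ k ∣? n)))
      where
      zero-both : ∀ a b c → 0ℚ * a * b ≡ 0ℚ * a * c
      zero-both = solve-∀ ℚR
    lem : ∀ p → π? p * ℓ p * Σ n (λ k → Σ n (λ d → χ (p ^ⁿ k ℕP.≟ d) * χ (d ∣? n))) ≡ π? p * ℓ p * Σ n
        (λ k → χ (p ^ⁿ k ∣? n))
    lem p = go p (prime? p)

  prime-pow-∣ : ∀ {p q m} k → Prime p → Prime q → p ≢ q → p ^ⁿ k ∣ q *ⁿ m → p ^ⁿ k ∣ m
  prime-pow-∣ {p} {q} k pp pq ne h = coprime-divisor (prime-coprime pq (q∤ k)) h
    where
    q∤ : ∀ k → ¬ (q ∣ p ^ⁿ k)
    q∤ zero d = ¬prime[1] (subst Prime (ND.∣1⇒≡1 d) pq)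
    q∤ (suc k) d with euclidsLemma p (p ^ⁿ k) pq d
    ... | inj₂ d′ = q∤ k d′
    ... | inj₁ d′ with prime⇒irreducible pp d′
    ...   | inj₁ e = ¬prime[1] (subst Prime e pq)
    ...   | inj₂ e = ne (sym e)

  -- The exponent of q goes up by one; the last term drops out since q ^ N exceeds m.
  valuation-q : ∀ {q m} N → Prime q → 1 ≤ⁿ m → m ≤ⁿ N → Σ N (λ k → χ (q ^ⁿ k ∣? q *ⁿ m)) ≡ Σ N
      (λ k → χ (q ^ⁿ k ∣? m)) + χ (1 ℕP.≤? N)
  valuation-q {q} {m} zero pq hm h = refl
  valuation-q {q} {m} (suc N) pq hm h = trans (Σ-head N (λ k → χ (q ^ⁿ k ∣? q *ⁿ m)))
    (trans (cong₂ _+_ (χ-yes (q ^ⁿ 1 ∣? q *ⁿ m) (subst (_∣ q *ⁿ m) (sym (ℕP.*-identityʳ q)) (ND.m∣m*n m)))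
       (Σ-cong N (λ k _ _ → χ-⇔ (q ^ⁿ suc k ∣? q *ⁿ m) (q ^ⁿ k ∣? m) (ND.*-cancelˡ-∣ q {{prime⇒nonZero pq}})
           (ND.*-monoʳ-∣ q))))
      (trans (+-comm 1ℚ (Σ N (λ k → χ (q ^ⁿ k ∣? m)))) (cong₂ _+_
          (sym (trans (cong (Σ N (λ k → χ (q ^ⁿ k ∣? m)) +_)
          (χ-no (q ^ⁿ suc N ∣? m) (∤-extend hm (ℕP.≤-<-trans h (k<p^k (suc N) (prime≥2 pq))))))
          (+-identityʳ (Σ N (λ k → χ (q ^ⁿ k ∣? m)))))) (sym (χ-yes (1 ℕP.≤? suc N) z<s)))))

  valuationSum-step : ∀ {q m N} → Prime q → 1 ≤ⁿ m → q *ⁿ m ≤ⁿ N → valuationSum N (q *ⁿ m) ≡ ℓ q +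
      valuationSum N m
  valuationSum-step {q} {m} {N} pq hm h = trans (Σ-cong N (λ p _ _ → lem p))
      (trans (Σ-+ N _ _) (cong (_+ valuationSum N m)
    (trans (Σ-single (λ p → χ (p ℕP.≟ q) * ℓ q) (prime≥1 pq) q≤N
        (λ i ne → trans (cong (_* ℓ q) (χ-no (i ℕP.≟ q) ne)) (*-zeroˡ (ℓ q))))
      (trans (cong (_* ℓ q) (χ-yes (q ℕP.≟ q) refl)) (*-identityˡ (ℓ q))))))
    where
    m≤N : m ≤ⁿ N
    m≤N = ℕP.≤-trans (ℕP.m≤n*m m q {{prime⇒nonZero pq}}) h
    q≤N : q ≤ⁿ N
    q≤N = ℕP.≤-trans (ℕP.m≤m*n q m {{>-nonZero hm}}) h
    v : ℕ → ℚ
    v p = Σ N (λ k → χ (p ^ⁿ k ∣? m))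
    r1 : ∀ a b → 1ℚ * a * (b + 1ℚ) ≡ 1ℚ * a + 1ℚ * a * b
    r1 = solve-∀ ℚR
    r2 : ∀ a b c → 1ℚ * a * b ≡ 0ℚ * c + 1ℚ * a * b
    r2 = solve-∀ ℚR
    r3 : ∀ a b c d → 0ℚ * a * b ≡ 0ℚ * d + 0ℚ * a * c
    r3 = solve-∀ ℚR
    go : ∀ p (c : Dec (Prime p)) (e : Dec (p ≡ q)) → χ c * ℓ p * Σ N (λ k → χ (p ^ⁿ k ∣? q *ⁿ m)) ≡
        χ e * ℓ q + χ c * ℓ p * v p
    go p (yes _) (yes refl) = trans (cong (1ℚ * ℓ q *_) (trans (valuation-q N pq hm m≤N)
        (cong (v q +_) (χ-yes (1 ℕP.≤? N) (ℕP.≤-trans (prime≥1 pq) q≤N))))) (r1 (ℓ q) (v q))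
    go p (yes pp) (no ne) = trans (cong (1ℚ * ℓ p *_) (Σ-cong N
        (λ k _ _ → χ-⇔ (p ^ⁿ k ∣? q *ⁿ m) (p ^ⁿ k ∣? m) (prime-pow-∣ k pp pq ne) (ND.∣n⇒∣m*n q))))
        (r2 (ℓ p) (v p) (ℓ q))
    go p (no np) (yes refl) = ⊥-elim (np pq)
    go p (no _) (no _) = r3 (ℓ p) (Σ N (λ k → χ (p ^ⁿ k ∣? q *ⁿ m))) (v p) (ℓ q)
    lem : ∀ p → π? p * ℓ p * Σ N (λ k → χ (p ^ⁿ k ∣? q *ⁿ m)) ≡ χ (p ℕP.≟ q) * ℓ q + π? p * ℓ p * v p
    lem p = go p (prime? p) (p ℕP.≟ q)

  valuationSum-1 : ∀ N → valuationSum N 1 ≡ 0ℚ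
  valuationSum-1 N = trans (Σ-cong N (λ p _ _ → lem p)) (Σ-0 N)
    where
    go : ∀ p (c : Dec (Prime p)) → χ c * ℓ p * Σ N (λ k → χ (p ^ⁿ k ∣? 1)) ≡ 0ℚ
    go p (no _) = trans (cong (_* Σ N (λ k → χ (p ^ⁿ k ∣? 1))) (*-zeroˡ (ℓ p)))
        (*-zeroˡ (Σ N (λ k → χ (p ^ⁿ k ∣? 1))))
    go p (yes pr) = trans (cong (1ℚ * ℓ p *_) (trans (Σ-cong N
        (λ k hk _ → χ-no (p ^ⁿ k ∣? 1) (∤-extend z<s (ℕP.≤-trans (prime≥2 pr) (p≤p^k (prime≥1 pr) hk)))))
        (Σ-0 N))) (*-zeroʳ (1ℚ * ℓ p))
    lem : ∀ p → π? p * ℓ p * Σ N (λ k → χ (p ^ⁿ k ∣? 1)) ≡ 0ℚ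
    lem p = go p (prime? p)

  valuationSum-product : ∀ {N} ps → All Prime ps → product ps ≤ⁿ N → valuationSum N (product ps) ≡ ℓ
      (product ps)
  valuationSum-product {N} [] _ h = trans (valuationSum-1 N) (sym ℓ-1)
  valuationSum-product {N} (q ∷ ps) (pq All.∷ prs) h = trans (valuationSum-step pq (productOfPrimes≥1 prs) h)
      (trans (cong (ℓ q +_) (valuationSum-product ps prs (ℕP.≤-trans
      (ℕP.m≤n*m (product ps) q {{prime⇒nonZero pq}}) h))) (sym (ℓ-* (prime≥1 pq) (productOfPrimes≥1 prs))))

  divSum-Λ : ∀ {n} → 1 ≤ⁿ n → divSum n Λ ≡ ℓ n
  divSum-Λ {n} h = trans (divSum-Λ-valuationSum h) (subst (λ z → valuationSum n z ≡ ℓ z) (fac-product h)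
      (valuationSum-product (fac n) (fac-prime n) (ℕP.≤-reflexive (fac-product h))))

  -- As `ℓ n * divSum n μ` vanishes, the negated sum is that of `μ d * (ℓ n - ℓ d)`. Expanding
  -- `ℓ n - ℓ d` as the sum of `Λ e` over the divisors `e` of `n / d` and summing over `d` first
  -- leaves only `e = n`.
  divSum-μℓ : ∀ {n} → 1 ≤ⁿ n → divSum n (λ d → μ d * ℓ d) ≡ - Λ n
  divSum-μℓ {n} hn = trans (r0 (divSum n (λ d → μ d * ℓ d)) (ℓ n * divSum n μ))
      (trans (cong₂ (λ a b → a - b) first second) (+-identityˡ (- Λ n)))
    where
    r0 : ∀ a b → a ≡ b - (b - a)
    r0 = solve-∀ ℚR
    first : ℓ n * divSum n μ ≡ 0ℚ
    first = go (n ℕP.≟ 1)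
      where
      go : Dec (n ≡ 1) → ℓ n * divSum n μ ≡ 0ℚ
      go (yes refl) = trans (cong (_* divSum 1 μ) ℓ-1) (*-zeroˡ (divSum 1 μ))
      go (no ne) = trans (cong (ℓ n *_) (divSum-μ (ℕP.≤∧≢⇒< hn (λ e → ne (sym e))))) (*-zeroʳ (ℓ n))
    r1 : ∀ l a u m → l * (a * u) - a * (u * m) ≡ a * (u * (l - m))
    r1 = solve-∀ ℚR
    r2 : ∀ a b → a + b - b ≡ a
    r2 = solve-∀ ℚR
    quot : ∀ d → 1 ≤ⁿ d → (c : Dec (d ∣ n)) → χ c * (μ d * (ℓ n - ℓ d)) ≡ μ d * Σ n
        (λ e → χ (e *ⁿ d ∣? n) * Λ e)
    quot d hd (no ¬dv) = trans (*-zeroˡ (μ d * (ℓ n - ℓ d)))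
        (sym (trans (cong (μ d *_) (trans (Σ-cong n (λ e _ _ →
        trans (cong (_* Λ e) (χ-no (e *ⁿ d ∣? n) (λ x → ¬dv (ND.m*n∣⇒n∣ e d x)))) (*-zeroˡ (Λ e)))) (Σ-0 n)))
        (*-zeroʳ (μ d))))
    quot d hd (yes (divides q eq)) = trans (*-identityˡ (μ d * (ℓ n - ℓ d)))
        (cong (μ d *_) (trans e1 (sym e2)))
      where
      hq : 1 ≤ⁿ q
      hq = factor≥1 hn eq
      e1 : ℓ n - ℓ d ≡ divSum q Λ
      e1 = trans (cong (λ z → z - ℓ d) (trans (cong ℓ eq) (ℓ-* hq hd)))
          (trans (r2 (ℓ q) (ℓ d)) (sym (divSum-Λ hq)))
      q≤n : q ≤ⁿ n
      q≤n = subst (q ≤ⁿ_) (sym eq) (ℕP.m≤m*n q d {{>-nonZero hd}})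
      cv : ∀ e → χ (e *ⁿ d ∣? n) ≡ χ (e ∣? q)
      cv e = χ-⇔ (e *ⁿ d ∣? n) (e ∣? q) (λ x → ND.*-cancelʳ-∣ d {{>-nonZero hd}} (subst (e *ⁿ d ∣_) eq x))
          (λ x → subst (e *ⁿ d ∣_) (sym eq) (ND.*-monoˡ-∣ d x))
      e2 : Σ n (λ e → χ (e *ⁿ d ∣? n) * Λ e) ≡ divSum q Λ
      e2 = trans (Σ-cong n (λ e _ _ → cong (_* Λ e) (cv e)))
          (Σ-extend _ q≤n (λ e a _ → trans (cong (_* Λ e) (χ-no (e ∣? q) (∤-extend hq a))) (*-zeroˡ (Λ e))))
    inner : ∀ e → 1 ≤ⁿ e → Dec (e ∣ n) → Σ n (λ d → μ d * (χ (e *ⁿ d ∣? n) * Λ e)) ≡ χ (e ℕP.≟ n) * Λ e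
    inner e he (no ¬dv) = trans (Σ-cong n (λ d _ _ → trans (cong (λ z → μ d * (z * Λ e))
        (χ-no (e *ⁿ d ∣? n) (λ x → ¬dv (ND.m*n∣⇒m∣ e d x))))
        (trans (cong (μ d *_) (*-zeroˡ (Λ e))) (*-zeroʳ (μ d)))))
             (trans (Σ-0 n) (sym (trans (cong (_* Λ e) (χ-no (e ℕP.≟ n) (λ { refl → ¬dv ND.∣-refl })))
                 (*-zeroˡ (Λ e)))))
    inner e he (yes (divides q eq)) = trans (Σ-cong n (λ d _ _ → trans (cong (λ z → μ d * (z * Λ e)) (cv d))
        (r3 (μ d) (χ (d ∣? q)) (Λ e))))
             (trans (Σ-*ʳ n (Λ e) _) (cong (_* Λ e) (trans (Σ-extend _ q≤n
                 (λ d a _ → trans (cong (_* μ d) (χ-no (d ∣? q) (∤-extend hq a))) (*-zeroˡ (μ d))))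
                 (trans (divSum-μ-χ hq) (χ-⇔ (q ℕP.≟ 1) (e ℕP.≟ n) to from)))))
      where
      r3 : ∀ a b c → a * (b * c) ≡ b * a * c
      r3 = solve-∀ ℚR
      hq : 1 ≤ⁿ q
      hq = factor≥1 hn eq
      q≤n : q ≤ⁿ n
      q≤n = subst (q ≤ⁿ_) (sym eq) (ℕP.m≤m*n q e {{>-nonZero he}})
      eq′ : n ≡ e *ⁿ q
      eq′ = trans eq (ℕP.*-comm q e)
      cv : ∀ d → χ (e *ⁿ d ∣? n) ≡ χ (d ∣? q)
      cv d = χ-⇔ (e *ⁿ d ∣? n) (d ∣? q) (λ x → ND.*-cancelˡ-∣ e {{>-nonZero he}} (subst (e *ⁿ d ∣_) eq′ x))
          (λ x → subst (e *ⁿ d ∣_) (sym eq′) (ND.*-monoʳ-∣ e x))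
      to : q ≡ 1 → e ≡ n
      to refl = sym (trans eq (ℕP.*-identityˡ e))
      from : e ≡ n → q ≡ 1
      from refl = ℕP.*-cancelʳ-≡ q 1 n {{>-nonZero hn}} (trans (sym eq) (sym (ℕP.*-identityˡ n)))
    second : ℓ n * divSum n μ - divSum n (λ d → μ d * ℓ d) ≡ Λ n
    second = trans (cong (_- divSum n (λ d → μ d * ℓ d)) (sym (Σ-*ˡ n (ℓ n) _)))
      (trans (sym (Σ-- n _ _)) (trans (Σ-cong n (λ d hd _ → trans (r1 (ℓ n) (χ (d ∣? n)) (μ d) (ℓ d))
          (quot d hd (d ∣? n))))
        (trans (Σ-cong n (λ d _ _ → sym (Σ-*ˡ n (μ d) _))) (trans
            (Σ-swap n n (λ d e → μ d * (χ (e *ⁿ d ∣? n) * Λ e)))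
            (trans (Σ-cong n (λ e he _ → inner e he (e ∣? n)))
          (trans (Σ-single (λ e → χ (e ℕP.≟ n) * Λ e) hn ℕP.≤-refl
              (λ i ne → trans (cong (_* Λ i) (χ-no (i ℕP.≟ n) ne)) (*-zeroˡ (Λ i))))
              (trans (cong (_* Λ n) (χ-yes (n ℕP.≟ n) refl)) (*-identityˡ (Λ n)))))))))

-- Rational logarithms

-- A rational stand-in for log on [1 , X]; no rational ℓ has these properties for all X at once.
record LogSystem (X : ℕ) : Set where
  field
    ℓ : ℕ → ℚ
    ℓ-* : ∀ {a b} → 1 ≤ⁿ a → 1 ≤ⁿ b → ℓ (a *ⁿ b) ≡ ℓ a + ℓ b
    ℓ≥0 : ∀ n → 0ℚ ≤ ℓ n
    ℓ-lo : ∀ {n} → 1 ≤ⁿ n → n <ⁿ X → ℓ n + inv (suc n) ≤ ℓ (suc n)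
    ℓ-hi : ∀ {n} → 1 ≤ⁿ n → n <ⁿ X → ℓ (suc n) ≤ ℓ n + inv n

H : ℕ → ℚ
H n = Σ n inv

Σ-split : ∀ m n (f : ℕ → ℚ) → Σ (m +ⁿ n) f ≡ Σ m f + Σ n (λ j → f (m +ⁿ j))
Σ-split m zero f = trans (cong (λ z → Σ z f) (ℕP.+-identityʳ m)) (sym (+-identityʳ (Σ m f)))
Σ-split m (suc n) f = trans (cong (λ z → Σ z f) (ℕP.+-suc m n))
    (trans (cong₂ _+_ (Σ-split m n f) (cong f (sym (ℕP.+-suc m n))))
    (+-assoc (Σ m f) (Σ n (λ j → f (m +ⁿ j))) (f (m +ⁿ suc n))))

ι*inv-* : ∀ {k m} → 1 ≤ⁿ k → 1 ≤ⁿ m → ι k * inv (k *ⁿ m) ≡ inv m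
ι*inv-* {k} {m} hk hm = trans (cong (ι k *_) (inv-* hk hm)) (ι*inv* (inv m) hk)

block-hi : ∀ a {t c} → 1 ≤ⁿ c → c ≤ⁿ t → Σ a (λ j → inv (t +ⁿ j)) ≤ ι a * inv c
block-hi a {t} {c} hc h = subst (Σ a (λ j → inv (t +ⁿ j)) ≤_) (Σ-const a (inv c))
    (Σ-mono a (λ j _ _ → inv-anti hc (ℕP.≤-trans h (ℕP.m≤m+n t j))))

block-lo : ∀ a {t c} → 1 ≤ⁿ t → t +ⁿ a ≤ⁿ c → ι a * inv c ≤ Σ a (λ j → inv (t +ⁿ j))
block-lo a {t} {c} ht h = subst (_≤ Σ a (λ j → inv (t +ⁿ j))) (Σ-const a (inv c))
    (Σ-mono a (λ j _ hj → inv-anti (ℕP.≤-trans ht (ℕP.m≤m+n t j)) (ℕP.≤-trans (ℕP.+-monoʳ-≤ t hj) h)))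

inv-step : ∀ {a} → 1 ≤ⁿ a → inv (suc a) + inv a * inv (suc a) ≡ inv a
inv-step {a} h = trans (r (inv a) (inv (suc a)) (ι a)) (trans
    (cong₂ (λ x y → (1ℚ - x) * inv (suc a) + inv a * y) (inv*ι h) (inv*ι {suc a} z<s))
    (r′ (inv a) (inv (suc a))))
  where
  r : ∀ u v x → v + u * v ≡ (1ℚ - u * x) * v + u * (v * (1ℚ + x))
  r = solve-∀ ℚR
  r′ : ∀ u v → (1ℚ - 1ℚ) * v + u * 1ℚ ≡ u
  r′ = solve-∀ ℚR

H-block : ∀ a t → H (a *ⁿ suc t) ≡ H (a *ⁿ t) + Σ a (λ j → inv (a *ⁿ t +ⁿ j))
H-block a t = trans (cong H (trans (ℕP.*-suc a t) (ℕP.+-comm a (a *ⁿ t)))) (Σ-split (a *ⁿ t) a inv)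

-- The block from `a t` to `a (t + 1)` adds between `inv (suc t)` and `inv t`, one step of `H t`
-- adds `inv (suc t)`, and the differences telescope.
H-scale : ∀ {a s} t → 1 ≤ⁿ a → 1 ≤ⁿ s → s ≤ⁿ t → (H t - H s ≤ H (a *ⁿ t) - H (a *ⁿ s)) ×
    (H (a *ⁿ t) - H (a *ⁿ s) + inv t ≤ H t - H s + inv s)
H-scale {a} {s} t ha hs h = go (ℕP.≤⇒≤′ h)
  where
  r0 : ∀ x y → x - x ≤ y - y
  r0 x y = ≤-reflexive (solve (x ∷ y ∷ []) ℚR)
  r0′ : ∀ x y z → x - x + z ≤ y - y + z
  r0′ x y z = ≤-reflexive (solve (x ∷ y ∷ z ∷ []) ℚR)
  r1 : ∀ ht hs u v w b → ht - hs ≤ u - v → w ≤ b → ht + w - hs ≤ u + b - v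
  r1 ht hs u v w b p q = lin (p +≤ q) (solve (ht ∷ hs ∷ u ∷ v ∷ w ∷ b ∷ []) ℚR)
  r2 : ∀ ht hs u v w b i is → u - v + i ≤ ht - hs + is → b ≤ i → u + b - v + w ≤ ht + w - hs + is
  r2 ht hs u v w b i is p q = lin (p +≤ q) (solve (ht ∷ hs ∷ u ∷ v ∷ w ∷ b ∷ i ∷ is ∷ []) ℚR)
  go : ∀ {t} → s ≤′ t → (H t - H s ≤ H (a *ⁿ t) - H (a *ⁿ s)) ×
      (H (a *ⁿ t) - H (a *ⁿ s) + inv t ≤ H t - H s + inv s)
  go (≤′-reflexive refl) = r0 (H s) (H (a *ⁿ s)) , r0′ (H (a *ⁿ s)) (H s) (inv s)
  go (≤′-step {t} p) = subst (λ z → H t + inv (suc t) - H s ≤ z - H (a *ⁿ s)) (sym (H-block a t))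
      (r1 (H t) (H s) (H (a *ⁿ t)) (H (a *ⁿ s)) (inv (suc t)) _ (proj₁ (go p)) lo)
    , subst (λ z → z - H (a *ⁿ s) + inv (suc t) ≤ H t + inv (suc t) - H s + inv s) (sym (H-block a t))
        (r2 (H t) (H s) (H (a *ⁿ t)) (H (a *ⁿ s)) (inv (suc t)) _ (inv t) (inv s) (proj₂ (go p)) hi)
    where
    ht : 1 ≤ⁿ t
    ht = ℕP.≤-trans hs (ℕP.≤′⇒≤ p)
    hat : 1 ≤ⁿ a *ⁿ t
    hat = ℕP.*-mono-≤ ha ht
    lo : inv (suc t) ≤ Σ a (λ j → inv (a *ⁿ t +ⁿ j))
    lo = subst (_≤ Σ a (λ j → inv (a *ⁿ t +ⁿ j))) (ι*inv-* ha z<s)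
        (block-lo a hat (ℕP.≤-reflexive (trans (ℕP.+-comm (a *ⁿ t) a) (sym (ℕP.*-suc a t)))))
    hi : Σ a (λ j → inv (a *ⁿ t +ⁿ j)) ≤ inv t
    hi = subst (Σ a (λ j → inv (a *ⁿ t +ⁿ j)) ≤_) (ι*inv-* ha ht) (block-hi a hat ℕP.≤-refl)

sumL : (ℕ → ℚ) → List ℕ → ℚ
sumL f [] = 0ℚ
sumL f (p ∷ ps) = f p + sumL f ps

sumL-++ : ∀ f ps qs → sumL f (ps ++ qs) ≡ sumL f ps + sumL f qs
sumL-++ f [] qs = sym (+-identityˡ (sumL f qs))
sumL-++ f (p ∷ ps) qs = trans (cong (f p +_) (sumL-++ f ps qs)) (sym (+-assoc (f p) (sumL f ps) (sumL f qs)))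

sumL-↭ : ∀ f {ps qs} → ps ↭ qs → sumL f ps ≡ sumL f qs
sumL-↭ f Perm.refl = refl
sumL-↭ f (prep x h) = cong (f x +_) (sumL-↭ f h)
sumL-↭ f (swap {ps} {qs} x y h) = trans (cong (λ z → f x + (f y + z)) (sumL-↭ f h))
    (r (f x) (f y) (sumL f qs))
  where
  r : ∀ a b c → a + (b + c) ≡ b + (a + c)
  r = solve-∀ ℚR
sumL-↭ f (Perm.trans h k) = trans (sumL-↭ f h) (sumL-↭ f k)

-- The harmonic approximation Σ_{M < j ≤ nM} 1/j of log n is additive up to 1/M.
module Approx (M : ℕ) (hM : 1 ≤ⁿ M) where

  lam : ℕ → ℚ
  lam n = H (n *ⁿ M) - H M

  -- Summing `lam` over prime factors makes additivity exact, by unique factorisation; `ell-close`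
  -- bounds the price by `n / M`.
  ell : ℕ → ℚ
  ell n = sumL lam (fac n)

  ell-* : ∀ {a b} → 1 ≤ⁿ a → 1 ≤ⁿ b → ell (a *ⁿ b) ≡ ell a + ell b
  ell-* {a} {b} ha hb = trans (sumL-↭ lam (fac-* ha hb)) (sumL-++ lam (fac a) (fac b))

  lam-* : ∀ {a b} → 1 ≤ⁿ a → 1 ≤ⁿ b → (lam a + lam b ≤ lam (a *ⁿ b)) × (lam (a *ⁿ b) ≤ lam a + lam b + inv M)
  lam-* {a} {b} ha hb = subst (λ z → (lam a + lam b ≤ H z - H M) × (H z - H M ≤ lam a + lam b + inv M))
      (sym (ℕP.*-assoc a b M))
      (r1 (H (a *ⁿ M)) (H M) (H (b *ⁿ M)) (H (a *ⁿ (b *ⁿ M))) (proj₁ hs) , r2 (H (a *ⁿ M)) (H M) (H (b *ⁿ M))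
          (H (a *ⁿ (b *ⁿ M))) (inv (b *ⁿ M)) (inv M) (proj₂ hs) (inv≥0 (b *ⁿ M)))
    where
    hs = H-scale {a} {M} (b *ⁿ M) ha hM (ℕP.m≤n*m M b {{>-nonZero hb}})
    r1 : ∀ x y z w → z - y ≤ w - x → x - y + (z - y) ≤ w - y
    r1 x y z w p = lin p (solve (x ∷ y ∷ z ∷ w ∷ []) ℚR)
    r2 : ∀ x y z w i j → w - x + i ≤ z - y + j → 0ℚ ≤ i → w - y ≤ x - y + (z - y) + j
    r2 x y z w i j p q = lin (p +≤ q) (solve (x ∷ y ∷ z ∷ w ∷ i ∷ j ∷ []) ℚR)

  lam-1 : lam 1 ≡ 0ℚ
  lam-1 = trans (cong (λ z → H z - H M) (ℕP.*-identityˡ M)) (r (H M))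
    where
    r : ∀ a → a - a ≡ 0ℚ
    r = solve-∀ ℚR

  -- Every multiplication costs one defect `inv M` of `lam-*`. Counting defects by the product
  -- instead of the number of factors is crude but inductive, because `1 + P ≤ q * P`.
  close : ∀ ps → All Prime ps → (sumL lam ps ≤ lam (product ps)) ×
      (lam (product ps) ≤ sumL lam ps + ι (product ps) * inv M)
  close [] _ = ≤-reflexive (sym lam-1) , subst (_≤ 0ℚ + ι 1 * inv M) (sym lam-1)
      (+≥0 ≤-refl (*≥0 (ι≥0 1) (inv≥0 M)))
  close (q ∷ ps) (pq All.∷ prs) = ≤-trans (≤-refl {lam q} +≤ proj₁ ih) (proj₁ st) , ≤-trans (proj₂ st)
      (r (lam q) (lam P) (sumL lam ps) (inv M) (ι P) (ι (q *ⁿ P)) (proj₂ ih) (inv≥0 M) (ι-mono {suc P} grow))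
    where
    P = product ps
    hP = productOfPrimes≥1 prs
    ih = close ps prs
    st = lam-* {q} {P} (prime≥1 pq) hP
    grow : suc P ≤ⁿ q *ⁿ P
    grow = ℕP.≤-trans (ℕP.+-mono-≤ hP (ℕP.≤-reflexive (sym (ℕP.+-identityʳ P)))) (ℕP.*-monoˡ-≤ P (prime≥2 pq))
    r : ∀ a b s m p p′ → b ≤ s + p * m → 0ℚ ≤ m → 1ℚ + p ≤ p′ → a + b + m ≤ a + s + p′ * m
    r a b s m p p′ h hm hp = lin (h +≤ hm ·≤ hp) (solve (a ∷ b ∷ s ∷ m ∷ p ∷ p′ ∷ []) ℚR)

  ell≥0 : ∀ n → 0ℚ ≤ ell n
  ell≥0 n = go (fac n) (fac-prime n)
    where
    lam≥0 : ∀ {p} → 1 ≤ⁿ p → 0ℚ ≤ lam p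
    lam≥0 {p} hp = diff≥0 (Σ-grow inv (ℕP.m≤n*m M p {{>-nonZero hp}}) (λ i _ _ → inv≥0 i))
    go : ∀ ps → All Prime ps → 0ℚ ≤ sumL lam ps
    go [] _ = ≤-refl
    go (p ∷ ps) (pr All.∷ prs) = +≥0 (lam≥0 (prime≥1 pr)) (go ps prs)

  ell-close : ∀ {n} → 1 ≤ⁿ n → (ell n ≤ lam n) × (lam n ≤ ell n + ι n * inv M)
  ell-close {n} h = subst (λ z → (ell n ≤ lam z) × (lam z ≤ ell n + ι z * inv M)) (fac-product h)
      (close (fac n) (fac-prime n))

module Build (X : ℕ) where

  -- `M = 2 K = 4 (X + 1)³` makes the defect `(n + 1) / M` at most `1 / ((2 n + 1) (2 n + 2))` for
  -- all `n < X`. Being even, it allows a step of `lam` to be cut into two halves of length `K`.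
  K : ℕ
  K = suc X *ⁿ (suc X *ⁿ (2 *ⁿ suc X))

  M : ℕ
  M = K +ⁿ K

  hK : 1 ≤ⁿ K
  hK = s≤s z≤n

  open Approx M z<s

  lam-step : ∀ n → lam (suc n) ≡ lam n + (Σ K (λ j → inv (n *ⁿ M +ⁿ j)) + Σ K (λ j → inv (n *ⁿ M +ⁿ K +ⁿ j)))
  lam-step n = trans (cong (λ z → H z - H M) (ℕP.+-comm M (n *ⁿ M)))
      (trans (cong (_- H M) (trans (Σ-split (n *ⁿ M) (K +ⁿ K) inv)
      (cong (H (n *ⁿ M) +_) (trans (Σ-split K K (λ j → inv (n *ⁿ M +ⁿ j)))
      (cong (Σ K (λ j → inv (n *ⁿ M +ⁿ j)) +_) (Σ-cong K (λ j _ _ →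
      cong inv (sym (ℕP.+-assoc (n *ⁿ M) K j)))))))))
    (r (H (n *ⁿ M)) (H M) (Σ K (λ j → inv (n *ⁿ M +ⁿ j)) + Σ K (λ j → inv (n *ⁿ M +ⁿ K +ⁿ j)))))
    where
    r : ∀ a b c → a + c - b ≡ a - b + c
    r = solve-∀ ℚR

  nM : ∀ n K → n *ⁿ (K +ⁿ K) ≡ K *ⁿ (2 *ⁿ n)
  nM = NS.solve-∀

  nM+K : ∀ n K → n *ⁿ (K +ⁿ K) +ⁿ K ≡ K *ⁿ suc (2 *ⁿ n)
  nM+K = NS.solve-∀

  nM+K+K : ∀ n K → n *ⁿ (K +ⁿ K) +ⁿ K +ⁿ K ≡ K *ⁿ suc (suc (2 *ⁿ n))
  nM+K+K = NS.solve-∀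

  half : ∀ {n} → 1 ≤ⁿ n → inv (2 *ⁿ n) + inv (2 *ⁿ n) ≡ inv n
  half {n} h = trans (r (inv (2 *ⁿ n))) (ι*inv-* {2} z<s h)
    where
    r : ∀ a → a + a ≡ ι 2 * a
    r = solve-∀ ℚR

  ι*inv-≤ : ∀ {c m} → 1 ≤ⁿ c → 1 ≤ⁿ m → c *ⁿ m ≤ⁿ M → ι c * inv M ≤ inv m
  ι*inv-≤ {c} {m} hc hm h = ≤-trans (ι≥0 c ·≤ inv-anti (ℕP.*-mono-≤ hc hm) h) (≤-reflexive (ι*inv-* hc hm))

  bound : ∀ {n} → n <ⁿ X → suc n *ⁿ (suc (2 *ⁿ n) *ⁿ suc (suc (2 *ⁿ n))) ≤ⁿ M
  bound {n} h = ℕP.≤-trans (ℕP.*-mono-≤ (ℕP.≤-trans h (ℕP.n≤1+n X))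
      (ℕP.*-mono-≤ {y = 2 *ⁿ suc X} (ℕP.≤-trans (ℕP.n≤1+n _) b2) b2)) (ℕP.≤-reflexive (e (suc X)))
    where
    b2 : suc (suc (2 *ⁿ n)) ≤ⁿ 2 *ⁿ suc X
    b2 = subst (_≤ⁿ 2 *ⁿ suc X) (ℕP.*-suc 2 n) (ℕP.*-monoʳ-≤ 2 (ℕP.≤-trans h (ℕP.n≤1+n X)))
    e : ∀ x → x *ⁿ (2 *ⁿ x *ⁿ (2 *ⁿ x)) ≡ x *ⁿ (x *ⁿ (2 *ⁿ x)) +ⁿ x *ⁿ (x *ⁿ (2 *ⁿ x))
    e = NS.solve-∀

  bound′ : ∀ {n} → n <ⁿ X → n *ⁿ (2 *ⁿ n *ⁿ suc (2 *ⁿ n)) ≤ⁿ M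
  bound′ {n} h = ℕP.≤-trans (ℕP.*-mono-≤ (ℕP.n≤1+n n) (ℕP.*-mono-≤ (ℕP.n≤1+n (2 *ⁿ n)) (ℕP.n≤1+n _)))
      (bound h)

  -- Estimating the two halves of the harmonic block separately gives
  -- `1 / (2 n + 1) + 1 / (2 n + 2)`, which exceeds `1 / (n + 1)` by `1 / ((2 n + 1) (2 n + 2))`.
  -- This slack pays for passing from `lam` to `ell`; one estimate for the whole block would leave
  -- none.
  ell-lo : ∀ {n} → 1 ≤ⁿ n → n <ⁿ X → ell n + inv (suc n) ≤ ell (suc n)
  ell-lo {n} hn h = r (ell n) (ell (suc n)) (lam n) (lam (suc n)) _ _ (inv a) (inv (suc a)) (inv (suc n))
      (ι (suc n) * inv M)
      (proj₁ (ell-close hn)) (proj₂ (ell-close {suc n} z<s)) (lam-step n) b1 b2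
      (subst (ι (suc n) * inv M ≤_) (inv-* {a} {suc a} z<s z<s)
          (ι*inv-≤ {suc n} {a *ⁿ suc a} z<s z<s (bound h)))
      (inv-step {a} z<s) (subst (λ z → inv z + inv z ≡ inv (suc n)) (ℕP.*-suc 2 n) (half {suc n} z<s))
    where
    a = suc (2 *ⁿ n)
    hnM : 1 ≤ⁿ n *ⁿ M
    hnM = ℕP.*-mono-≤ hn z<s
    b1 : inv a ≤ Σ K (λ j → inv (n *ⁿ M +ⁿ j))
    b1 = subst (_≤ Σ K (λ j → inv (n *ⁿ M +ⁿ j))) (trans (cong (λ z → ι K * inv z) (nM+K n K))
        (ι*inv-* {K} {a} hK z<s)) (block-lo K {n *ⁿ M} hnM ℕP.≤-refl)
    b2 : inv (suc a) ≤ Σ K (λ j → inv (n *ⁿ M +ⁿ K +ⁿ j))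
    b2 = subst (_≤ Σ K (λ j → inv (n *ⁿ M +ⁿ K +ⁿ j))) (trans (cong (λ z → ι K * inv z) (nM+K+K n K))
        (ι*inv-* {K} {suc a} hK z<s)) (block-lo K {n *ⁿ M +ⁿ K} (ℕP.≤-trans hnM (ℕP.m≤m+n _ K)) ℕP.≤-refl)
    r0 : ∀ en es ln s t u w → en ≤ ln → u ≤ s → w ≤ t → ln + (s + t) ≤ es + u * w →
        en + (w + w) ≤ es + (w + u * w) - u
    r0 en es ln s t u w h1 h3 h4 h2 = lin (h1 +≤ h2 +≤ h3 +≤ h4)
        (solve (en ∷ es ∷ ln ∷ s ∷ t ∷ u ∷ w ∷ []) ℚR)
    r00 : ∀ e u → e + u - u ≡ e
    r00 = solve-∀ ℚR
    r : ∀ en es ln ls s t u w i c → en ≤ ln → ls ≤ es + c → ls ≡ ln + (s + t) → u ≤ s → w ≤ t → c ≤ u * w →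
        w + u * w ≡ u → w + w ≡ i → en + i ≤ es
    r en es ln ls s t u w i c h1 h2 refl h3 h4 h5 e1 refl = subst (en + (w + w) ≤_)
        (trans (cong (λ z → es + z - u) e1) (r00 es u)) (r0 en es ln s t u w h1 h3 h4
        (≤-trans h2 (≤-refl {es} +≤ h5)))

  -- As in `ell-lo`: the halves are at most `1 / (2 n)` and `1 / (2 n + 1)`, which leaves
  -- `1 / (2 n (2 n + 1))` below `1 / n`.
  ell-hi : ∀ {n} → 1 ≤ⁿ n → n <ⁿ X → ell (suc n) ≤ ell n + inv n
  ell-hi {n} hn h = r (ell n) (ell (suc n)) (lam n) (lam (suc n)) _ _ (inv a) (inv (suc a)) (inv n)
      (ι n * inv M)
      (proj₂ (ell-close hn)) (proj₁ (ell-close {suc n} z<s)) (lam-step n) b1 b2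
      (subst (ι n * inv M ≤_) (inv-* {a} {suc a} ha z<s) (ι*inv-≤ {n} {a *ⁿ suc a} hn (ℕP.*-mono-≤ ha z<s)
          (bound′ h)))
      (inv-step {a} ha) (half hn)
    where
    a = 2 *ⁿ n
    ha : 1 ≤ⁿ a
    ha = ℕP.≤-trans hn (ℕP.m≤m+n n _)
    hnM : 1 ≤ⁿ n *ⁿ M
    hnM = ℕP.*-mono-≤ hn z<s
    b1 : Σ K (λ j → inv (n *ⁿ M +ⁿ j)) ≤ inv a
    b1 = subst (Σ K (λ j → inv (n *ⁿ M +ⁿ j)) ≤_) (trans (cong (λ z → ι K * inv z) (nM n K))
        (ι*inv-* {K} {a} hK ha)) (block-hi K {n *ⁿ M} hnM ℕP.≤-refl)
    b2 : Σ K (λ j → inv (n *ⁿ M +ⁿ K +ⁿ j)) ≤ inv (suc a)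
    b2 = subst (Σ K (λ j → inv (n *ⁿ M +ⁿ K +ⁿ j)) ≤_) (trans (cong (λ z → ι K * inv z) (nM+K n K))
        (ι*inv-* {K} {suc a} hK z<s)) (block-hi K {n *ⁿ M +ⁿ K} (ℕP.≤-trans hnM (ℕP.m≤m+n _ K)) ℕP.≤-refl)
    r0 : ∀ en es ln s t u w → es ≤ ln + (s + t) → s ≤ u → t ≤ w → ln ≤ en + u * w → es ≤ en + u + (w + u * w)
    r0 en es ln s t u w h2 h3 h4 h1 = lin (h1 +≤ h2 +≤ h3 +≤ h4)
        (solve (en ∷ es ∷ ln ∷ s ∷ t ∷ u ∷ w ∷ []) ℚR)
    r : ∀ en es ln ls s t u w i c → ln ≤ en + c → es ≤ ls → ls ≡ ln + (s + t) → s ≤ u → t ≤ w → c ≤ u * w →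
        w + u * w ≡ u → u + u ≡ i → es ≤ en + i
    r en es ln ls s t u w i c h1 h2 refl h3 h4 h5 e1 refl = subst (es ≤_)
        (trans (cong (en + u +_) e1) (+-assoc en u u)) (r0 en es ln s t u w h2 h3 h4
        (≤-trans h1 (≤-refl {en} +≤ h5)))

  logSystem : LogSystem X
  logSystem = record { ℓ = ell ; ℓ-* = ell-* ; ℓ≥0 = ell≥0 ; ℓ-lo = ell-lo ; ℓ-hi = ell-hi }

-- Bounds on absolute values; search

infix 4 ∣_∣≤_

-- Two inequalities instead of `ℚ.∣_∣`, so that each half can be fed to `lin`; `∣∣-<` translates at
-- the end.
∣_∣≤_ : ℚ → ℚ → Set
∣ u ∣≤ a = (- a ≤ u) × (u ≤ a)

abs-+ : ∀ {u v a b} → ∣ u ∣≤ a → ∣ v ∣≤ b → ∣ u + v ∣≤ a + b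
abs-+ {u} {v} {a} {b} (p , q) (p′ , q′) = lin (p +≤ p′) (solve (u ∷ v ∷ a ∷ b ∷ []) ℚR) , q +≤ q′

abs-mono : ∀ {u a b} → ∣ u ∣≤ a → a ≤ b → ∣ u ∣≤ b
abs-mono (p , q) h = ≤-trans (neg-≤ h) p , ≤-trans q h

abs-neg : ∀ {u a} → ∣ u ∣≤ a → ∣ - u ∣≤ a
abs-neg {u} {a} (p , q) = neg-≤ q , lin p (solve (u ∷ a ∷ []) ℚR)

abs-- : ∀ {u v a b} → ∣ u ∣≤ a → ∣ v ∣≤ b → ∣ u - v ∣≤ a + b
abs-- h k = abs-+ h (abs-neg k)

abs-≥0 : ∀ {u a} → ∣ u ∣≤ a → 0ℚ ≤ a
abs-≥0 {u} {a} (p , q) = ι-cancelˡ {2} z<s (lin (p +≤ q) (solve (u ∷ a ∷ []) ℚR))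

-- No case distinction on signs: `2 (a b - u v) = (a + u) (b - v) + (a - u) (b +
-- v)`, and likewise for `a b + u v`.
abs-* : ∀ {u v a b} → ∣ u ∣≤ a → ∣ v ∣≤ b → ∣ u * v ∣≤ a * b
abs-* {u} {v} {a} {b} (p , q) (p′ , q′) =
    ι-cancelˡ {2} z<s (lin (*≥0 (diff≥0 p) (diff≥0 p′) +≤ *≥0 (diff≥0 q) (diff≥0 q′))
        (solve (u ∷ v ∷ a ∷ b ∷ []) ℚR))
  , ι-cancelˡ {2} z<s (lin (*≥0 (diff≥0 q) (diff≥0 p′) +≤ *≥0 (diff≥0 p) (diff≥0 q′))
      (solve (u ∷ v ∷ a ∷ b ∷ []) ℚR))

abs-scale : ∀ {c u a} → 0ℚ ≤ c → ∣ u ∣≤ a → ∣ c * u ∣≤ c * a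
abs-scale {c} {u} {a} h (p , q) = lin (h ·≤ p) (solve (c ∷ u ∷ a ∷ []) ℚR) , h ·≤ q

abs-0 : ∣ 0ℚ ∣≤ 0ℚ
abs-0 = ≤-refl , ≤-refl

abs-Σ : ∀ n {f g : ℕ → ℚ} → (∀ i → 1 ≤ⁿ i → i ≤ⁿ n → ∣ f i ∣≤ g i) → ∣ Σ n f ∣≤ Σ n g
abs-Σ zero h = abs-0
abs-Σ (suc n) h = abs-+ (abs-Σ n (λ i a b → h i a (ℕP.m≤n⇒m≤1+n b))) (h (suc n) z<s ℕP.≤-refl)

abs-nonneg : ∀ {u a} → 0ℚ ≤ u → u ≤ a → ∣ u ∣≤ a
abs-nonneg {u} {a} h k = lin (h +≤ ≤-trans h k) (solve (u ∷ a ∷ []) ℚR) , k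

÷-glb : ∀ {x k m} → 1 ≤ⁿ k → k *ⁿ m ≤ⁿ x → m ≤ⁿ x ÷ k
÷-glb {x} {suc k} {m} hk h = ℕP.≤-pred (ℕP.*-cancelˡ-< (suc k) m (suc (x ÷ suc k))
    (ℕP.≤-<-trans h (÷-hi x hk)))

÷-lub : ∀ {x k m} → m ≤ⁿ x ÷ k → k *ⁿ m ≤ⁿ x
÷-lub {x} {k} h = ℕP.≤-trans (ℕP.*-monoʳ-≤ k h) (÷-lo x k)

Σ-trunc : ∀ {m n} (f : ℕ → ℚ) → m ≤ⁿ n → Σ m f ≡ Σ n (λ i → χ (i ℕP.≤? m) * f i)
Σ-trunc {m} {n} f h = sym (trans (Σ-extend _ h (λ i a _ → trans (cong (_* f i) (χ-no (i ℕP.≤? m) (ℕP.<⇒≱ a)))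
    (*-zeroˡ (f i))))
  (Σ-cong m (λ i _ b → trans (cong (_* f i) (χ-yes (i ℕP.≤? m) b)) (*-identityˡ (f i)))))

Σ-hyperbola : ∀ x (f : ℕ → ℕ → ℚ) → Σ x (λ a → Σ (x ÷ a) (λ b → f a b)) ≡ Σ x (λ b → Σ (x ÷ b) (λ a → f a b))
Σ-hyperbola x f = trans (Σ-cong x (λ a _ _ → Σ-trunc (f a) (÷≤ x a)))
  (trans (Σ-swap x x (λ a b → χ (b ℕP.≤? x ÷ a) * f a b))
    (Σ-cong x (λ b hb _ → trans (Σ-cong x (λ a ha _ → cong (_* f a b)
        (χ-⇔ (b ℕP.≤? x ÷ a) (a ℕP.≤? x ÷ b) (flip ha hb) (flip hb ha))))
        (sym (Σ-trunc (λ a → f a b) (÷≤ x b))))))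
  where
  flip : ∀ {a b} → 1 ≤ⁿ a → 1 ≤ⁿ b → b ≤ⁿ x ÷ a → a ≤ⁿ x ÷ b
  flip {a} {b} ha hb h = ÷-glb hb (subst (_≤ⁿ x) (ℕP.*-comm a b) (÷-lub {x} {a} h))

halving : ∀ x → ∃ λ h → (x ≡ h +ⁿ h) ⊎ (x ≡ suc (h +ⁿ h))
halving zero = 0 , inj₁ refl
halving (suc x) = go (halving x)
  where
  go : (∃ λ h → (x ≡ h +ⁿ h) ⊎ (x ≡ suc (h +ⁿ h))) → ∃ λ h → (suc x ≡ h +ⁿ h) ⊎ (suc x ≡ suc (h +ⁿ h))
  go (h , inj₁ e) = h , inj₂ (cong suc e)
  go (h , inj₂ e) = suc h , inj₁ (trans (cong suc e) (cong suc (sym (ℕP.+-suc h h))))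

first : ∀ {P : ℕ → Set} → (∀ m → Dec (P m)) → ∀ y j →
  (∃ λ m → (y <ⁿ m) × (m ≤ⁿ y +ⁿ j) × P m × (∀ u → y <ⁿ u → u <ⁿ m → ¬ P u)) ⊎ (∀ m → y <ⁿ m → m ≤ⁿ y +ⁿ j →
      ¬ P m)
first P? y zero = inj₂ (λ m a b → ⊥-elim (ℕP.<⇒≱ a (subst (m ≤ⁿ_) (ℕP.+-identityʳ y) b)))
first {P} P? y (suc j) = go (first P? y j) (P? (y +ⁿ suc j))
  where
  go : (∃ λ m → (y <ⁿ m) × (m ≤ⁿ y +ⁿ j) × P m × (∀ u → y <ⁿ u → u <ⁿ m → ¬ P u)) ⊎
      (∀ m → y <ⁿ m → m ≤ⁿ y +ⁿ j → ¬ P m) → Dec (P (y +ⁿ suc j)) →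
    (∃ λ m → (y <ⁿ m) × (m ≤ⁿ y +ⁿ suc j) × P m × (∀ u → y <ⁿ u → u <ⁿ m → ¬ P u)) ⊎
        (∀ m → y <ⁿ m → m ≤ⁿ y +ⁿ suc j → ¬ P m)
  go (inj₁ (m , a , b , p , l)) _ = inj₁ (m , a , ℕP.≤-trans b (ℕP.+-monoʳ-≤ y (ℕP.n≤1+n j)) , p , l)
  go (inj₂ none) (yes p) = inj₁ (y +ⁿ suc j , ℕP.m<m+n y z<s , ℕP.≤-refl , p , λ u a b →
      none u a (ℕP.≤-pred (subst (u <ⁿ_) (ℕP.+-suc y j) b)))
  go (inj₂ none) (no ¬p) = inj₂ (λ m a b → last m a (ℕP.m≤n⇒m<n∨m≡n b))
    where
    last : ∀ m → y <ⁿ m → m <ⁿ y +ⁿ suc j ⊎ m ≡ y +ⁿ suc j → ¬ P m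
    last m a (inj₁ lt) = none m a (ℕP.≤-pred (subst (m <ⁿ_) (ℕP.+-suc y j) lt))
    last m a (inj₂ refl) = ¬p

Σ-range : ∀ {y z} (f g : ℕ → ℚ) → y ≤ⁿ z → (∀ m → y <ⁿ m → m ≤ⁿ z → f m ≤ g m) → Σ z f - Σ y f ≤ Σ z g - Σ y g
Σ-range {y} {z} f g h = go (ℕP.≤⇒≤′ h)
  where
  r : ∀ a b c d u v → a - b ≤ c - d → u ≤ v → a + u - b ≤ c + v - d
  r a b c d u v p q = lin (p +≤ q) (solve (a ∷ b ∷ c ∷ d ∷ u ∷ v ∷ []) ℚR)
  r0 : ∀ a b → a - a ≤ b - b
  r0 a b = ≤-reflexive (solve (a ∷ b ∷ []) ℚR)
  go : ∀ {z} → y ≤′ z → (∀ m → y <ⁿ m → m ≤ⁿ z → f m ≤ g m) → Σ z f - Σ y f ≤ Σ z g - Σ y g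
  go (≤′-reflexive refl) _ = r0 (Σ y f) (Σ y g)
  go (≤′-step {z} p) k = r (Σ z f) (Σ y f) (Σ z g) (Σ y g) (f (suc z)) (g (suc z))
      (go p (λ m a b → k m a (ℕP.m≤n⇒m≤1+n b))) (k (suc z) (s≤s (ℕP.≤′⇒≤ p)) ℕP.≤-refl)

-- The exponent is twice `12 N + 3`: as `ℓ 2 ≥ 1/2`, this gives `ℓ (K₀ N) ≥ 12 N + 3`, whereas a run
-- as in `no-run` would force `ℓ (K₀ N) ≤ 12 N + 2`.
K₀ : ℕ → ℕ
K₀ N = 2 ^ⁿ (24 *ⁿ N +ⁿ 6)

K₀≥1 : ∀ N → 1 ≤ⁿ K₀ N
K₀≥1 N = 1≤p^k (24 *ⁿ N +ⁿ 6) z<s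

y≤K₀y : ∀ N y → y ≤ⁿ K₀ N *ⁿ y
y≤K₀y N y = ℕP.m≤n*m y (K₀ N) {{>-nonZero (K₀≥1 N)}}

-- Two searches of ratio `K₀ N` in a row, with a factor 2 for the stretch between them: in
-- `good-interval` the points satisfy `m ≤ K₀ y`, `s ≤ 2 K₀ y` and `t ≤ K₀ s`.
K : ℕ → ℕ
K N = 2 *ⁿ (K₀ N *ⁿ K₀ N)

K≥1 : ∀ N → 1 ≤ⁿ K N
K≥1 N = ℕP.*-mono-≤ {1} {2} z<s (ℕP.*-mono-≤ (K₀≥1 N) (K₀≥1 N))

-- Scales of ratio `K N`. The start `4 N + 1` makes the good intervals found above a scale nonempty:
-- for `a ≥ 4 N + 1` the bound `a ≤ 4 N (d + 1)` excludes `d = 0`.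
grid : ℕ → ℕ → ℕ
grid N j = K N ^ⁿ j *ⁿ suc (4 *ⁿ N)

grid-suc : ∀ N j → K N *ⁿ grid N j ≡ grid N (suc j)
grid-suc N j = sym (ℕP.*-assoc (K N) (K N ^ⁿ j) (suc (4 *ⁿ N)))

grid-≥ : ∀ N j → suc (4 *ⁿ N) ≤ⁿ grid N j
grid-≥ N j = ℕP.m≤n*m (suc (4 *ⁿ N)) (K N ^ⁿ j) {{>-nonZero (1≤p^k j (K≥1 N))}}

grid-mono : ∀ N {i j} → i ≤ⁿ j → grid N i ≤ⁿ grid N j
grid-mono N h = ℕP.*-monoˡ-≤ (suc (4 *ⁿ N)) (ℕP.^-monoʳ-≤ (K N) {{>-nonZero (K≥1 N)}} h)

grid-≥1 : ∀ N j → 1 ≤ⁿ grid N j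
grid-≥1 N j = ℕP.≤-trans z<s (grid-≥ N j)

transition : ∀ {P : ℕ → Set} → (∀ m → Dec (P m)) → P 0 → ∀ n → ¬ P n → ∃ λ j → P j × ¬ P (suc j)
transition P? p₀ zero ¬p = ⊥-elim (¬p p₀)
transition {P} P? p₀ (suc n) ¬p = go (P? n)
  where
  go : Dec (P n) → ∃ λ j → P j × ¬ P (suc j)
  go (yes p) = n , p , ¬p
  go (no ¬q) = transition P? p₀ n ¬q

cancel-≤ : ∀ {c a b} → 1ℚ ≤ c → c * a ≤ c * b → a ≤ b
cancel-≤ {c} h k = ℚP.*-cancelˡ-≤-pos c {{ℚ.positive (<-≤-trans 0<1 h)}} k

-- The reciprocal is the proportion of `ℓ(x)²` that `saving` secures: at least `ℓ(x) / (4 K)`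
-- scales, each worth `ℓ(x) / (2 * 10 N)`.
C : ℕ → ℕ
C N = 8 *ⁿ K N *ⁿ (10 *ⁿ N)

C≥1 : ∀ {N} → 1 ≤ⁿ N → 1 ≤ⁿ C N
C≥1 {N} h = ℕP.*-mono-≤ (ℕP.≤-trans (K≥1 N) (ℕP.m≤m+n (K N) _)) (ℕP.≤-trans h (ℕP.m≤m+n N _))

-- Goldbach partitions as pairs of odd primes

oddPrime? : ∀ k → Dec ((3 ≤ⁿ k) × Prime k)
oddPrime? k = (3 ℕ.≤? k) ×-dec prime? k

o : ℕ → ℚ
o k = χ (oddPrime? k)

o≥0 : ∀ k → 0ℚ ≤ o k
o≥0 k = χ≥0 (oddPrime? k)

o-0 : o 0 ≡ 0ℚ
o-0 = χ-no (oddPrime? 0) (λ { (() , _) })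

even-not : ∀ h → o (h +ⁿ h) ≡ 0ℚ
even-not h = χ-no (oddPrime? (h +ⁿ h)) bad
  where
  bad : ¬ ((3 ≤ⁿ h +ⁿ h) × Prime (h +ⁿ h))
  bad (h3 , pr) = go (prime⇒irreducible pr (divides h (trans (cong (h +ⁿ_) (sym (ℕP.+-identityʳ h)))
      (ℕP.*-comm 2 h))))
    where
    go : 2 ≡ 1 ⊎ 2 ≡ h +ⁿ h → ⊥
    go (inj₂ e) = ℕP.<⇒≢ h3 e

Conv : (ℕ → ℚ) → (ℕ → ℚ) → ℕ → ℚ
Conv f g s = Σ s (λ p → f p * g (s ∸ⁿ p))

pairSum : (ℕ → ℚ) → (ℕ → ℚ) → ℕ → ℚ
pairSum f g x = Σ x (λ p → f p * Σ (x ∸ⁿ p) g)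

suc-∸ : ∀ {x p} → p ≤ⁿ x → suc x ∸ⁿ p ≡ suc (x ∸ⁿ p)
suc-∸ h = ℕP.+-∸-assoc 1 h

-- Pairs are grouped by their sum. The hypothesis on `g 0` disposes of the terms `p = s` of `Conv`,
-- which `pairSum` does not contain.
Σ-Conv : ∀ f g → g 0 ≡ 0ℚ → ∀ x → Σ x (Conv f g) ≡ pairSum f g x
Σ-Conv f g g0 zero = refl
Σ-Conv f g g0 (suc x) = trans (cong (_+ Conv f g (suc x)) (Σ-Conv f g g0 x))
    (trans (r (pairSum f g x) (Σ x (λ p → f p * g (suc x ∸ⁿ p))) (f (suc x)) (g (x ∸ⁿ x))
    (trans (cong g (ℕP.n∸n≡0 x)) g0))
  (cong₂ _+_ (trans (sym (Σ-+ x (λ p → f p * Σ (x ∸ⁿ p) g) (λ p → f p * g (suc x ∸ⁿ p)))) (Σ-cong x term))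
      (sym (trans (cong (λ z → f (suc x) * Σ z g) (ℕP.n∸n≡0 x)) (*-zeroʳ (f (suc x)))))))
  where
  r0 : ∀ a b c → a + (b + c * 0ℚ) ≡ a + b + 0ℚ
  r0 = solve-∀ ℚR
  r : ∀ a b c g → g ≡ 0ℚ → a + (b + c * g) ≡ a + b + 0ℚ
  r a b c g refl = r0 a b c
  term : ∀ p → 1 ≤ⁿ p → p ≤ⁿ x → f p * Σ (x ∸ⁿ p) g + f p * g (suc x ∸ⁿ p) ≡ f p * Σ (suc x ∸ⁿ p) g
  term p _ h = trans (cong (λ z → f p * Σ (x ∸ⁿ p) g + f p * g z) (suc-∸ h))
      (trans (sym (*-distribˡ-+ (f p) (Σ (x ∸ⁿ p) g) (g (suc (x ∸ⁿ p)))))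
      (cong (λ z → f p * Σ z g) (sym (suc-∸ h))))

-- One of two numbers with odd sum is even, and `o` vanishes there.
Conv-odd : ∀ h → Conv o o (suc (h +ⁿ h)) ≡ 0ℚ
Conv-odd h = trans (Σ-cong s (λ p _ ps → term p ps (halving p))) (Σ-0 s)
  where
  s = suc (h +ⁿ h)
  term : ∀ p → p ≤ⁿ s → (∃ λ k → (p ≡ k +ⁿ k) ⊎ (p ≡ suc (k +ⁿ k))) → o p * o (s ∸ⁿ p) ≡ 0ℚ
  term p _ (k , inj₁ refl) = trans (cong (_* o (s ∸ⁿ p)) (even-not k)) (*-zeroˡ (o (s ∸ⁿ p)))
  term p ps (k , inj₂ refl) = trans (cong (o p *_) (trans (cong o e) (even-not (h ∸ⁿ k)))) (*-zeroʳ (o p))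
    where
    k≤h : k ≤ⁿ h
    k≤h = ℕP.≮⇒≥ λ lt → ℕP.<⇒≱ (ℕP.+-mono-<-≤ lt (ℕP.<⇒≤ lt)) (ℕP.≤-pred ps)
    e : (h +ⁿ h) ∸ⁿ (k +ⁿ k) ≡ (h ∸ⁿ k) +ⁿ (h ∸ⁿ k)
    e = trans (cong₂ (λ a b → (a +ⁿ b) ∸ⁿ (k +ⁿ k)) (sym (ℕP.m+[n∸m]≡n k≤h)) (sym (ℕP.m+[n∸m]≡n k≤h)))
        (trans (cong (_∸ⁿ (k +ⁿ k)) (e2 k (h ∸ⁿ k))) (ℕP.m+n∸m≡n (k +ⁿ k) _))
      where
      e2 : ∀ k j → k +ⁿ j +ⁿ (k +ⁿ j) ≡ k +ⁿ k +ⁿ (j +ⁿ j)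
      e2 = NS.solve-∀

Σ-rev : ∀ k (f : ℕ → ℚ) → Σ k (λ j → f (k ∸ⁿ j)) + f k ≡ Σ k f + f 0
Σ-rev zero f = refl
Σ-rev (suc k) f = trans (cong (_+ f (suc k)) (trans (Σ-head k (λ j → f (suc k ∸ⁿ j)))
    (trans (+-comm (f k) _) (Σ-rev k f)))) (r (Σ k f) (f 0) (f (suc k)))
  where
  r : ∀ a b c → a + b + c ≡ a + c + b
  r = solve-∀ ℚR

Σ-term : ∀ {n k} (f : ℕ → ℚ) → 1 ≤ⁿ k → k ≤ⁿ n → (∀ i → 0ℚ ≤ f i) → f k ≤ Σ n f
Σ-term {n} {suc k} f _ h z = ≤-trans (subst (_≤ Σ k f + f (suc k)) (+-identityˡ (f (suc k)))
    (Σ-≥0 k (λ i _ _ → z i) +≤ ≤-refl {f (suc k)})) (Σ-grow f h (λ i _ _ → z i))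

length-filter : ∀ {P : ℕ → Set} (P? : Decidable P) (f : ℕ → ℕ) m → ι (length (filter P? (applyUpTo f m))) ≡
    Σ m (λ i → χ (P? (f (pred i))))
length-filter P? f zero = refl
length-filter {P} P? f (suc m) = trans (go (P? (f 0))) (sym (Σ-head m (λ i → χ (P? (f (pred i))))))
  where
  ih : ι (length (filter P? (applyUpTo (λ i → f (suc i)) m))) ≡ Σ m (λ i → χ (P? (f i)))
  ih = trans (length-filter P? (λ i → f (suc i)) m) (Σ-cong m (λ { (suc i) _ _ → refl }))
  go : Dec (P (f 0)) → ι (length (filter P? (f 0 ∷ applyUpTo (λ i → f (suc i)) m))) ≡ χ (P? (f 0)) + Σ m
      (λ i → χ (P? (f i)))
  go (yes p) = trans (cong (λ l → ι (length l)) (LP.filter-accept P? p))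
      (cong₂ _+_ (sym (χ-yes (P? (f 0)) p)) ih)
  go (no ¬p) = trans (cong (λ l → ι (length l)) (LP.filter-reject P? ¬p))
      (trans ih (trans (sym (+-identityˡ _)) (cong (_+ Σ m (λ i → χ (P? (f i)))) (sym (χ-no (P? (f 0)) ¬p)))))

ι-sum : ∀ (g f : ℕ → ℕ) m → ι (sum (map g (applyUpTo f m))) ≡ Σ m (λ i → ι (g (f (pred i))))
ι-sum g f zero = refl
ι-sum g f (suc m) = trans (ι-+ (g (f 0)) _) (trans (cong (ι (g (f 0)) +_)
    (trans (ι-sum g (λ i → f (suc i)) m) (Σ-cong m (λ { (suc i) _ _ → refl }))))
    (sym (Σ-head m (λ i → ι (g (f (pred i)))))))

ι-range : ∀ (g : ℕ → ℕ) → g 1 ≡ 0 → g 2 ≡ 0 → ∀ n → ι (sum (map g (range n))) ≡ Σ n (λ k → ι (g k))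
ι-range g g1 g2 zero = refl
ι-range g g1 g2 (suc zero) = sym (trans (+-identityˡ (ι (g 1))) (cong ι g1))
ι-range g g1 g2 (suc (suc n)) = trans (cong (λ l → ι (sum l)) (sym (LP.map-∘ (upTo n))))
    (trans (ι-sum (λ i → g (3 +ⁿ i)) (λ i → i) n)
  (trans (Σ-cong n (λ { (suc i) _ _ → refl })) (sym (trans (Σ-head (suc n) (λ k → ι (g k)))
      (trans (cong₂ _+_ (cong ι g1) (trans (Σ-head n (λ k → ι (g (suc k))))
      (trans (cong (λ z → ι z + Σ n (λ i → ι (g (2 +ⁿ i)))) g2) (+-identityˡ (Σ n (λ i → ι (g (2 +ⁿ i))))))))
      (+-identityˡ (Σ n (λ i → ι (g (2 +ⁿ i))))))))))

card-Σ : ∀ n → ι (card n) ≡ Σ n (λ k → ι (Q₂ k))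
card-Σ = ι-range Q₂ refl refl

moment-Σ : ∀ j n → ι (moment j n) ≡ Σ n (λ k → ι (k ^ⁿ j *ⁿ Q₂ k))
moment-Σ j = ι-range (λ k → k ^ⁿ j *ⁿ Q₂ k) (ℕP.*-zeroʳ (1 ^ⁿ j)) (ℕP.*-zeroʳ (2 ^ⁿ j))

Q₂-Σ : ∀ k → ι (Q₂ k) ≡ Σ k (λ p → o p * o (k +ⁿ k ∸ⁿ p))
Q₂-Σ k = trans (length-filter P? (λ i → i) (suc k)) (trans (Σ-head k (λ i → χ (P? (pred i))))
    (trans (cong (_+ Σ k (λ p → χ (P? p))) (χ-no (P? 0) (λ { (() , _) })))
    (trans (+-identityˡ _) (Σ-cong k term))))
  where
  P? : Decidable (λ p → (3 ≤ⁿ p) × (p ≤ⁿ k) × Prime p × Prime (2 *ⁿ k ∸ⁿ p))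
  P? p = (3 ℕ.≤? p) ×-dec ((p ℕ.≤? k) ×-dec (prime? p ×-dec prime? (2 *ⁿ k ∸ⁿ p)))
  e2 : 2 *ⁿ k ≡ k +ⁿ k
  e2 = cong (k +ⁿ_) (ℕP.+-identityʳ k)
  term : ∀ p → 1 ≤ⁿ p → p ≤ⁿ k → χ (P? p) ≡ o p * o (k +ⁿ k ∸ⁿ p)
  term p _ pk = subst (λ z → χ (P? p) ≡ o p * o (z ∸ⁿ p)) e2 (go (oddPrime? p) (oddPrime? (2 *ⁿ k ∸ⁿ p)))
    where
    go : (a : Dec ((3 ≤ⁿ p) × Prime p)) (b : Dec ((3 ≤ⁿ 2 *ⁿ k ∸ⁿ p) × Prime (2 *ⁿ k ∸ⁿ p))) →
        χ (P? p) ≡ χ a * χ b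
    go (yes (h3 , pp)) (yes (_ , pq)) = χ-yes (P? p) (h3 , pk , pp , pq)
    go (no ¬a) b = trans (χ-no (P? p) (λ { (h3 , _ , pp , _) → ¬a (h3 , pp) })) (sym (*-zeroˡ (χ b)))
    -- `2 k - p ≥ k ≥ p ≥ 3`, so a prime complement is automatically an odd prime.
    go (yes (h3 , pp)) (no ¬b) = χ-no (P? p) (λ { (_ , _ , _ , pq) →
        ¬b (ℕP.≤-trans h3 (ℕP.≤-trans pk le) , pq) })
      where
      le : k ≤ⁿ 2 *ⁿ k ∸ⁿ p
      le = subst (λ z → k ≤ⁿ z ∸ⁿ p) (sym e2) (subst (k ≤ⁿ_) (sym (ℕP.+-∸-assoc k pk)) (ℕP.m≤m+n k (k ∸ⁿ p)))

o² : ∀ k → o k * o k ≡ o k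
o² k = go (oddPrime? k)
  where
  go : ∀ {P : Set} (d : Dec P) → χ d * χ d ≡ χ d
  go (yes _) = refl
  go (no _) = refl

-- The reflection `p ↦ 2 k - p` carries the half above `k` to the half below. Its fixed point
-- `p = k` is counted once by `Conv`, and `o k` supplies the second copy.
Conv-even : ∀ k → Conv o o (k +ⁿ k) + o k ≡ ι (Q₂ k) + ι (Q₂ k)
Conv-even k = trans (cong (_+ o k) (trans (Σ-split k k f) (cong (Σ k f +_) (Σ-cong k refl-term))))
    (trans (+-assoc (Σ k f) (Σ k (λ j → f (k ∸ⁿ j))) (o k)) (cong₂ _+_ (sym (Q₂-Σ k))
  (trans (cong (Σ k (λ j → f (k ∸ⁿ j)) +_) (sym fk)) (trans (Σ-rev k f)
      (trans (cong (Σ k f +_) f0) (trans (+-identityʳ (Σ k f)) (sym (Q₂-Σ k))))))))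
  where
  f : ℕ → ℚ
  f p = o p * o (k +ⁿ k ∸ⁿ p)
  fk : f k ≡ o k
  fk = trans (cong (λ z → o k * o z) (ℕP.m+n∸m≡n k k)) (o² k)
  f0 : f 0 ≡ 0ℚ
  f0 = trans (cong (_* o (k +ⁿ k)) o-0) (*-zeroˡ (o (k +ⁿ k)))
  refl-term : ∀ j → 1 ≤ⁿ j → j ≤ⁿ k → f (k +ⁿ j) ≡ f (k ∸ⁿ j)
  refl-term j _ h = trans (*-comm (o (k +ⁿ j)) (o (k +ⁿ k ∸ⁿ (k +ⁿ j))))
      (cong₂ (λ a b → o a * o b) (ℕP.[m+n]∸[m+o]≡n∸o k k j) e)
    where
    e : k +ⁿ j ≡ k +ⁿ k ∸ⁿ (k ∸ⁿ j)
    e = sym (trans (ℕP.+-∸-assoc k (ℕP.m∸n≤m k j)) (cong (k +ⁿ_) (ℕP.m∸[m∸n]≡n h)))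

pairs : ∀ t → pairSum o o (t +ⁿ t) + Σ t o ≡ ι 2 * ι (card t)
pairs t = trans (cong (_+ Σ t o) (sym (Σ-Conv o o o-0 (t +ⁿ t))))
    (trans (go t) (cong (ι 2 *_) (sym (card-Σ t))))
  where
  r1 : ∀ c e s o′ q q′ → c + s ≡ ι 2 * q → e + o′ ≡ q′ + q′ → c + 0ℚ + e + (s + o′) ≡ ι 2 * (q + q′)
  r1 c e s o′ q q′ p₁ p₂ = trans (r2 c e s o′) (trans (cong₂ _+_ p₁ p₂) (r3 q q′))
    where
    r2 : ∀ c e s o′ → c + 0ℚ + e + (s + o′) ≡ (c + s) + (e + o′)
    r2 = solve-∀ ℚR
    r3 : ∀ q q′ → ι 2 * q + (q′ + q′) ≡ ι 2 * (q + q′)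
    r3 = solve-∀ ℚR
  go : ∀ t → Σ (t +ⁿ t) (Conv o o) + Σ t o ≡ ι 2 * Σ t (λ k → ι (Q₂ k))
  go zero = refl
  go (suc t) = trans (cong (λ z → Σ (suc z) (Conv o o) + Σ (suc t) o) (ℕP.+-suc t t))
    (trans (cong (λ z → Σ (t +ⁿ t) (Conv o o) + z + Conv o o (suc (suc (t +ⁿ t))) + (Σ t o + o (suc t)))
        (Conv-odd t))
      (r1 (Σ (t +ⁿ t) (Conv o o)) (Conv o o (suc (suc (t +ⁿ t)))) (Σ t o) (o (suc t)) (Σ t (λ k → ι (Q₂ k)))
          (ι (Q₂ (suc t))) (go t) (subst (λ z → Conv o o (suc z) + o (suc t) ≡ ι (Q₂ (suc t)) + ι
          (Q₂ (suc t))) (ℕP.+-suc t t) (Conv-even (suc t)))))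

-- Chosen for `ℓ (z₀ M) ≥ 4 M`: primes beyond it carry weight at least `4 M`, so Chebyshev's bound
-- `W j ≤ 4 j` leaves at most `j / M` of them up to `j`.
z₀ : ℕ → ℕ
z₀ M = 2 ^ⁿ (8 *ⁿ M)

C₂ : ℕ → ℕ
C₂ M = z₀ M *ⁿ (M *ⁿ z₀ M +ⁿ 3)

isqrt : ∀ x → ∃ λ s → (s *ⁿ s ≤ⁿ x) × (x <ⁿ suc s *ⁿ suc s)
isqrt x = go (transition (λ s → s *ⁿ s ℕP.≤? x) z≤n (suc x) (ℕP.<⇒≱
    (ℕP.≤-trans (ℕP.n<1+n x) (ℕP.m≤m*n (suc x) (suc x)))))
  where
  go : (∃ λ s → (s *ⁿ s ≤ⁿ x) × ¬ (suc s *ⁿ suc s ≤ⁿ x)) → ∃ λ s → (s *ⁿ s ≤ⁿ x) × (x <ⁿ suc s *ⁿ suc s)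
  go (s , a , b) = s , a , ℕP.≰⇒> b

C₁ : ℕ → ℕ
C₁ M = M *ⁿ (2 *ⁿ (M +ⁿ 2)) *ⁿ (2 *ⁿ (M +ⁿ 2))

module Estimates {X : ℕ} (S : LogSystem X) (2≤X : 2 ≤ⁿ X) where

  open LogSystem S
  open Mangoldt ℓ ℓ-*

  -- Chebyshev and Mertens

  ψ : ℕ → ℚ
  ψ n = Σ n Λ

  T : ℕ → ℚ
  T n = Σ n ℓ

  R : ℕ → ℚ
  R n = ψ n - ι n

  Λ-nonneg : ∀ n → 0ℚ ≤ Λ n
  Λ-nonneg = Λ≥0 ℓ≥0

  ψ≥0 : ∀ n → 0ℚ ≤ ψ n
  ψ≥0 n = Σ-≥0 n (λ i _ _ → Λ-nonneg i)

  ψ-mono : ∀ {m n} → m ≤ⁿ n → ψ m ≤ ψ n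
  ψ-mono h = Σ-grow Λ h (λ i _ _ → Λ-nonneg i)

  ℓ-mono : ∀ {m n} → 1 ≤ⁿ m → m ≤ⁿ n → n ≤ⁿ X → ℓ m ≤ ℓ n
  ℓ-mono {m} {n} hm h hX = go (ℕP.≤⇒≤′ h) hX
    where
    r : ∀ a b i → a + i ≤ b → 0ℚ ≤ i → a ≤ b
    r a b i p q = lin (p +≤ q) (solve (a ∷ b ∷ i ∷ []) ℚR)
    go : ∀ {n} → m ≤′ n → n ≤ⁿ X → ℓ m ≤ ℓ n
    go (≤′-reflexive refl) _ = ≤-refl
    go (≤′-step {n} p) hX = ≤-trans (go p (ℕP.<⇒≤ hX)) (r (ℓ n) (ℓ (suc n)) (inv (suc n))
        (ℓ-lo (ℕP.≤-trans hm (ℕP.≤′⇒≤ p)) hX) (inv≥0 (suc n)))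

  ℓ-2 : ℓ 2 ≤ 1ℚ
  ℓ-2 = subst (ℓ 2 ≤_) (trans (cong (_+ 1ℚ) ℓ-1) (+-identityˡ 1ℚ)) (ℓ-hi {1} z<s 2≤X)

  ℓ-≤ : ∀ {n} → 1 ≤ⁿ n → n ≤ⁿ X → ℓ n ≤ ι n
  ℓ-≤ {suc zero} _ _ = subst (_≤ ι 1) (sym ℓ-1) (ι≥0 1)
  ℓ-≤ {suc (suc n)} _ h = ≤-trans (ℓ-hi z<s h) (r (ℓ (suc n)) (ι (suc n)) (inv (suc n))
      (ℓ-≤ {suc n} z<s (ℕP.<⇒≤ h)) (inv≤1 (suc n)))
    where
    r : ∀ a b i → a ≤ b → i ≤ 1ℚ → a + i ≤ 1ℚ + b
    r a b i p q = lin (p +≤ q) (solve (a ∷ b ∷ i ∷ []) ℚR)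

  T-Λ : ∀ x → T x ≡ Σ x (λ k → Λ k * ι (x ÷ k))
  T-Λ x = trans (Σ-cong x (λ n hn h → trans (sym (divSum-Λ hn))
      (sym (Σ-extend _ h (λ d a _ → trans (cong (_* Λ d) (χ-no (d ∣? n) (∤-extend hn a))) (*-zeroˡ (Λ d)))))))
    (trans (Σ-swap x x (λ n d → χ (d ∣? n) * Λ d)) (Σ-cong x
        (λ d hd _ → trans (sym (Σ-multiples x (λ _ → Λ d) hd))
        (trans (Σ-const (x ÷ d) (Λ d)) (*-comm (ι (x ÷ d)) (Λ d))))))

  T-ψ : ∀ x → Σ x (λ n → ψ (x ÷ n)) ≡ T x
  T-ψ x = trans (Σ-hyperbola x (λ _ d → Λ d)) (trans (Σ-cong x
      (λ d _ _ → trans (Σ-const (x ÷ d) (Λ d)) (*-comm (ι (x ÷ d)) (Λ d)))) (sym (T-Λ x)))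

  -- Both `ℓ (2 i - 1)` and `ℓ (2 i)` are at most `ℓ 2 + ℓ i`, and `ℓ 2 ≤ 1`.
  T-double : ∀ h → h +ⁿ h ≤ⁿ X → T (h +ⁿ h) ≤ ι 2 * T h + ι 2 * ι h
  T-double zero _ = ≤-refl
  T-double (suc h) hX = subst (λ z → T (suc z) ≤ ι 2 * T (suc h) + ι 2 * ι (suc h)) (sym (ℕP.+-suc h h))
      (r (T (h +ⁿ h)) (ℓ (suc (h +ⁿ h))) (ℓ (suc (suc (h +ⁿ h)))) (T h) (ℓ (suc h)) (ℓ 2) (ι h)
          (T-double h (ℕP.≤-trans (ℕP.n≤1+n _) (ℕP.<⇒≤ hX′))) (ℓ-mono z<s (ℕP.n≤1+n _) hX′) e ℓ-2)
    where
    hX′ : suc (suc (h +ⁿ h)) ≤ⁿ X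
    hX′ = subst (λ z → suc z ≤ⁿ X) (ℕP.+-suc h h) hX
    e : ℓ (suc (suc (h +ⁿ h))) ≡ ℓ 2 + ℓ (suc h)
    e = trans (cong ℓ (sym (trans (cong (suc h +ⁿ_) (ℕP.+-identityʳ (suc h))) (cong suc (ℕP.+-suc h h)))))
        (ℓ-* {2} {suc h} z<s z<s)
    r : ∀ t a b th l l2 hh → t ≤ ι 2 * th + ι 2 * hh → a ≤ b → b ≡ l2 + l → l2 ≤ 1ℚ →
        t + a + b ≤ ι 2 * (th + l) + ι 2 * (1ℚ + hh)
    r t a b th l l2 hh p q refl s = lin (p +≤ q +≤ s +≤ s) (solve (t ∷ a ∷ th ∷ l ∷ l2 ∷ hh ∷ []) ℚR)

  -- Chebyshev's argument: in `T (2 h) - 2 T h` the coefficient of `Λ k` is the quotient of `2 h` by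
  -- `k` minus twice that of `h`, which is never negative and is at least 1 for `h < k ≤ 2 h`.
  ψ-double : ∀ h → h +ⁿ h ≤ⁿ X → ψ (h +ⁿ h) ≤ ψ h + ι 2 * ι h
  ψ-double h hX = r (ψ (h +ⁿ h)) (ψ h) (T (h +ⁿ h)) (T h) (ι h) main (T-double h hX)
    where
    x = h +ⁿ h
    r : ∀ a b t th i → a + ι 2 * th ≤ b + t → t ≤ ι 2 * th + ι 2 * i → a ≤ b + ι 2 * i
    r a b t th i p q = lin (p +≤ q) (solve (a ∷ b ∷ t ∷ th ∷ i ∷ []) ℚR)
    Th : T h ≡ Σ x (λ k → Λ k * ι (h ÷ k))
    Th = trans (T-Λ h) (sym (Σ-extend _ (ℕP.m≤m+n h h) (λ k a _ → trans (cong (λ z → Λ k * ι z) (÷-big a))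
        (*-zeroʳ (Λ k)))))
    ψh : ψ h ≡ Σ x (λ k → χ (k ℕP.≤? h) * Λ k)
    ψh = Σ-trunc Λ (ℕP.m≤m+n h h)
    small : ∀ k → 1 ≤ⁿ k → k ≤ⁿ x → (d : Dec (k ≤ⁿ h)) → 1ℚ + ι 2 * ι (h ÷ k) ≤ χ d + ι (x ÷ k)
    small k hk kx (yes _) = ≤-refl {1ℚ} +≤ subst (_≤ ι (x ÷ k))
        (trans (ι-+ (h ÷ k) (h ÷ k)) (r2 (ι (h ÷ k)))) (ι-mono
        (÷-glb hk (subst (_≤ⁿ x) (sym (ℕP.*-distribˡ-+ k (h ÷ k) (h ÷ k)))
        (ℕP.+-mono-≤ (÷-lo h k) (÷-lo h k)))))
      where
      r2 : ∀ a → a + a ≡ ι 2 * a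
      r2 = solve-∀ ℚR
    small k hk kx (no ¬p) = subst (λ z → 1ℚ + ι 2 * ι z ≤ 0ℚ + ι (x ÷ k)) (sym (÷-big (ℕP.≰⇒> ¬p)))
        (subst (_≤ 0ℚ + ι (x ÷ k)) refl (≤-refl {0ℚ} +≤ ι-mono {1} (÷-≥1 hk kx)))
    r3 : ∀ l c a b → l * (1ℚ + ι 2 * a) ≤ l * (c + b) → l + ι 2 * (l * a) ≤ c * l + l * b
    r3 l c a b p = lin p (solve (l ∷ c ∷ a ∷ b ∷ []) ℚR)
    main : ψ x + ι 2 * T h ≤ ψ h + T x
    main = subst₂ _≤_ (trans (Σ-+ x Λ (λ k → ι 2 * (Λ k * ι (h ÷ k))))
        (cong (ψ x +_) (trans (Σ-*ˡ x (ι 2) (λ k → Λ k * ι (h ÷ k))) (cong (ι 2 *_) (sym Th)))))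
      (trans (Σ-+ x (λ k → χ (k ℕP.≤? h) * Λ k) (λ k → Λ k * ι (x ÷ k))) (cong₂ _+_ (sym ψh) (sym (T-Λ x))))
      (Σ-mono x (λ k hk kx → r3 (Λ k) (χ (k ℕP.≤? h)) (ι (h ÷ k)) (ι (x ÷ k))
          (Λ-nonneg k ·≤ small k hk kx (k ℕP.≤? h))))

  ψ-1 : ψ 1 ≡ 0ℚ
  ψ-1 = trans (sym (trans (+-identityˡ (ψ (1 ÷ 1))) refl)) (trans (T-ψ 1) (trans (+-identityˡ (ℓ 1)) ℓ-1))

  -- Strong induction by halving, with `n` as fuel. An odd `2 h + 1` is treated through `2 h + 2`,
  -- hence the strict `x < X`; the step `6 (h + 1) ≤ 4 (2 h + 1)` holds from `h = 1` on.
  ψ-≤ : ∀ {x} → x <ⁿ X → ψ x ≤ ι 4 * ι x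
  ψ-≤ {x} hx = go x x ℕP.≤-refl hx
    where
    r1 : ∀ a b h → a ≤ b + ι 2 * h → b ≤ ι 4 * h → 0ℚ ≤ h → a ≤ ι 4 * (h + h)
    r1 a b h p q z = lin (p +≤ q +≤ (ι≥0 2 ·≤ z)) (solve (a ∷ b ∷ h ∷ []) ℚR)
    r2 : ∀ a c b h → a ≤ c → c ≤ b + ι 2 * (1ℚ + h) → b ≤ ι 4 * (1ℚ + h) → 1ℚ ≤ h → a ≤ ι 4 * (1ℚ + (h + h))
    r2 a c b h p0 p q z = lin (p0 +≤ p +≤ q +≤ (ι≥0 2 ·≤ z)) (solve (a ∷ c ∷ b ∷ h ∷ []) ℚR)
    go : ∀ n x → x ≤ⁿ n → x <ⁿ X → ψ x ≤ ι 4 * ι x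
    go n zero _ _ = ≤-refl
    go n (suc zero) _ _ = subst (_≤ ι 4 * ι 1) (sym ψ-1) (*≥0 (ι≥0 4) (ι≥0 1))
    go (suc n) (suc (suc x)) (s≤s h) hX = cases (halving (suc (suc x)))
      where
      cases : (∃ λ h → (suc (suc x) ≡ h +ⁿ h) ⊎ (suc (suc x) ≡ suc (h +ⁿ h))) → ψ (suc (suc x)) ≤ ι 4 * ι
          (suc (suc x))
      cases (zero , inj₁ ())
      cases (suc k , inj₁ e) = subst (λ z → ψ z ≤ ι 4 * ι z) (sym e)
          (subst (λ z → ψ (suc k +ⁿ suc k) ≤ ι 4 * z) (sym (ι-+ (suc k) (suc k)))
          (r1 (ψ (suc k +ⁿ suc k)) (ψ (suc k)) (ι (suc k)) (ψ-double (suc k) (subst (_≤ⁿ X) e (ℕP.<⇒≤ hX)))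
              (go n (suc k) (ℕP.≤-trans lt h) (ℕP.≤-<-trans lt (ℕP.<-trans (ℕP.n<1+n _) hX))) (ι≥0 (suc k))))
        where
        lt : suc k ≤ⁿ suc x
        lt = ℕP.≤-trans (ℕP.m≤n+m (suc k) k) (ℕP.≤-reflexive (ℕP.suc-injective (sym e)))
      cases (zero , inj₂ ())
      cases (suc k , inj₂ e) = subst (λ z → ψ z ≤ ι 4 * ι z) (sym e)
          (subst (λ z → ψ (suc (suc k +ⁿ suc k)) ≤ ι 4 * (1ℚ + z)) (sym (ι-+ (suc k) (suc k)))
          (r2 (ψ (suc (suc k +ⁿ suc k))) (ψ (suc (suc k) +ⁿ suc (suc k))) (ψ (suc (suc k))) (ι (suc k))
              (ψ-mono up) (ψ-double (suc (suc k)) hX′) (go n (suc (suc k)) (ℕP.≤-trans lt h)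
              (ℕP.≤-<-trans lt (ℕP.<-trans (ℕP.n<1+n _) hX))) (ι-mono {1} {suc k} z<s)))
        where
        e2 : suc (suc k) +ⁿ suc (suc k) ≡ suc (suc (suc k +ⁿ suc k))
        e2 = cong suc (ℕP.+-suc (suc k) (suc k))
        up : suc (suc k +ⁿ suc k) ≤ⁿ suc (suc k) +ⁿ suc (suc k)
        up = subst (suc (suc k +ⁿ suc k) ≤ⁿ_) (sym e2) (ℕP.n≤1+n _)
        hX′ : suc (suc k) +ⁿ suc (suc k) ≤ⁿ X
        hX′ = subst (_≤ⁿ X) (trans (cong suc e) (sym e2)) hX
        lt : suc (suc k) ≤ⁿ suc x
        lt = subst (suc (suc k) ≤ⁿ_) (sym (ℕP.suc-injective e)) (s≤s (ℕP.m≤n+m (suc k) k))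

  R-abs : ∀ {x} → x <ⁿ X → ∣ R x ∣≤ ι 4 * ι x
  R-abs {x} h = r1 (ψ x) (ι x) (ψ≥0 x) (ι≥0 x) , r2 (ψ x) (ι x) (ψ-≤ h) (ι≥0 x)
    where
    r1 : ∀ a b → 0ℚ ≤ a → 0ℚ ≤ b → - (ι 4 * b) ≤ a - b
    r1 a b p q = lin (p +≤ (ι≥0 3 ·≤ q)) (solve (a ∷ b ∷ []) ℚR)
    r2 : ∀ a b → a ≤ ι 4 * b → 0ℚ ≤ b → a - b ≤ ι 4 * b
    r2 a b p q = lin (p +≤ q) (solve (a ∷ b ∷ []) ℚR)

  -- With `T-hi`, a weak form of Stirling's formula: the step of `n ℓ(n) - T n` is
  -- `n (ℓ(n + 1) - ℓ(n))`, which lies between `n / (n + 1)` and 1.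
  T-lo : ∀ {n} → 1 ≤ⁿ n → n ≤ⁿ X → ι n * ℓ n ≤ T n + ι n
  T-lo {suc zero} _ _ = r (ℓ 1)
    where
    r : ∀ a → ι 1 * a ≤ 0ℚ + a + ι 1
    r a = lin 0≤1 (solve (a ∷ []) ℚR)
  T-lo {suc (suc n)} _ h = r (ι m) (ℓ m) (ℓ (suc m)) (T m) (inv m) (T-lo {suc n} z<s (ℕP.<⇒≤ h)) (ι≥0 m)
      (ℓ-hi {m} z<s h) (ι*inv {m} z<s)
    where
    m = suc n
    r0 : ∀ m l l′ t i → m * l ≤ t + m → 0ℚ ≤ m → l′ ≤ l + i → (1ℚ + m) * l′ ≤ t + l′ + (m * i + m)
    r0 m l l′ t i p z q = lin (p +≤ (z ·≤ q)) (solve (m ∷ l ∷ l′ ∷ t ∷ i ∷ []) ℚR)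
    r : ∀ m l l′ t i → m * l ≤ t + m → 0ℚ ≤ m → l′ ≤ l + i → m * i ≡ 1ℚ → (1ℚ + m) * l′ ≤ t + l′ + (1ℚ + m)
    r m l l′ t i p z q e = subst (λ w → (1ℚ + m) * l′ ≤ t + l′ + (w + m)) e (r0 m l l′ t i p z q)

  T-hi : ∀ {n} → 1 ≤ⁿ n → n ≤ⁿ X → T n + ι n ≤ ι n * ℓ n + H n
  T-hi {suc zero} _ _ = r (ℓ 1)
    where
    r : ∀ a → 0ℚ + a + ι 1 ≤ ι 1 * a + (0ℚ + 1ℚ)
    r a = ≤-reflexive (solve (a ∷ []) ℚR)
  T-hi {suc (suc n)} _ h = r (ι m) (ℓ m) (ℓ (suc m)) (T m) (H m) (inv (suc m)) (T-hi {suc n} z<s (ℕP.<⇒≤ h))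
      (ι≥0 m) (ℓ-lo {m} z<s h) (ι*inv {suc m} z<s)
    where
    m = suc n
    r0 : ∀ m l l′ t h i → t + m ≤ m * l + h → 0ℚ ≤ m → l + i ≤ l′ → t + l′ + (m + (1ℚ + m) * i) ≤
        (1ℚ + m) * l′ + (h + i)
    r0 m l l′ t h i p z q = lin (p +≤ (z ·≤ q)) (solve (m ∷ l ∷ l′ ∷ t ∷ h ∷ i ∷ []) ℚR)
    r : ∀ m l l′ t h i → t + m ≤ m * l + h → 0ℚ ≤ m → l + i ≤ l′ → (1ℚ + m) * i ≡ 1ℚ →
        t + l′ + (1ℚ + m) ≤ (1ℚ + m) * l′ + (h + i)
    r m l l′ t h i p z q e = subst (_≤ (1ℚ + m) * l′ + (h + i))
        (trans (cong (λ w → t + l′ + (m + w)) e) (cong (t + l′ +_) (+-comm m 1ℚ))) (r0 m l l′ t h i p z q)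

  H≥0 : ∀ n → 0ℚ ≤ H n
  H≥0 n = Σ-≥0 n (λ i _ _ → inv≥0 i)

  H≤ι : ∀ n → H n ≤ ι n
  H≤ι n = subst (H n ≤_) (trans (Σ-const n 1ℚ) (*-identityʳ (ι n))) (Σ-mono n (λ i _ _ → inv≤1 i))

  -- With `H-ℓ-mono`, the usual proof that `H - ℓ` converges with error `1 / n`, stopped at `X`.
  H-ℓ-anti : ∀ {m n} → 1 ≤ⁿ m → m ≤ⁿ n → n ≤ⁿ X → H n - ℓ n ≤ H m - ℓ m
  H-ℓ-anti {m} {n} hm h hX = go (ℕP.≤⇒≤′ h) hX
    where
    r : ∀ h l l′ i z → h - l ≤ z → l + i ≤ l′ → h + i - l′ ≤ z
    r h l l′ i z p q = lin (p +≤ q) (solve (h ∷ l ∷ l′ ∷ i ∷ z ∷ []) ℚR)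
    go : ∀ {n} → m ≤′ n → n ≤ⁿ X → H n - ℓ n ≤ H m - ℓ m
    go (≤′-reflexive refl) _ = ≤-refl
    go (≤′-step {n} p) hX = r (H n) (ℓ n) (ℓ (suc n)) (inv (suc n)) (H m - ℓ m) (go p (ℕP.<⇒≤ hX))
        (ℓ-lo (ℕP.≤-trans hm (ℕP.≤′⇒≤ p)) hX)

  H-ℓ-mono : ∀ {m n} → 1 ≤ⁿ m → m ≤ⁿ n → n ≤ⁿ X → H m - ℓ m - inv m ≤ H n - ℓ n - inv n
  H-ℓ-mono {m} {n} hm h hX = go (ℕP.≤⇒≤′ h) hX
    where
    r : ∀ h l l′ i j z → z ≤ h - l - j → l′ ≤ l + j → z ≤ h + i - l′ - i
    r h l l′ i j z p q = lin (p +≤ q) (solve (h ∷ l ∷ l′ ∷ i ∷ j ∷ z ∷ []) ℚR)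
    go : ∀ {n} → m ≤′ n → n ≤ⁿ X → H m - ℓ m - inv m ≤ H n - ℓ n - inv n
    go (≤′-reflexive refl) _ = ≤-refl
    go (≤′-step {n} p) hX = r (H n) (ℓ n) (ℓ (suc n)) (inv (suc n)) (inv n) (H m - ℓ m - inv m)
        (go p (ℕP.<⇒≤ hX)) (ℓ-hi (ℕP.≤-trans hm (ℕP.≤′⇒≤ p)) hX)

  -- The value at X of H - ℓ plays the role of Euler's constant.
  γ : ℚ
  γ = H X - ℓ X

  γ-lo : ∀ {n} → 1 ≤ⁿ n → n ≤ⁿ X → ℓ n + γ ≤ H n
  γ-lo {n} hn h = r (ℓ n) (H n) γ (H-ℓ-anti hn h ℕP.≤-refl)
    where
    r : ∀ l h g → g ≤ h - l → l + g ≤ h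
    r l h g p = lin p (solve (l ∷ h ∷ g ∷ []) ℚR)

  γ-hi : ∀ {n} → 1 ≤ⁿ n → n ≤ⁿ X → H n ≤ ℓ n + γ + inv n
  γ-hi {n} hn h = r (ℓ n) (H n) γ (inv n) (inv X) (H-ℓ-mono hn h ℕP.≤-refl) (inv≥0 X)
    where
    r : ∀ l h g i x → h - l - i ≤ g - x → 0ℚ ≤ x → h ≤ l + g + i
    r l h g i x p q = lin (p +≤ q) (solve (l ∷ h ∷ g ∷ i ∷ x ∷ []) ℚR)

  1≤X : 1 ≤ⁿ X
  1≤X = ℕP.≤-trans z<s 2≤X

  γ≥0 : 0ℚ ≤ γ
  γ≥0 = r (ℓ 1) γ (γ-hi {1} z<s 1≤X) ℓ-1
    where
    r0 : ∀ g → 0ℚ + 1ℚ ≤ 0ℚ + g + 1ℚ → 0ℚ ≤ g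
    r0 g p = lin p (solve (g ∷ []) ℚR)
    r : ∀ l g → 0ℚ + 1ℚ ≤ l + g + 1ℚ → l ≡ 0ℚ → 0ℚ ≤ g
    r l g p refl = r0 g p

  γ≤1 : γ ≤ 1ℚ
  γ≤1 = r (ℓ 1) γ (γ-lo {1} z<s 1≤X) ℓ-1
    where
    r0 : ∀ g → 0ℚ + g ≤ 0ℚ + 1ℚ → g ≤ 1ℚ
    r0 g p = lin p (solve (g ∷ []) ℚR)
    r : ∀ l g → l + g ≤ 0ℚ + 1ℚ → l ≡ 0ℚ → g ≤ 1ℚ
    r l g p refl = r0 g p

  H≤ℓ+1 : ∀ {n} → 1 ≤ⁿ n → n ≤ⁿ X → H n ≤ ℓ n + 1ℚ
  H≤ℓ+1 {n} hn h = r (H n) (ℓ n) (ℓ 1) (H-ℓ-anti {1} z<s hn h) ℓ-1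
    where
    r0 : ∀ h l → h - l ≤ 0ℚ + 1ℚ - 0ℚ → h ≤ l + 1ℚ
    r0 h l p = lin p (solve (h ∷ l ∷ []) ℚR)
    r : ∀ h l l1 → h - l ≤ 0ℚ + 1ℚ - l1 → l1 ≡ 0ℚ → h ≤ l + 1ℚ
    r h l l1 p refl = r0 h l p

  T≤ : ∀ {x} → 1 ≤ⁿ x → x ≤ⁿ X → T x ≤ ι x * ℓ x
  T≤ {x} hx h = r (T x) (ι x) (ι x * ℓ x) (H x) (T-hi hx h) (H≤ι x)
    where
    r : ∀ t x y h → t + x ≤ y + h → h ≤ x → t ≤ y
    r t x y h p q = lin (p +≤ q) (solve (t ∷ x ∷ y ∷ h ∷ []) ℚR)

  mertens : ℕ → ℚ
  mertens x = Σ x (λ k → Λ k * inv k)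

  mertens-scale : ∀ x → ι x * mertens x ≡ Σ x (λ k → Λ k * (ι x * inv k))
  mertens-scale x = trans (sym (Σ-*ˡ x (ι x) (λ k → Λ k * inv k)))
      (Σ-cong x (λ k _ _ → r (ι x) (Λ k) (inv k)))
    where
    r : ∀ a b c → a * (b * c) ≡ b * (a * c)
    r = solve-∀ ℚR

  mertens-lo : ∀ {x} → 1 ≤ⁿ x → x ≤ⁿ X → ℓ x - 1ℚ ≤ mertens x
  mertens-lo {x} hx h = ι-cancelˡ hx (r (ι x) (ℓ x) (T x) (ι x * mertens x) (T-lo hx h)
      (subst₂ _≤_ (sym (T-Λ x)) (sym (mertens-scale x)) (Σ-mono x (λ k hk _ → Λ-nonneg k ·≤ ÷-lo-ℚ x hk))))
    where
    r : ∀ x l t m → x * l ≤ t + x → t ≤ m → x * (l - 1ℚ) ≤ m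
    r x l t m p q = lin (p +≤ q) (solve (x ∷ l ∷ t ∷ m ∷ []) ℚR)

  -- Replacing the quotients `x ÷ k` in `T-Λ` by the unrounded `x / k` changes the sum by at most
  -- `ψ x ≤ 4 x`.
  mertens-hi : ∀ {x} → 1 ≤ⁿ x → x <ⁿ X → mertens x ≤ ℓ x + ι 4
  mertens-hi {x} hx h = ι-cancelˡ hx (r (ι x) (ℓ x) (T x) (ψ x) (ι x * mertens x) (T≤ hx (ℕP.<⇒≤ h))
      (ψ-≤ h) main)
    where
    r : ∀ x l t p m → t ≤ x * l → p ≤ ι 4 * x → m ≤ t + p → m ≤ x * (l + ι 4)
    r x l t p m h1 h2 h3 = lin (h1 +≤ h2 +≤ h3) (solve (x ∷ l ∷ t ∷ p ∷ m ∷ []) ℚR)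
    r2 : ∀ l a b → l * a ≤ l * (b + 1ℚ) → l * a ≤ l * b + l
    r2 l a b p = lin p (solve (l ∷ a ∷ b ∷ []) ℚR)
    main : ι x * mertens x ≤ T x + ψ x
    main = subst₂ _≤_ (sym (mertens-scale x)) (trans (Σ-+ x (λ k → Λ k * ι (x ÷ k)) Λ)
        (cong (_+ ψ x) (sym (T-Λ x)))) (Σ-mono x (λ k hk _ → r2 (Λ k) (ι x * inv k) (ι (x ÷ k))
        (Λ-nonneg k ·≤ ÷-hi-ℚ x hk)))

  divSum-extend : ∀ {m x} (f : ℕ → ℚ) → 1 ≤ⁿ m → m ≤ⁿ x → Σ x (λ d → χ (d ∣? m) * f d) ≡ divSum m f
  divSum-extend {m} f hm h = Σ-extend _ h (λ d a _ → trans (cong (_* f d) (χ-no (d ∣? m) (∤-extend hm a)))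
      (*-zeroˡ (f d)))

  -- Collecting the terms with `d * n = m` leaves the coefficient `L [m = 1] + Λ m`, by the divisor
  -- sums of `μ` and of `μ ℓ`.
  tatuzawa-iseki : ∀ {x} L (F : ℕ → ℚ) → 1 ≤ⁿ x → Σ x (λ d → μ d * (L - ℓ d) * Σ (x ÷ d) (λ n → F (d *ⁿ n)))
      ≡ L * F 1 + Σ x (λ k → Λ k * F k)
  tatuzawa-iseki {x} L F hx = trans (Σ-cong x (λ d hd _ → trans
      (cong (μ d * (L - ℓ d) *_) (Σ-multiples x F hd)) (sym (Σ-*ˡ x (μ d * (L - ℓ d))
      (λ m → χ (d ∣? m) * F m)))))
    (trans (Σ-swap x x (λ d m → μ d * (L - ℓ d) * (χ (d ∣? m) * F m)))
        (trans (Σ-cong x col) (trans (Σ-+ x (λ m → χ (m ℕP.≟ 1) * (L * F m)) (λ m → Λ m * F m))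
        (cong (_+ Σ x (λ m → Λ m * F m)) one))))
    where
    r1 : ∀ u l c f L → u * (L - l) * (c * f) ≡ (L * (c * u) - c * (u * l)) * f
    r1 = solve-∀ ℚR
    r2 : ∀ L c l f → (L * c - - l) * f ≡ c * (L * f) + l * f
    r2 = solve-∀ ℚR
    inner : ∀ m → 1 ≤ⁿ m → m ≤ⁿ x → Σ x (λ d → L * (χ (d ∣? m) * μ d) - χ (d ∣? m) * (μ d * ℓ d)) ≡ L * χ
        (m ℕP.≟ 1) - - Λ m
    inner m hm h = trans (Σ-- x (λ d → L * (χ (d ∣? m) * μ d)) (λ d → χ (d ∣? m) * (μ d * ℓ d)))
      (cong₂ (λ a b → a - b) (trans (Σ-*ˡ x L (λ d → χ (d ∣? m) * μ d))
          (cong (L *_) (trans (divSum-extend μ hm h) (divSum-μ-χ hm))))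
          (trans (divSum-extend (λ d → μ d * ℓ d) hm h) (divSum-μℓ hm)))
    col : ∀ m → 1 ≤ⁿ m → m ≤ⁿ x → Σ x (λ d → μ d * (L - ℓ d) * (χ (d ∣? m) * F m)) ≡ χ (m ℕP.≟ 1) *
        (L * F m) + Λ m * F m
    col m hm h = trans (Σ-cong x (λ d _ _ → r1 (μ d) (ℓ d) (χ (d ∣? m)) (F m) L))
        (trans (Σ-*ʳ x (F m) (λ d → L * (χ (d ∣? m) * μ d) - χ (d ∣? m) * (μ d * ℓ d)))
        (trans (cong (_* F m) (inner m hm h)) (r2 L (χ (m ℕP.≟ 1)) (Λ m) (F m))))
    one : Σ x (λ m → χ (m ℕP.≟ 1) * (L * F m)) ≡ L * F 1
    one = trans (Σ-single {x} {1} (λ m → χ (m ℕP.≟ 1) * (L * F m)) z<s hx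
        (λ i ne → trans (cong (_* (L * F i)) (χ-no (i ℕP.≟ 1) ne)) (*-zeroˡ (L * F i))))
        (*-identityˡ (L * F 1))

  ℓ-÷ : ∀ {x d} → 1 ≤ⁿ d → d ≤ⁿ x → x ≤ⁿ X → ℓ d + ℓ (x ÷ d) ≤ ℓ x
  ℓ-÷ {x} {d} hd h hX = subst (_≤ ℓ x) (ℓ-* hd (÷-≥1 hd h)) (ℓ-mono (ℕP.*-mono-≤ hd (÷-≥1 hd h))
      (÷-lo x d) hX)

  -- The antiderivative t (log² (x/t) + 4 log (x/t) + 5) dominates the sum.
  Σ-log² : ∀ {x} D → 1 ≤ⁿ D → D ≤ⁿ x → x ≤ⁿ X → Σ D (λ d → (ℓ x - ℓ d) * (ℓ x - ℓ d + ι 2)) ≤ ι D *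
      ((ℓ x - ℓ D) * (ℓ x - ℓ D) + ι 4 * (ℓ x - ℓ D) + ι 5)
  Σ-log² {x} (suc zero) _ h hX = r (ℓ x - ℓ 1) (diff≥0 (ℓ-mono z<s h hX))
    where
    r : ∀ a → 0ℚ ≤ a → 0ℚ + a * (a + ι 2) ≤ ι 1 * (a * a + ι 4 * a + ι 5)
    r a p = lin ((ι≥0 2 ·≤ p) +≤ ι≥0 5) (solve (a ∷ []) ℚR)
  Σ-log² {x} (suc (suc D)) _ h hX = r (Σ m (λ d → (ℓ x - ℓ d) * (ℓ x - ℓ d + ι 2))) (ι m) (ℓ x - ℓ (suc m))
      (ℓ (suc m) - ℓ m) (ℓ x - ℓ m) (r0 (ℓ x) (ℓ m) (ℓ (suc m))) (Σ-log² {x} (suc D) z<s (ℕP.<⇒≤ h) hX)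
      (diff≥0 (ℓ-mono z<s h hX)) (diff≥0 (ℓ-mono z<s (ℕP.n≤1+n m) (ℕP.≤-trans h hX))) (diff≥0 md≤1)
          (ι-mono {1} {m} z<s) 
    where
    m = suc D
    r0 : ∀ a b c → a - b ≡ a - c + (c - b)
    r0 = solve-∀ ℚR
    hi : ℓ (suc m) ≤ ℓ m + inv m
    hi = ℓ-hi {m} z<s (ℕP.≤-trans h hX)
    r3 : ∀ a b c → a ≤ b + c → a - b ≤ c
    r3 a b c p = lin p (solve (a ∷ b ∷ c ∷ []) ℚR)
    md≤1 : ι m * (ℓ (suc m) - ℓ m) ≤ 1ℚ
    md≤1 = subst (ι m * (ℓ (suc m) - ℓ m) ≤_) (ι*inv {m} z<s) (ι≥0 m ·≤ r3 (ℓ (suc m)) (ℓ m) (inv m) hi)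
    r : ∀ s m l d l₀ → l₀ ≡ l + d → s ≤ m * (l₀ * l₀ + ι 4 * l₀ + ι 5) → 0ℚ ≤ l → 0ℚ ≤ d → 0ℚ ≤ 1ℚ - m * d →
        1ℚ ≤ m → s + l * (l + ι 2) ≤ (1ℚ + m) * (l * l + ι 4 * l + ι 5)
    r s m l d l₀ refl p hl hd hmd hm = lin (p +≤ *≥0 (+≥0 (+≥0 hl hl) (+≥0 hd (ι≥0 4))) hmd +≤ *≥0
        (diff≥0 hm) hd +≤ hmd ) (solve (s ∷ m ∷ l ∷ d ∷ []) ℚR)

  Σ-log²-end : ∀ {x} → 1 ≤ⁿ x → x ≤ⁿ X → Σ x (λ d → (ℓ x - ℓ d) * (ℓ x - ℓ d + ι 2)) ≤ ι 5 * ι x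
  Σ-log²-end {x} hx hX = ≤-trans (Σ-log² x hx ℕP.≤-refl hX) (≤-reflexive (r (ℓ x) (ι x)))
    where
    r : ∀ l x → x * ((l - l) * (l - l) + ι 4 * (l - l) + ι 5) ≡ ι 5 * x
    r = solve-∀ ℚR

  -- Selberg's inequality

  -- `R` at `x / k`, with rounding only inside `ψ`, shifted by the constant for which the inner sums
  -- `T m - (x / d) H m + m (γ + 1)` lose their terms of order `m` and become logarithmic.
  F : ℕ → ℕ → ℚ
  F x k = ψ (x ÷ k) - ι x * inv k + (γ + 1ℚ)

  Σ-F : ∀ x {d} → 1 ≤ⁿ d → Σ (x ÷ d) (λ n → F x (d *ⁿ n)) ≡ T (x ÷ d) - ι x * inv d * H (x ÷ d) + ι (x ÷ d) *
      (γ + 1ℚ)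
  Σ-F x {d} hd = trans (Σ-cong m (λ n hn _ → cong₂ (λ a b → ψ a - b + (γ + 1ℚ)) (sym (÷-÷ x hd hn))
      (trans (cong (ι x *_) (inv-* hd hn)) (sym (*-assoc (ι x) (inv d) (inv n))))))
    (trans (Σ-+ m (λ n → ψ (m ÷ n) - ι x * inv d * inv n) (λ _ → γ + 1ℚ))
        (cong₂ _+_ (trans (Σ-- m (λ n → ψ (m ÷ n)) (λ n → ι x * inv d * inv n))
        (cong₂ (λ a b → a - b) (T-ψ m) (Σ-*ˡ m (ι x * inv d) inv))) (Σ-const m (γ + 1ℚ))))
    where
    m = x ÷ d

  Σ-F-abs : ∀ {x d} → 1 ≤ⁿ d → d ≤ⁿ x → x ≤ⁿ X → ∣ Σ (x ÷ d) (λ n → F x (d *ⁿ n)) ∣≤ ℓ x - ℓ d + ι 2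
  Σ-F-abs {x} {d} hd h hX = subst (∣_∣≤ ℓ x - ℓ d + ι 2) (sym (Σ-F x hd))
      ( lower (T m) (ι m) (ℓ m) (H m) γ (ι x * inv d) (ℓ x) (ℓ d) (inv m) (T-lo hm mX)
          (*≥0 (diff≥0 (÷-hi-ℚ x hd)) (H≥0 m)) (*≥0 (ι≥0 m) (diff≥0 (γ-hi hm mX))) (ι*inv hm) (H≤ℓ+1 hm mX)
          (ℓ-÷ hd h hX)
      , upper (T m) (ι m) (ℓ m) (H m) γ (ι x * inv d) (ℓ x) (ℓ d) (T-hi hm mX)
          (*≥0 (diff≥0 (÷-lo-ℚ x hd)) (H≥0 m)) (*≥0 (ι≥0 m) (diff≥0 (γ-lo hm mX))) (H≤ℓ+1 hm mX)
          (ℓ-÷ hd h hX))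
    where
    m = x ÷ d
    hm : 1 ≤ⁿ m
    hm = ÷-≥1 hd h
    mX : m ≤ⁿ X
    mX = ℕP.≤-trans (÷≤ x d) hX
    upper : ∀ t m l h g y lx ld → t + m ≤ m * l + h → 0ℚ ≤ (y - m) * h → 0ℚ ≤ m * (h - (l + g)) →
        h ≤ l + 1ℚ → ld + l ≤ lx → t - y * h + m * (g + 1ℚ) ≤ lx - ld + ι 2
    upper t m l h g y lx ld p q s u v = lin (p +≤ q +≤ s +≤ u +≤ v +≤ 0≤1)
        (solve (t ∷ m ∷ l ∷ h ∷ g ∷ y ∷ lx ∷ ld ∷ []) ℚR)
    lower0 : ∀ t m l h g y lx ld i → m * l ≤ t + m → 0ℚ ≤ (m + 1ℚ - y) * h → 0ℚ ≤ m * (l + g + i - h) →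
        h ≤ l + 1ℚ → ld + l ≤ lx → - (lx - ld + ι 2) ≤ t - y * h + m * (g + 1ℚ) + (m * i - 1ℚ)
    lower0 t m l h g y lx ld i p q s u v = lin (p +≤ q +≤ s +≤ u +≤ v)
        (solve (t ∷ m ∷ l ∷ h ∷ g ∷ y ∷ lx ∷ ld ∷ i ∷ []) ℚR)
    r00 : ∀ z → z + (1ℚ - 1ℚ) ≡ z
    r00 = solve-∀ ℚR
    lower : ∀ t m l h g y lx ld i → m * l ≤ t + m → 0ℚ ≤ (m + 1ℚ - y) * h → 0ℚ ≤ m * (l + g + i - h) →
        m * i ≡ 1ℚ → h ≤ l + 1ℚ → ld + l ≤ lx → - (lx - ld + ι 2) ≤ t - y * h + m * (g + 1ℚ)
    lower t m l h g y lx ld i p q s e u v = subst (- (lx - ld + ι 2) ≤_)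
        (trans (cong (λ w → t - y * h + m * (g + 1ℚ) + (w - 1ℚ)) e) (r00 (t - y * h + m * (g + 1ℚ))))
        (lower0 t m l h g y lx ld i p q s u v)

  tatuzawa-iseki-abs : ∀ {x} → 1 ≤ⁿ x → x ≤ⁿ X → ∣ ℓ x * F x 1 + Σ x (λ k → Λ k * F x k) ∣≤ ι 5 * ι x
  tatuzawa-iseki-abs {x} hx hX = subst (∣_∣≤ ι 5 * ι x) (tatuzawa-iseki (ℓ x) (F x) hx)
      (abs-mono (abs-Σ x term) (Σ-log²-end hx hX))
    where
    term : ∀ d → 1 ≤ⁿ d → d ≤ⁿ x → ∣ μ d * (ℓ x - ℓ d) * Σ (x ÷ d) (λ n → F x (d *ⁿ n)) ∣≤ (ℓ x - ℓ d) *
        (ℓ x - ℓ d + ι 2)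
    term d hd h = subst (λ z → ∣ μ d * (ℓ x - ℓ d) * Σ (x ÷ d) (λ n → F x (d *ⁿ n)) ∣≤ z * (ℓ x - ℓ d + ι 2))
        (*-identityˡ (ℓ x - ℓ d))
      (abs-* (abs-* (μ≤1 d) (abs-nonneg (diff≥0 (ℓ-mono hd h hX)) ≤-refl)) (Σ-F-abs hd h hX))

  selbergSum : ℕ → ℚ
  selbergSum x = ℓ x * R x + Σ x (λ k → Λ k * R (x ÷ k))

  selbergSum-abs : ∀ {x} → 1 ≤ⁿ x → x <ⁿ X → ∣ selbergSum x ∣≤ ι 15 * ι x
  selbergSum-abs {x} hx h = subst (∣_∣≤ ι 15 * ι x) (sym e) (abs-mono (abs-- (tatuzawa-iseki-abs hx xX) corr)
      (r2 (ι x) (ℓ x) (ψ x) (ℓ-≤ hx xX) (ψ-≤ h)))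
    where
    xX = ℕP.<⇒≤ h
    -- `F` and `R` differ by the rounding and by `γ + 1`, in all between 0 and 2. Summed against
    -- `ℓ x` and `Λ` this costs `2 (x + 4 x)`, which together with 5 makes 15.
    W : ℕ → ℚ
    W k = F x k - R (x ÷ k)
    Wb : ∀ k → 1 ≤ⁿ k → ∣ W k ∣≤ ι 2
    Wb k hk = abs-nonneg (r3 (ψ (x ÷ k)) (ι (x ÷ k)) (ι x * inv k) γ (÷-hi-ℚ x hk) γ≥0)
        (r4 (ψ (x ÷ k)) (ι (x ÷ k)) (ι x * inv k) γ (÷-lo-ℚ x hk) γ≤1)
      where
      r3 : ∀ p m y g → y ≤ m + 1ℚ → 0ℚ ≤ g → 0ℚ ≤ p - y + (g + 1ℚ) - (p - m)
      r3 p m y g a b = lin (a +≤ b) (solve (p ∷ m ∷ y ∷ g ∷ []) ℚR)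
      r4 : ∀ p m y g → m ≤ y → g ≤ 1ℚ → p - y + (g + 1ℚ) - (p - m) ≤ ι 2
      r4 p m y g a b = lin (a +≤ b) (solve (p ∷ m ∷ y ∷ g ∷ []) ℚR)
    corr : ∣ ℓ x * W 1 + Σ x (λ k → Λ k * W k) ∣≤ ℓ x * ι 2 + ψ x * ι 2
    corr = abs-+ (abs-scale (ℓ≥0 x) (Wb 1 z<s)) (subst (∣ Σ x (λ k → Λ k * W k) ∣≤_) (Σ-*ʳ x (ι 2) Λ)
        (abs-Σ x (λ k hk _ → abs-scale (Λ-nonneg k) (Wb k hk))))
    r1 : ∀ l f a s rr → l * rr + s ≡ l * f + a - (l * (f - rr) + (a - s))
    r1 = solve-∀ ℚR
    r5 : ∀ l a b → l * (a - b) ≡ l * a - l * b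
    r5 = solve-∀ ℚR
    e : selbergSum x ≡ ℓ x * F x 1 + Σ x (λ k → Λ k * F x k) - (ℓ x * W 1 + Σ x (λ k → Λ k * W k))
    e = trans (cong (λ z → ℓ x * R z + Σ x (λ k → Λ k * R (x ÷ k))) (sym (÷-1 x)))
      (trans (r1 (ℓ x) (F x 1) (Σ x (λ k → Λ k * F x k)) (Σ x (λ k → Λ k * R (x ÷ k))) (R (x ÷ 1)))
        (cong (λ z → ℓ x * F x 1 + Σ x (λ k → Λ k * F x k) - (ℓ x * W 1 + z))
            (sym (trans (Σ-cong x (λ k _ _ → r5 (Λ k) (F x k) (R (x ÷ k))))
            (Σ-- x (λ k → Λ k * F x k) (λ k → Λ k * R (x ÷ k)))))))
    r2 : ∀ x l p → l ≤ x → p ≤ ι 4 * x → ι 5 * x + (l * ι 2 + p * ι 2) ≤ ι 15 * x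
    r2 x l p a b = lin (a +≤ a +≤ b +≤ b) (solve (x ∷ l ∷ p ∷ []) ℚR)

  ΛΛ : ℕ → ℚ
  ΛΛ n = divSum n (λ k → Λ k * Λ (n ÷ k))

  Λ₂ : ℕ → ℚ
  Λ₂ n = Λ n * ℓ n + ΛΛ n

  ΛΛ≥0 : ∀ n → 0ℚ ≤ ΛΛ n
  ΛΛ≥0 n = Σ-≥0 n (λ k _ _ → *≥0 (χ≥0 (k ∣? n)) (*≥0 (Λ-nonneg k) (Λ-nonneg (n ÷ k))))

  Λ₂≥0 : ∀ n → 0ℚ ≤ Λ₂ n
  Λ₂≥0 n = +≥0 (*≥0 (Λ-nonneg n) (ℓ≥0 n)) (ΛΛ≥0 n)

  convolve : ∀ x (G : ℕ → ℚ) → Σ x (λ k → Λ k * Σ (x ÷ k) (λ j → Λ j * G (k *ⁿ j))) ≡ Σ x (λ m → ΛΛ m * G m)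
  convolve x G = trans (Σ-cong x (λ k hk _ → trans (cong (Λ k *_)
      (trans (Σ-cong (x ÷ k) (λ j _ _ → cong (λ z → Λ z * G (k *ⁿ j)) (sym (*÷ j hk))))
      (Σ-multiples x (λ m → Λ (m ÷ k) * G m) hk))) (sym (Σ-*ˡ x (Λ k)
      (λ m → χ (k ∣? m) * (Λ (m ÷ k) * G m))))))
    (trans (Σ-swap x x (λ k m → Λ k * (χ (k ∣? m) * (Λ (m ÷ k) * G m))))
        (Σ-cong x (λ m hm h → trans (Σ-cong x (λ k _ _ → r (Λ k) (χ (k ∣? m)) (Λ (m ÷ k)) (G m)))
        (trans (Σ-*ʳ x (G m) (λ k → χ (k ∣? m) * (Λ k * Λ (m ÷ k))))
        (cong (_* G m) (divSum-extend (λ k → Λ k * Λ (m ÷ k)) hm h))))))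
    where
    r : ∀ a c b g → a * (c * (b * g)) ≡ c * (a * b) * g
    r = solve-∀ ℚR

  -- The defect `ℓ(x) ψ(x) - Σ Λ(n) ℓ(n)`. From `m` to `m + 1` it grows by
  -- `ψ m * (ℓ (suc m) - ℓ m) ≤ 4`, which gives `ψ₁-hi`.
  ψ₁ : ℕ → ℚ
  ψ₁ x = Σ x (λ n → Λ n * (ℓ x - ℓ n))

  ψ₁≥0 : ∀ {x} → x ≤ⁿ X → 0ℚ ≤ ψ₁ x
  ψ₁≥0 {x} h = Σ-≥0 x (λ n hn nx → *≥0 (Λ-nonneg n) (diff≥0 (ℓ-mono hn nx h)))

  ψ₁-shift : ∀ n l l′ → Σ n (λ i → Λ i * (l′ - ℓ i)) ≡ Σ n (λ i → Λ i * (l - ℓ i)) + ψ n * (l′ - l)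
  ψ₁-shift n l l′ = trans (Σ-cong n (λ i _ _ → r (Λ i) l l′ (ℓ i)))
      (trans (Σ-+ n (λ i → Λ i * (l - ℓ i)) (λ i → Λ i * (l′ - l)))
      (cong (Σ n (λ i → Λ i * (l - ℓ i)) +_) (Σ-*ʳ n (l′ - l) Λ)))
    where
    r : ∀ a l l′ b → a * (l′ - b) ≡ a * (l - b) + a * (l′ - l)
    r = solve-∀ ℚR

  ψ₁-hi : ∀ {x} → x <ⁿ X → ψ₁ x ≤ ι 4 * ι x
  ψ₁-hi {zero} _ = ≤-refl
  ψ₁-hi {suc zero} _ = r (Λ 1) (ℓ 1)
    where
    r : ∀ a l → 0ℚ + a * (l - l) ≤ ι 4 * (1ℚ + 0ℚ)
    r a l = lin (ι≥0 4) (solve (a ∷ l ∷ []) ℚR)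
  ψ₁-hi {suc (suc n)} h = r (Σ m (λ i → Λ i * (ℓ (suc m) - ℓ i))) (ψ₁ m) (ψ m) (ℓ m) (ℓ (suc m)) (inv m)
      (Λ (suc m)) (ι m) (ψ₁-shift m (ℓ m) (ℓ (suc m))) (ψ₁-hi {suc n} (ℕP.<-trans (ℕP.n<1+n m) h))
      (*≥0 (ψ≥0 m) (diff≥0 (ℓ-hi {m} z<s (ℕP.<⇒≤ h)))) (*-monoʳ (inv m) (inv≥0 m)
          (ψ-≤ {m} (ℕP.<-trans (ℕP.n<1+n m) h))) (ι*inv {m} z<s)
    where
    m = suc n
    r0 : ∀ y p l l′ i a x → y ≤ ι 4 * x → 0ℚ ≤ p * (l + i - l′) → p * i ≤ ι 4 * x * i →
        y + p * (l′ - l) + a * (l′ - l′) ≤ ι 4 * (x * i + x)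
    r0 y p l l′ i a x h1 h2 h3 = lin (h1 +≤ h2 +≤ h3) (solve (y ∷ p ∷ l ∷ l′ ∷ i ∷ a ∷ x ∷ []) ℚR)
    r : ∀ s y p l l′ i a x → s ≡ y + p * (l′ - l) → y ≤ ι 4 * x → 0ℚ ≤ p * (l + i - l′) →
        p * i ≤ ι 4 * x * i → x * i ≡ 1ℚ → s + a * (l′ - l′) ≤ ι 4 * (1ℚ + x)
    r s y p l l′ i a x refl h1 h2 h3 e = subst (λ w → y + p * (l′ - l) + a * (l′ - l′) ≤ ι 4 * (w + x)) e
        (r0 y p l l′ i a x h1 h2 h3)

  ψ₂ : ℕ → ℚ
  ψ₂ x = Σ x Λ₂

  -- The sum in `selbergSum` is the summatory function of `Λ * Λ` minus `T x`, and `ψ₁` converts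
  -- `ℓ x * ψ x` into the sum of `Λ ℓ`. Both `ι x * ℓ x` and `T x` have main term `x ℓ(x)`, whence
  -- the 2 in `ψ₂-abs`.
  ψ₂-id : ∀ x → ψ₂ x ≡ selbergSum x - ψ₁ x + ι x * ℓ x + T x
  ψ₂-id x = trans (Σ-+ x (λ n → Λ n * ℓ n) ΛΛ) (r (Σ x (λ n → Λ n * ℓ n)) (Σ x ΛΛ) (ℓ x) (ψ x) (ι x)
      (Σ x (λ k → Λ k * R (x ÷ k))) (ψ₁ x) (T x) eY eR)
    where
    r1 : ∀ a b c → a * (b - c) ≡ b * a - a * c
    r1 = solve-∀ ℚR
    r1′ : ∀ a b c → a * (b - c) ≡ a * b - a * c
    r1′ = solve-∀ ℚR
    eY : ψ₁ x ≡ ℓ x * ψ x - Σ x (λ n → Λ n * ℓ n)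
    eY = trans (Σ-cong x (λ n _ _ → r1 (Λ n) (ℓ x) (ℓ n))) (trans (Σ-- x (λ n → ℓ x * Λ n) (λ n → Λ n * ℓ n))
        (cong (_- Σ x (λ n → Λ n * ℓ n)) (Σ-*ˡ x (ℓ x) Λ)))
    conv1 : Σ x (λ k → Λ k * ψ (x ÷ k)) ≡ Σ x ΛΛ
    conv1 = trans (Σ-cong x (λ k _ _ → cong (Λ k *_) (Σ-cong (x ÷ k) (λ j _ _ → sym (*-identityʳ (Λ j))))))
        (trans (convolve x (λ _ → 1ℚ)) (Σ-cong x (λ m _ _ → *-identityʳ (ΛΛ m))))
    eR : Σ x (λ k → Λ k * R (x ÷ k)) ≡ Σ x ΛΛ - T x
    eR = trans (Σ-cong x (λ k _ _ → r1′ (Λ k) (ψ (x ÷ k)) (ι (x ÷ k))))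
        (trans (Σ-- x (λ k → Λ k * ψ (x ÷ k)) (λ k → Λ k * ι (x ÷ k)))
        (cong₂ (λ a b → a - b) conv1 (sym (T-Λ x))))
    r0 : ∀ a c l p x t → a + c ≡ l * (p - x) + (c - t) - (l * p - a) + x * l + t
    r0 = solve-∀ ℚR
    r : ∀ a c l p x s y t → y ≡ l * p - a → s ≡ c - t → a + c ≡ l * (p - x) + s - y + x * l + t
    r a c l p x s y t refl refl = r0 a c l p x t

  ψ₂-abs : ∀ {x} → 1 ≤ⁿ x → x <ⁿ X → ∣ ψ₂ x - ι 2 * (ι x * ℓ x) ∣≤ ι 20 * ι x
  ψ₂-abs {x} hx h = subst (λ z → ∣ z - ι 2 * (ι x * ℓ x) ∣≤ ι 20 * ι x) (sym (ψ₂-id x))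
      ( r1 (selbergSum x) (ψ₁ x) (ι x * ℓ x) (T x) (ι x) (proj₁ s) (ψ₁-hi h) (T-lo hx (ℕP.<⇒≤ h))
      , r2 (selbergSum x) (ψ₁ x) (ι x * ℓ x) (T x) (ι x) (proj₂ s) (ψ₁≥0 (ℕP.<⇒≤ h)) (T≤ hx (ℕP.<⇒≤ h))
          (ι≥0 x))
    where
    s = selbergSum-abs hx h
    r1 : ∀ s y z t x → - (ι 15 * x) ≤ s → y ≤ ι 4 * x → z ≤ t + x → - (ι 20 * x) ≤ s - y + z + t - ι 2 * z
    r1 s y z t x a b c = lin (a +≤ b +≤ c) (solve (s ∷ y ∷ z ∷ t ∷ x ∷ []) ℚR)
    r2 : ∀ s y z t x → s ≤ ι 15 * x → 0ℚ ≤ y → t ≤ z → 0ℚ ≤ x → s - y + z + t - ι 2 * z ≤ ι 20 * x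
    r2 s y z t x a b c d = lin (a +≤ b +≤ c +≤ (ι≥0 5 ·≤ d)) (solve (s ∷ y ∷ z ∷ t ∷ x ∷ []) ℚR)

  ℓ-gap : ∀ {a} j → 1 ≤ⁿ a → a +ⁿ j ≤ⁿ X → ℓ (a +ⁿ j) ≤ ℓ a + ι j * inv a
  ℓ-gap {a} zero ha h = ≤-reflexive (trans (cong ℓ (ℕP.+-identityʳ a))
      (sym (trans (cong (ℓ a +_) (*-zeroˡ (inv a))) (+-identityʳ (ℓ a)))))
  ℓ-gap {a} (suc j) ha h = subst (λ z → ℓ z ≤ ℓ a + ι (suc j) * inv a) (sym (ℕP.+-suc a j))
      (r (ℓ a) (ℓ (a +ⁿ j)) (ℓ (suc (a +ⁿ j))) (ι j) (inv a) (inv (a +ⁿ j)) (ℓ-gap j ha (ℕP.<⇒≤ h′))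
      (ℓ-hi (ℕP.≤-trans ha (ℕP.m≤m+n a j)) h′) (inv-anti ha (ℕP.m≤m+n a j)))
    where
    h′ : suc (a +ⁿ j) ≤ⁿ X
    h′ = subst (_≤ⁿ X) (ℕP.+-suc a j) h
    r : ∀ la l l′ j i i′ → l ≤ la + j * i → l′ ≤ l + i′ → i′ ≤ i → l′ ≤ la + (1ℚ + j) * i
    r la l l′ j i i′ p q s = lin (p +≤ q +≤ s) (solve (la ∷ l ∷ l′ ∷ j ∷ i ∷ i′ ∷ []) ℚR)

  -- Write `x = k m + j` with `j ≤ k`; the `j` steps from `k m` to `x` raise `ℓ` by at most
  -- `j / (k m) ≤ 1 / m`.
  ℓ-÷-error : ∀ {x k} → 1 ≤ⁿ k → k ≤ⁿ x → x <ⁿ X → ∣ ℓ x - ℓ (x ÷ k) - ℓ k ∣≤ inv (x ÷ k)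
  ℓ-÷-error {x} {k} hk h hX = abs-nonneg (r1 (ℓ x) (ℓ m) (ℓ k) (ℓ-÷ hk h (ℕP.<⇒≤ hX)))
      (r2 (ℓ x) (ℓ m) (ℓ k) (inv m) up)
    where
    m = x ÷ k
    hm : 1 ≤ⁿ m
    hm = ÷-≥1 hk h
    r1 : ∀ a b c → c + b ≤ a → 0ℚ ≤ a - b - c
    r1 a b c p = lin p (solve (a ∷ b ∷ c ∷ []) ℚR)
    r2 : ∀ a b c i → a ≤ c + b + i → a - b - c ≤ i
    r2 a b c i p = lin p (solve (a ∷ b ∷ c ∷ i ∷ []) ℚR)
    j = x ∸ⁿ k *ⁿ m
    ej : k *ⁿ m +ⁿ j ≡ x
    ej = ℕP.m+[n∸m]≡n (÷-lo x k)
    j≤k : j ≤ⁿ k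
    j≤k = ℕP.+-cancelˡ-≤ (k *ⁿ m) j k (subst₂ _≤ⁿ_ (sym ej) (trans (ℕP.*-suc k m) (ℕP.+-comm k (k *ⁿ m)))
        (ℕP.<⇒≤ (÷-hi x hk)))
    up : ℓ x ≤ ℓ k + ℓ m + inv m
    up = subst₂ (λ a b → ℓ a ≤ b + inv m) ej (ℓ-* hk hm) (≤-trans
        (ℓ-gap j (ℕP.*-mono-≤ hk hm) (subst (_≤ⁿ X) (sym ej) (ℕP.<⇒≤ hX)))
        (≤-refl {ℓ (k *ⁿ m)} +≤ subst (ι j * inv (k *ⁿ m) ≤_) (ι*inv-* hk hm)
        (*-monoʳ (inv (k *ⁿ m)) (inv≥0 (k *ⁿ m)) (ι-mono j≤k))))

  -- Multiply `selbergSum x` by `ℓ x`, split `ℓ x` as `ℓ (x ÷ k) + ℓ k + e k` and eliminate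
  -- `ℓ (x ÷ k) * R (x ÷ k)` through `selbergSum (x ÷ k)`. What remains is `R` weighted by `Λ * Λ`
  -- and by `Λ ℓ` with opposite signs; absolute values join the two into `Λ₂`. The majorant `U` is
  -- free so that `improve` can insert smaller values at good points.
  selberg : ∀ {x} (U : ℕ → ℚ) → 1 ≤ⁿ x → x <ⁿ X → (∀ m → 1 ≤ⁿ m → m ≤ⁿ x → ∣ R m ∣≤ U m) →
    ∣ ℓ x * ℓ x * R x ∣≤ Σ x (λ n → Λ₂ n * U (x ÷ n)) + (ι 30 * (ι x * ℓ x) + ι 16 * ι x)
  selberg {x} U hx h hU = subst (∣_∣≤ Σ x (λ n → Λ₂ n * U (x ÷ n)) + (ι 30 * (ι x * ℓ x) + ι 16 * ι x))
      (sym id)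
      (abs-mono (abs-- (abs-- (abs-+ (abs-- bS bΛS) b2) b3) b4)
          (r9 (ℓ x) (ι x) (T x) (ψ x) (Σ x (λ n → ΛΛ n * U (x ÷ n))) (Σ x (λ n → Λ n * ℓ n * U (x ÷ n)))
          (Σ x (λ n → Λ₂ n * U (x ÷ n))) split (T≤ hx (ℕP.<⇒≤ h)) (ψ-≤ h)))
    where
    e : ℕ → ℚ
    e k = ℓ x - ℓ (x ÷ k) - ℓ k
    P0 = Σ x (λ k → Λ k * R (x ÷ k))
    P1 = Σ x (λ k → Λ k * (ℓ (x ÷ k) * R (x ÷ k)))
    P2 = Σ x (λ k → ΛΛ k * R (x ÷ k))
    P3 = Σ x (λ k → Λ k * ℓ k * R (x ÷ k))
    P4 = Σ x (λ k → Λ k * (e k * R (x ÷ k)))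
    P₅ = Σ x (λ k → Λ k * selbergSum (x ÷ k))
    ra : ∀ a lx lm lk rr → lx * (a * rr) ≡ a * (lm * rr) + a * lk * rr + a * ((lx - lm - lk) * rr)
    ra = solve-∀ ℚR
    eq0 : ℓ x * P0 ≡ P1 + P3 + P4
    eq0 = trans (sym (Σ-*ˡ x (ℓ x) (λ k → Λ k * R (x ÷ k))))
        (trans (Σ-cong x (λ k _ _ → ra (Λ k) (ℓ x) (ℓ (x ÷ k)) (ℓ k) (R (x ÷ k))))
      (trans (Σ-+ x (λ k → Λ k * (ℓ (x ÷ k) * R (x ÷ k)) + Λ k * ℓ k * R (x ÷ k))
          (λ k → Λ k * (e k * R (x ÷ k)))) (cong (_+ P4) (Σ-+ x (λ k → Λ k * (ℓ (x ÷ k) * R (x ÷ k)))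
          (λ k → Λ k * ℓ k * R (x ÷ k))))))
    eqS : P₅ ≡ P1 + P2
    eqS = trans (Σ-cong x (λ k hk _ → trans (*-distribˡ-+ (Λ k) (ℓ (x ÷ k) * R (x ÷ k))
        (Σ (x ÷ k) (λ j → Λ j * R ((x ÷ k) ÷ j)))) (cong (λ z → Λ k * (ℓ (x ÷ k) * R (x ÷ k)) + Λ k * z)
        (Σ-cong (x ÷ k) (λ j hj _ → cong (λ z → Λ j * R z) (÷-÷ x hk hj))))))
      (trans (Σ-+ x (λ k → Λ k * (ℓ (x ÷ k) * R (x ÷ k))) (λ k →
          Λ k * Σ (x ÷ k) (λ j → Λ j * R (x ÷ (k *ⁿ j))))) (cong (P1 +_) (convolve x (λ m → R (x ÷ m)))))
    r0 : ∀ l rr p0 p1 p2 p3 p4 → l * p0 ≡ p1 + p3 + p4 → l * l * rr ≡ l * (l * rr + p0) - (p1 + p2) +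
        p2 - p3 - p4
    r0 l rr p0 p1 p2 p3 p4 q = trans (r00 l rr p0) (trans (cong (λ z → l * (l * rr + p0) - z) q)
        (r01 (l * (l * rr + p0)) p1 p2 p3 p4))
      where
      r00 : ∀ l rr p0 → l * l * rr ≡ l * (l * rr + p0) - l * p0
      r00 = solve-∀ ℚR
      r01 : ∀ z p1 p2 p3 p4 → z - (p1 + p3 + p4) ≡ z - (p1 + p2) + p2 - p3 - p4
      r01 = solve-∀ ℚR
    id : ℓ x * ℓ x * R x ≡ ℓ x * selbergSum x - P₅ + P2 - P3 - P4
    id = trans (r0 (ℓ x) (R x) P0 P1 P2 P3 P4 eq0) (cong (λ z → ℓ x * selbergSum x - z + P2 - P3 - P4)
        (sym eqS))
    mX : ∀ k → x ÷ k <ⁿ X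
    mX k = ℕP.≤-<-trans (÷≤ x k) h
    bS : ∣ ℓ x * selbergSum x ∣≤ ℓ x * (ι 15 * ι x)
    bS = abs-scale (ℓ≥0 x) (selbergSum-abs hx h)
    rc : ∀ a b c → a * (b * c) ≡ b * (a * c)
    rc = solve-∀ ℚR
    bΛS : ∣ P₅ ∣≤ ι 15 * T x
    bΛS = subst (∣ P₅ ∣≤_) (trans (Σ-cong x (λ k _ _ → rc (Λ k) (ι 15) (ι (x ÷ k))))
        (trans (Σ-*ˡ x (ι 15) (λ k → Λ k * ι (x ÷ k))) (cong (ι 15 *_) (sym (T-Λ x)))))
        (abs-Σ x (λ k hk kx → abs-scale (Λ-nonneg k) (selbergSum-abs (÷-≥1 hk kx) (mX k))))
    bU : ∀ k → 1 ≤ⁿ k → k ≤ⁿ x → ∣ R (x ÷ k) ∣≤ U (x ÷ k)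
    bU k hk kx = hU (x ÷ k) (÷-≥1 hk kx) (÷≤ x k)
    b2 : ∣ P2 ∣≤ Σ x (λ n → ΛΛ n * U (x ÷ n))
    b2 = abs-Σ x (λ k hk kx → abs-scale (ΛΛ≥0 k) (bU k hk kx))
    b3 : ∣ P3 ∣≤ Σ x (λ n → Λ n * ℓ n * U (x ÷ n))
    b3 = abs-Σ x (λ k hk kx → abs-scale (*≥0 (Λ-nonneg k) (ℓ≥0 k)) (bU k hk kx))
    four : ∀ k → 1 ≤ⁿ k → k ≤ⁿ x → inv (x ÷ k) * (ι 4 * ι (x ÷ k)) ≡ ι 4
    four k hk kx = trans (rd (inv (x ÷ k)) (ι (x ÷ k))) (trans (cong (ι 4 *_) (inv*ι (÷-≥1 hk kx)))
        (*-identityʳ (ι 4)))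
      where
      rd : ∀ a b → a * (ι 4 * b) ≡ ι 4 * (a * b)
      rd = solve-∀ ℚR
    b4 : ∣ P4 ∣≤ ψ x * ι 4
    b4 = subst (∣ P4 ∣≤_) (Σ-*ʳ x (ι 4) Λ) (abs-Σ x (λ k hk kx →
        abs-scale (Λ-nonneg k) (subst (∣ e k * R (x ÷ k) ∣≤_) (four k hk kx)
        (abs-* (ℓ-÷-error hk kx h) (R-abs (mX k))))))
    rs : ∀ a l b u → a * l * u + b * u ≡ (a * l + b) * u
    rs = solve-∀ ℚR
    split : Σ x (λ n → Λ₂ n * U (x ÷ n)) ≡ Σ x (λ n → Λ n * ℓ n * U (x ÷ n)) + Σ x (λ n → ΛΛ n * U (x ÷ n))
    split = trans (Σ-cong x (λ n _ _ → sym (rs (Λ n) (ℓ n) (ΛΛ n) (U (x ÷ n)))))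
        (Σ-+ x (λ n → Λ n * ℓ n * U (x ÷ n)) (λ n → ΛΛ n * U (x ÷ n)))
    r9 : ∀ l x t p b c u → u ≡ c + b → t ≤ x * l → p ≤ ι 4 * x → l * (ι 15 * x) + ι 15 * t + b + c +
        p * ι 4 ≤ u + (ι 30 * (x * l) + ι 16 * x)
    r9 l x t p b c u refl q s = lin ((ι≥0 15 ·≤ q) +≤ (ι≥0 4 ·≤ s)) (solve (l ∷ x ∷ t ∷ p ∷ b ∷ c ∷ []) ℚR)

  N₂ : ℕ → ℚ
  N₂ x = Σ x (λ n → Λ₂ n * inv n)

  -- Partial summation: the step is `ψ₂ m / (m (m + 1)) ≤ (2 ℓ(m) + 20) / (m + 1)`, and the right
  -- side grows by at least that much because `ℓ` grows by at least `1 / (m + 1)`.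
  N₂-ψ₂ : ∀ {x} → 1 ≤ⁿ x → x <ⁿ X → N₂ x - ψ₂ x * inv x ≤ ℓ x * ℓ x + ι 20 * ℓ x
  N₂-ψ₂ {suc zero} _ _ = r (Λ₂ 1) (ℓ 1) ℓ-1
    where
    r0 : ∀ a → 0ℚ + a * 1ℚ - (0ℚ + a) * 1ℚ ≤ 0ℚ * 0ℚ + ι 20 * 0ℚ
    r0 a = ≤-reflexive (solve (a ∷ []) ℚR)
    r : ∀ a l → l ≡ 0ℚ → 0ℚ + a * 1ℚ - (0ℚ + a) * 1ℚ ≤ l * l + ι 20 * l
    r a l refl = r0 a
  N₂-ψ₂ {suc (suc n)} _ h = r (N₂ m) (ψ₂ m) (inv m) (inv (suc m)) (Λ₂ (suc m)) (ℓ m) (ℓ (suc m)) (ι m)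
      (N₂-ψ₂ {suc n} z<s hm) (sym (inv-step {m} z<s)) (proj₂ (ψ₂-abs {m} z<s hm)) (inv≥0 m) (inv≥0 (suc m))
      (ι*inv {m} z<s) (ℓ-lo {m} z<s hm) (ℓ≥0 m)
    where
    m = suc n
    hm : m <ⁿ X
    hm = ℕP.<-trans (ℕP.n<1+n m) h
    r3 : ∀ N a i j b l l′ x → N - a * i ≤ l * l + ι 20 * l → a - ι 2 * (x * l) ≤ ι 20 * x → 0ℚ ≤ i * j →
        0ℚ ≤ (ι 2 * l + ι 20) * (l′ - (l + j)) → 0ℚ ≤ (l′ - l) * (l′ - l) →
      N + b * j - (a + b) * j - a * (i - j - i * j) - (x * i - 1ℚ) * (j * (ι 2 * l + ι 20)) ≤ l′ * l′ +
          ι 20 * l′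
    r3 N a i j b l l′ x p q z s t = lin (p +≤ (z ·≤ q) +≤ s +≤ t)
        (solve (N ∷ a ∷ i ∷ j ∷ b ∷ l ∷ l′ ∷ x ∷ []) ℚR)
    r4 : ∀ c a k w → c - a * (k - k) - (1ℚ - 1ℚ) * w ≡ c
    r4 = solve-∀ ℚR
    r5 : ∀ i j k → i ≡ j + k → i - j - k ≡ 1ℚ - 1ℚ
    r5 i j k refl = go j k
      where
      go : ∀ j k → j + k - j - k ≡ 1ℚ - 1ℚ
      go = solve-∀ ℚR
    r : ∀ N a i j b l l′ x → N - a * i ≤ l * l + ι 20 * l → i ≡ j + i * j → a - ι 2 * (x * l) ≤ ι 20 * x →
        0ℚ ≤ i → 0ℚ ≤ j → x * i ≡ 1ℚ → l + j ≤ l′ → 0ℚ ≤ l → N + b * j - (a + b) * j ≤ l′ * l′ + ι 20 * l′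
    r N a i j b l l′ x p e q hi hj e1 s hl = subst (_≤ l′ * l′ + ι 20 * l′)
        (trans (cong₂ (λ u v → N + b * j - (a + b) * j - a * u - (v - 1ℚ) * (j * (ι 2 * l + ι 20)))
            (r5 i j (i * j) e) e1) (r4 (N + b * j - (a + b) * j) a 1ℚ (j * (ι 2 * l + ι 20))))
        (r3 N a i j b l l′ x p q (*≥0 hi hj) (*≥0 (+≥0 (*≥0 (ι≥0 2) hl) (ι≥0 20)) (diff≥0 s)) (*≥0 d d))
      where
      d : 0ℚ ≤ l′ - l
      d = r6 l l′ j hj s
        where
        r6 : ∀ l l′ j → 0ℚ ≤ j → l + j ≤ l′ → 0ℚ ≤ l′ - l
        r6 l l′ j p q = lin (p +≤ q) (solve (l ∷ l′ ∷ j ∷ []) ℚR)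

  N₂-hi : ∀ {x} → 1 ≤ⁿ x → x <ⁿ X → N₂ x ≤ ℓ x * ℓ x + ι 22 * ℓ x + ι 20
  N₂-hi {x} hx h = r (N₂ x) (ψ₂ x) (inv x) (ι x) (ℓ x) (N₂-ψ₂ hx h) (inv≥0 x) (proj₂ (ψ₂-abs hx h)) (inv*ι hx)
    where
    r0 : ∀ N a i x l → N - a * i ≤ l * l + ι 20 * l → 0ℚ ≤ i → a - ι 2 * (x * l) ≤ ι 20 * x →
        N ≤ l * l + ι 20 * l + (ι 2 * l + ι 20) * (i * x)
    r0 N a i x l p z q = lin (p +≤ (z ·≤ q)) (solve (N ∷ a ∷ i ∷ x ∷ l ∷ []) ℚR)
    r1 : ∀ l → l * l + ι 20 * l + (ι 2 * l + ι 20) * 1ℚ ≡ l * l + ι 22 * l + ι 20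
    r1 = solve-∀ ℚR
    r : ∀ N a i x l → N - a * i ≤ l * l + ι 20 * l → 0ℚ ≤ i → a - ι 2 * (x * l) ≤ ι 20 * x → i * x ≡ 1ℚ →
        N ≤ l * l + ι 22 * l + ι 20
    r N a i x l p z q e = subst (N ≤_) (trans (cong (λ w → l * l + ι 20 * l + (ι 2 * l + ι 20) * w) e)
        (r1 l)) (r0 N a i x l p z q)

  J : ℕ → ℚ
  J x = Σ x (λ m → R m * (inv m - inv (suc m)))

  -- Partial summation of `Λ k / k` against `ψ`, with `m / (m (m + 1)) = 1 / (m + 1)`. In `J-abs`
  -- the logarithms in `mertens x` and in `H` then cancel.
  J-id : ∀ x → J x + ψ x * inv (suc x) + H (suc x) ≡ mertens x + 1ℚ
  J-id zero = refl
  J-id (suc x) = r (J x) (ψ x) (Λ m) (ι m) (inv m) (inv (suc m)) (H m) (mertens x) (J-id x) (ι*inv {m} z<s)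
      (ι*inv {suc m} z<s)
    where
    m = suc x
    r0 : ∀ J p l n i j h → J + (p + l - n) * (i - j) + (p + l) * j + (h + j) ≡ J + p * i + h + l * i -
        (n * i - (1ℚ + n) * j)
    r0 = solve-∀ ℚR
    r1 : ∀ M a → M + 1ℚ + a - (1ℚ - 1ℚ) ≡ M + a + 1ℚ
    r1 = solve-∀ ℚR
    r : ∀ J p l n i j h M → J + p * i + h ≡ M + 1ℚ → n * i ≡ 1ℚ → (1ℚ + n) * j ≡ 1ℚ →
        J + (p + l - n) * (i - j) + (p + l) * j + (h + j) ≡ M + l * i + 1ℚ
    r J p l n i j h M e e1 e2 = trans (r0 J p l n i j h) (trans
        (cong₂ (λ u v → u + l * i - v) e (cong₂ (λ a b → a - b) e1 e2)) (r1 M (l * i)))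

  J-abs : ∀ {x} → 1 ≤ⁿ x → x <ⁿ X → ∣ J x ∣≤ ι 6
  J-abs {x} hx h =
      lo (J x) (ψ x * inv (suc x)) (H x) (inv (suc x)) (mertens x) (ℓ x) (J-id x) (mertens-lo hx xX) pi
          (H≤ℓ+1 hx xX) (inv≤1 (suc x))
    , hi (J x) (ψ x * inv (suc x)) (H x) (inv (suc x)) (mertens x) (ℓ x) γ (J-id x) (mertens-hi hx h)
        (*≥0 (ψ≥0 x) (inv≥0 (suc x))) (γ-lo hx xX) γ≥0 (inv≥0 (suc x))
    where
    xX = ℕP.<⇒≤ h
    pi : ψ x * inv (suc x) ≤ ι 4
    pi = ≤-trans (*-mono (ψ≥0 x) (≤-trans (ψ-≤ h) (ι≥0 4 ·≤ ι-mono (ℕP.n≤1+n x))) (inv≥0 (suc x)) ≤-refl)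
        (≤-reflexive (trans (*-assoc (ι 4) (ι (suc x)) (inv (suc x)))
        (trans (cong (ι 4 *_) (ι*inv {suc x} z<s)) (*-identityʳ (ι 4)))))
    lo0 : ∀ p h i M l → l - 1ℚ ≤ M → p ≤ ι 4 → h ≤ l + 1ℚ → i ≤ 1ℚ → - ι 6 ≤ M + 1ℚ - (p + (h + i))
    lo0 p h i M l a b c d = lin (a +≤ b +≤ c +≤ d) (solve (p ∷ h ∷ i ∷ M ∷ l ∷ []) ℚR)
    rj : ∀ j p h → j ≡ j + p + h - (p + h)
    rj = solve-∀ ℚR
    lo : ∀ j p h i M l → j + p + (h + i) ≡ M + 1ℚ → l - 1ℚ ≤ M → p ≤ ι 4 → h ≤ l + 1ℚ → i ≤ 1ℚ → - ι 6 ≤ j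
    lo j p h i M l e a b c d = subst (- ι 6 ≤_) (sym (trans (rj j p (h + i)) (cong (_- (p + (h + i))) e)))
        (lo0 p h i M l a b c d)
    hi0 : ∀ p h i M l g → M ≤ l + ι 4 → 0ℚ ≤ p → l + g ≤ h → 0ℚ ≤ g → 0ℚ ≤ i → M + 1ℚ - (p + (h + i)) ≤ ι 6
    hi0 p h i M l g a b c d e = lin (a +≤ b +≤ c +≤ d +≤ e +≤ 0≤1) (solve (p ∷ h ∷ i ∷ M ∷ l ∷ g ∷ []) ℚR)
    hi : ∀ j p h i M l g → j + p + (h + i) ≡ M + 1ℚ → M ≤ l + ι 4 → 0ℚ ≤ p → l + g ≤ h → 0ℚ ≤ g → 0ℚ ≤ i →
        j ≤ ι 6
    hi j p h i M l g e a b c d f = subst (_≤ ι 6) (sym (trans (rj j p (h + i)) (cong (_- (p + (h + i))) e)))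
        (hi0 p h i M l g a b c d f)

  -- Intervals on which R is small

  ℓ-2^ : ∀ k → ι k ≤ ι 2 * ℓ (2 ^ⁿ k)
  ℓ-2^ zero = *≥0 (ι≥0 2) (ℓ≥0 1)
  ℓ-2^ (suc k) = subst (λ z → ι (suc k) ≤ ι 2 * z) (sym (ℓ-* {2} {2 ^ⁿ k} z<s (1≤p^k k z<s)))
      (r (ι k) (ℓ (2 ^ⁿ k)) (ℓ 2) (ℓ-2^ k) half-≤)
    where
    r : ∀ k l l2 → k ≤ ι 2 * l → 1ℚ ≤ ι 2 * l2 → 1ℚ + k ≤ ι 2 * (l2 + l)
    r k l l2 p q = lin (p +≤ q) (solve (k ∷ l ∷ l2 ∷ []) ℚR)
    r1 : ∀ l1 l2 i → l1 + i ≤ l2 → 0ℚ ≤ l1 → i ≤ l2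
    r1 l1 l2 i p q = lin (p +≤ q) (solve (l1 ∷ l2 ∷ i ∷ []) ℚR)
    half-≤ : 1ℚ ≤ ι 2 * ℓ 2
    half-≤ = subst (_≤ ι 2 * ℓ 2) (ι*inv {2} z<s) (ι≥0 2 ·≤ r1 (ℓ 1) (ℓ 2) (inv 2) (ℓ-lo {1} z<s 2≤X) (ℓ≥0 1))

  -- ψ₂ long run of Q m ≥ m / N would make Σ Q m / (m (m + 1)) exceed 12.
  no-run : ∀ (Q : ℕ → ℚ) {y N} → 1 ≤ⁿ y → K₀ N *ⁿ y <ⁿ X →
    Σ (K₀ N *ⁿ y) (λ m → Q m * (inv m - inv (suc m))) - Σ y (λ m → Q m * (inv m - inv (suc m))) ≤ ι 12 →
    ¬ (∀ m → y <ⁿ m → m ≤ⁿ K₀ N *ⁿ y → ι m ≤ ι N * Q m)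
  no-run Q {y} {N} hy hX hJ all = ℚP.<-irrefl refl (<-≤-trans 0<1
      (final (Σ z f - Σ y f) (H (suc z)) (H (suc y)) (H y) (H z) (ℓ z) (ℓ y) (ℓ (K₀ N)) (inv y) (inv z)
      (inv (suc y)) (ι (24 *ⁿ N +ⁿ 6)) (ι N) s1 eN (ℓ-2^ (24 *ⁿ N +ⁿ 6)) (ℓ-* (K₀≥1 N) hy)
      (H-ℓ-mono hy y≤z (ℕP.<⇒≤ hX)) (inv≤1 y) (inv≥0 z) (inv≤1 (suc y)) (inv≥0 (suc z)) hJ (ι≥0 N) refl refl))
    where
    z = K₀ N *ⁿ y
    y≤z = y≤K₀y N y
    f : ℕ → ℚ
    f m = Q m * (inv m - inv (suc m))
    weight≥0 : ∀ m → 1 ≤ⁿ m → 0ℚ ≤ inv m - inv (suc m)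
    weight≥0 m hm = diff≥0 (inv-anti hm (ℕP.n≤1+n m))
    rt0 : ∀ m i j → m * (i - j) ≡ m * i - (1ℚ + m) * j + j
    rt0 = solve-∀ ℚR
    rt1 : ∀ j → 1ℚ - 1ℚ + j ≡ j
    rt1 = solve-∀ ℚR
    rt2 : ∀ n q w → w * (n * q) ≡ n * (q * w)
    rt2 = solve-∀ ℚR
    wt : ∀ m → 1 ≤ⁿ m → (inv m - inv (suc m)) * ι m ≡ inv (suc m)
    wt m hm = trans (*-comm _ (ι m)) (trans (rt0 (ι m) (inv m) (inv (suc m)))
        (trans (cong₂ (λ a b → a - b + inv (suc m)) (ι*inv hm) (ι*inv {suc m} z<s)) (rt1 (inv (suc m)))))
    s0 : Σ z (λ m → inv (suc m)) - Σ y (λ m → inv (suc m)) ≤ Σ z (λ m → ι N * f m) - Σ y (λ m → ι N * f m)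
    s0 = Σ-range _ _ y≤z (λ m a b → subst₂ _≤_ (wt m (ℕP.≤-trans z<s a))
        (rt2 (ι N) (Q m) (inv m - inv (suc m))) (weight≥0 m (ℕP.≤-trans z<s a) ·≤ all m a b))
    rs : ∀ a b c → a - b ≡ c + a - (c + b)
    rs = solve-∀ ℚR
    rm : ∀ n a b → n * a - n * b ≡ n * (a - b)
    rm = solve-∀ ℚR
    s1 : H (suc z) - H (suc y) ≤ ι N * (Σ z f - Σ y f)
    s1 = subst₂ _≤_ (trans (rs (Σ z (λ m → inv (suc m))) (Σ y (λ m → inv (suc m))) (inv 1))
        (cong₂ (λ a b → a - b) (sym (Σ-head z inv)) (sym (Σ-head y inv))))
      (trans (cong₂ (λ a b → a - b) (Σ-*ˡ z (ι N) f) (Σ-*ˡ y (ι N) f)) (rm (ι N) (Σ z f) (Σ y f))) s0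
    eN : ι (24 *ⁿ N +ⁿ 6) ≡ ι 24 * ι N + ι 6
    eN = trans (ι-+ (24 *ⁿ N) 6) (cong (_+ ι 6) (ι-* 24 N))
    final0 : ∀ D hy hz lz ly lK iy iz iy′ iz′ N → hz + iz′ - (hy + iy′) ≤ N * D → ι 24 * N + ι 6 ≤ ι 2 * lK →
        lz ≡ lK + ly → hy - ly - iy ≤ hz - lz - iz → iy ≤ 1ℚ → 0ℚ ≤ iz → iy′ ≤ 1ℚ → 0ℚ ≤ iz′ → D ≤ ι 12 →
        0ℚ ≤ N → ι 2 * 1ℚ ≤ ι 2 * 0ℚ
    final0 D hy hz lz ly lK iy iz iy′ iz′ N a b refl c d e f g h n =
        lin ((ι≥0 2 ·≤ (a +≤ c +≤ d +≤ e +≤ f +≤ g +≤ (n ·≤ h))) +≤ b)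
        (solve (D ∷ hy ∷ hz ∷ ly ∷ lK ∷ iy ∷ iz ∷ iy′ ∷ iz′ ∷ N ∷ []) ℚR)
    final : ∀ D hz′ hy′ hy hz lz ly lK iy iz iy′ k N → hz′ - hy′ ≤ N * D → k ≡ ι 24 * N + ι 6 →
        k ≤ ι 2 * lK → lz ≡ lK + ly → hy - ly - iy ≤ hz - lz - iz → iy ≤ 1ℚ → 0ℚ ≤ iz → iy′ ≤ 1ℚ →
        0ℚ ≤ inv (suc z) → D ≤ ι 12 → 0ℚ ≤ N → hz′ ≡ hz + inv (suc z) → hy′ ≡ hy + iy′ → 1ℚ ≤ 0ℚ
    final D hz′ hy′ hy hz lz ly lK iy iz iy′ k N a refl b e c d f g i h n refl refl =
        ι-cancelˡ {2} z<s (final0 D hy hz lz ly lK iy iz iy′ (inv (suc z)) N a b e c d f g i h n)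

  abs-diff : ∀ {a b} → ∣ a ∣≤ ι 6 → ∣ b ∣≤ ι 6 → a - b ≤ ι 12
  abs-diff p q = proj₂ (abs-- p q)

  -- Otherwise `- R` would form a run excluded by `no-run`; its weighted sum is `- J`, so the bound
  -- 12 applies to it as well.
  low-point : ∀ {y N} → 1 ≤ⁿ y → K₀ N *ⁿ y <ⁿ X → ∃ λ m → (y <ⁿ m) × (m ≤ⁿ K₀ N *ⁿ y) × (- ι m ≤ ι N * R m)
  low-point {y} {N} hy hX = go (first (λ m → - ι m ≤? ι N * R m) y (z ∸ⁿ y))
    where
    z = K₀ N *ⁿ y
    ez : y +ⁿ (z ∸ⁿ y) ≡ z
    ez = ℕP.m+[n∸m]≡n (y≤K₀y N y)
    rn : ∀ a w → - (a * w) ≡ - a * w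
    rn = solve-∀ ℚR
    r : ∀ m n q → n * q ≤ - m → m ≤ n * - q
    r m n q p = lin p (solve (m ∷ n ∷ q ∷ []) ℚR)
    rd : ∀ a b → - a - - b ≡ b - a
    rd = solve-∀ ℚR
    neg : ∀ x → Σ x (λ m → - R m * (inv m - inv (suc m))) ≡ - J x
    neg x = trans (Σ-cong x (λ m _ _ → sym (rn (R m) (inv m - inv (suc m)))))
        (Σ-neg x (λ m → R m * (inv m - inv (suc m))))
    go : _ → _
    go (inj₁ (m , a , b , p , _)) = m , a , subst (m ≤ⁿ_) ez b , p
    go (inj₂ none) = ⊥-elim (no-run (λ m → - R m) {y} {N} hy hX
        (subst (_≤ ι 12) (sym (trans (cong₂ (λ a b → a - b) (neg z) (neg y)) (rd (J z) (J y))))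
        (abs-diff (J-abs hy (ℕP.≤-<-trans (y≤K₀y N y) hX)) (J-abs (ℕP.≤-trans hy (y≤K₀y N y)) hX)))
      (λ m a b → r (ι m) (ι N) (R m) (<⇒≤ (≰⇒> (none m a (subst (m ≤ⁿ_) (sym ez) b))))))

  high-point : ∀ {y N} → 1 ≤ⁿ y → K₀ N *ⁿ y <ⁿ X → ∃ λ m → (y <ⁿ m) × (m ≤ⁿ K₀ N *ⁿ y) × (ι N * R m ≤ ι m) ×
      (∀ u → y <ⁿ u → u <ⁿ m → ι u ≤ ι N * R u)
  high-point {y} {N} hy hX = go (first (λ m → ι N * R m ≤? ι m) y (z ∸ⁿ y))
    where
    z = K₀ N *ⁿ y
    ez : y +ⁿ (z ∸ⁿ y) ≡ z
    ez = ℕP.m+[n∸m]≡n (y≤K₀y N y)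
    go : _ → _
    go (inj₁ (m , a , b , p , l)) = m , a , subst (m ≤ⁿ_) ez b , p , λ u c d → <⇒≤ (≰⇒> (l u c d))
    go (inj₂ none) = ⊥-elim (no-run R {y} {N} hy hX (abs-diff (J-abs (ℕP.≤-trans hy (y≤K₀y N y)) hX)
        (J-abs hy (ℕP.≤-<-trans (y≤K₀y N y) hX)))
      (λ m a b → <⇒≤ (≰⇒> (none m a (subst (m ≤ⁿ_) (sym ez) b)))))

  R-lip : ∀ {m s} → m ≤ⁿ s → R m + ι m ≤ R s + ι s
  R-lip {m} {s} h = r (ψ m) (ψ s) (ι m) (ι s) (ψ-mono h)
    where
    r : ∀ a b c d → a ≤ b → a - c + c ≤ b - d + d
    r a b c d p = lin p (solve (a ∷ b ∷ c ∷ d ∷ []) ℚR)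

  Good : ℕ → ℕ → Set
  Good N m = ∣ ι N * R m ∣≤ ι 2 * ι m

  good? : ∀ N m → Dec (Good N m)
  good? N m = (- (ι 2 * ι m) ≤? ι N * R m) ×-dec (ι N * R m ≤? ι 2 * ι m)

  -- ψ is monotone, so R falls with slope at most 1: after a point where R is large, R crosses the strip |R m| ≤ 2 m / N slowly.
  good-interval : ∀ {N y} → 1 ≤ⁿ N → 1 ≤ⁿ y → K N *ⁿ y <ⁿ X →
    ∃ λ a → ∃ λ d → (y ≤ⁿ a) × (a +ⁿ d ≤ⁿ K N *ⁿ y) × (a ≤ⁿ 4 *ⁿ N *ⁿ suc d) × (∀ u → a <ⁿ u → u ≤ⁿ a +ⁿ d →
        Good N u)
  good-interval {N} {y} hN hy hX = go₁ (low-point {y} {N} hy (ℕP.≤-<-trans K₀y≤Ky hX))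
    where
    k = K₀ N
    Ky : K N *ⁿ y ≡ k *ⁿ (k *ⁿ y +ⁿ k *ⁿ y)
    Ky = e k y
      where
      e : ∀ k y → 2 *ⁿ (k *ⁿ k) *ⁿ y ≡ k *ⁿ (k *ⁿ y +ⁿ k *ⁿ y)
      e = NS.solve-∀
    2K₀y≤Ky : k *ⁿ y +ⁿ k *ⁿ y ≤ⁿ K N *ⁿ y
    2K₀y≤Ky = subst (k *ⁿ y +ⁿ k *ⁿ y ≤ⁿ_) (sym Ky) (y≤K₀y N _)
    K₀y≤Ky : k *ⁿ y ≤ⁿ K N *ⁿ y
    K₀y≤Ky = ℕP.≤-trans (ℕP.m≤m+n (k *ⁿ y) (k *ⁿ y)) 2K₀y≤Ky
    Result = ∃ λ a → ∃ λ d → (y ≤ⁿ a) × (a +ⁿ d ≤ⁿ K N *ⁿ y) × (a ≤ⁿ 4 *ⁿ N *ⁿ suc d) ×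
        (∀ u → a <ⁿ u → u ≤ⁿ a +ⁿ d → Good N u)
    go₁ : (∃ λ m → (y <ⁿ m) × (m ≤ⁿ k *ⁿ y) × (- ι m ≤ ι N * R m)) → Result
    -- Slope at least -1 keeps `R s ≥ - 2 s / N` for `m / N` steps after `m`. If `R` also stays
    -- below `2 s / N`, this stretch is the interval; otherwise the strip is left upwards at some
    -- `s`.
    go₁ (m , ym , mK , low) = go₂ (first (λ s → ι 2 * ι s ℚP.<? ι N * R s) m w)
      where
      w = m ÷ N
      w≤m : w ≤ⁿ m
      w≤m = ÷≤ m N
      4N≥N : N ≤ⁿ 4 *ⁿ N
      4N≥N = ℕP.m≤m+n N _
      Nw : ι N * ι w ≤ ι m
      Nw = subst (_≤ ι m) (ι-* N w) (ι-mono (÷-lo m N))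
      lower : ∀ s → m <ⁿ s → s ≤ⁿ m +ⁿ w → - (ι 2 * ι s) ≤ ι N * R s
      lower s ms sm = r (ι N) (R m) (R s) (ι m) (ι s) (ι w) low (ι≥0 N ·≤ R-lip (ℕP.<⇒≤ ms))
          (ι≥0 N ·≤ subst (ι s ≤_) (ι-+ m w) (ι-mono sm)) Nw (ι-mono (ℕP.<⇒≤ ms))
        where
        r : ∀ n rm rs m s w → - m ≤ n * rm → n * (rm + m) ≤ n * (rs + s) → n * s ≤ n * (m + w) → n * w ≤ m →
            m ≤ s → - (ι 2 * s) ≤ n * rs
        r n rm rs m s w a b c d e = lin (a +≤ b +≤ c +≤ d +≤ (ι≥0 2 ·≤ e))
            (solve (n ∷ rm ∷ rs ∷ m ∷ s ∷ w ∷ []) ℚR)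
      go₂ : _ → Result
      go₂ (inj₂ none) = m , w , ℕP.<⇒≤ ym , ℕP.≤-trans (ℕP.+-mono-≤ mK (ℕP.≤-trans w≤m mK)) 2K₀y≤Ky ,
          ℕP.≤-trans (ℕP.<⇒≤ (÷-hi m hN)) (ℕP.*-monoˡ-≤ (suc w) 4N≥N)
        , λ u a b → lower u a b , ℚP.≮⇒≥ (none u a b)
      -- Now `R` lies above the strip at `s`. Up to the first later `t` with `R t ≤ t / N` the lower
      -- bound is automatic, and the descent from `2 s / N` to `t / N` must cross the strip.
      go₂ (inj₁ (s , ms , sm , big , _)) = go₃ (high-point {s} {N} hs (ℕP.≤-<-trans K₀s≤Ky hX))
        where
        hs : 1 ≤ⁿ s
        hs = ℕP.≤-trans z<s ms
        s≤ : s ≤ⁿ k *ⁿ y +ⁿ k *ⁿ y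
        s≤ = ℕP.≤-trans sm (ℕP.+-mono-≤ mK (ℕP.≤-trans w≤m mK))
        K₀s≤Ky : k *ⁿ s ≤ⁿ K N *ⁿ y
        K₀s≤Ky = subst (k *ⁿ s ≤ⁿ_) (sym Ky) (ℕP.*-monoʳ-≤ k s≤)
        go₃ : (∃ λ t → (s <ⁿ t) × (t ≤ⁿ k *ⁿ s) × (ι N * R t ≤ ι t) × (∀ u → s <ⁿ u → u <ⁿ t →
            ι u ≤ ι N * R u)) → Result
        go₃ (t , st , tK , top , mid) = a , d , ℕP.≤-trans (ℕP.<⇒≤ (ℕP.<-trans ym ms)) s≤a , ℕP.≤-trans
            (ℕP.<⇒≤ ad<t) (ℕP.≤-trans tK K₀s≤Ky) , ℕP.≤-trans (ℕP.m∸n≤m t (suc d)) (ℕP.<⇒≤ (÷-hi t 4N≥1))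
            , λ u au ud → lo u (ℕP.≤-<-trans s≤a au) (ℕP.≤-<-trans ud ad<t) , up u (ℕP.≤-<-trans ud ad<t)
                (tud u au)
          where
          4N≥1 : 1 ≤ⁿ 4 *ⁿ N
          4N≥1 = ℕP.≤-trans hN 4N≥N
          -- About a quarter of `t / N`: with slope at least -1 the descent takes more than `d`
          -- steps, and for the `d` points just before `t`, `R u ≤ R t + (t - u) ≤ 2 u / N`.
          d = t ÷ (4 *ⁿ N)
          a = t ∸ⁿ suc d
          4Nd : ι 4 * ι N * ι d ≤ ι t
          4Nd = subst (_≤ ι t) (trans (ι-* (4 *ⁿ N) d) (cong (_* ι d) (ι-* 4 N))) (ι-mono (÷-lo t (4 *ⁿ N)))
          r1 : ∀ n rs rt s t d → ι 2 * s ≤ n * rs → n * (rs + s) ≤ n * (rt + t) → n * rt ≤ t → 0ℚ ≤ n →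
              t ≤ s + d → ι 4 * n * d ≤ t → 1ℚ ≤ n → 0ℚ ≤ d → t ≤ 0ℚ
          r1 n rs rt s t d a b c z e f g h = lin ((ι≥0 4 ·≤ (a +≤ b +≤ c +≤ (+≥0 z (ι≥0 2) ·≤ e))) +≤
              (ι≥0 3 ·≤ f) +≤ (ι≥0 8 ·≤ (h ·≤ g))) (solve (n ∷ rs ∷ rt ∷ s ∷ t ∷ d ∷ []) ℚR)
          sd<t : s +ⁿ suc d ≤ⁿ t
          sd<t = subst (_≤ⁿ t) (sym (ℕP.+-suc s d)) (ℕP.≰⇒> λ t≤ → ℕP.<⇒≱ (ℕP.≤-<-trans z≤n st)
              (ι-cancel {t} {0} (r1 (ι N) (R s) (R t) (ι s) (ι t) (ι d) (<⇒≤ big)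
              (ι≥0 N ·≤ R-lip (ℕP.<⇒≤ st)) top (ι≥0 N) (subst (ι t ≤_) (ι-+ s d) (ι-mono t≤)) 4Nd (ι-mono hN)
              (ι≥0 d))))
          ea : a +ⁿ suc d ≡ t
          ea = ℕP.m∸n+n≡m (ℕP.≤-trans (ℕP.m≤n+m (suc d) s) sd<t)
          s≤a : s ≤ⁿ a
          s≤a = ℕP.+-cancelʳ-≤ (suc d) s a (subst (s +ⁿ suc d ≤ⁿ_) (sym ea) sd<t)
          ad<t : a +ⁿ d <ⁿ t
          ad<t = ℕP.≤-reflexive (trans (sym (ℕP.+-suc a d)) ea)
          tud : ∀ u → a <ⁿ u → ι t ≤ ι u + ι d
          tud u au = subst (ι t ≤_) (ι-+ u d) (ι-mono (subst (_≤ⁿ u +ⁿ d) (trans (sym (ℕP.+-suc a d)) ea)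
              (ℕP.+-monoˡ-≤ d au)))
          lo : ∀ u → s <ⁿ u → u <ⁿ t → - (ι 2 * ι u) ≤ ι N * R u
          lo u su ut = r (ι u) (ι N * R u) (mid u su ut) (ι≥0 u)
            where
            r : ∀ u v → u ≤ v → 0ℚ ≤ u → - (ι 2 * u) ≤ v
            r u v p q = lin (p +≤ (ι≥0 3 ·≤ q)) (solve (u ∷ v ∷ []) ℚR)
          up : ∀ u → u <ⁿ t → ι t ≤ ι u + ι d → ι N * R u ≤ ι 2 * ι u
          up u ut tu = r (ι N) (R u) (R t) (ι u) (ι t) (ι d) (ι≥0 N ·≤ R-lip (ℕP.<⇒≤ ut)) top (ι≥0 N) tu 4Nd
              (ι-mono hN) (ι≥0 d)
            where
            r : ∀ n ru rt u t d → n * (ru + u) ≤ n * (rt + t) → n * rt ≤ t → 0ℚ ≤ n → t ≤ u + d →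
                ι 4 * n * d ≤ t → 1ℚ ≤ n → 0ℚ ≤ d → n * ru ≤ ι 2 * u
            r n ru rt u t d a b z c e f g = lin (a +≤ b +≤ (+≥0 z (ι≥0 2) ·≤ c) +≤ e +≤
                (ι≥0 3 ·≤ (g ·≤ f)) +≤ g) (solve (n ∷ ru ∷ rt ∷ u ∷ t ∷ d ∷ []) ℚR)

  -- Improving a bound on R

  goodWeight : ℕ → ℕ → ℕ → ℚ
  goodWeight N x n = Λ₂ n * inv n * χ (good? N (x ÷ n))

  goodWeight≥0 : ∀ N x n → 0ℚ ≤ goodWeight N x n
  goodWeight≥0 N x n = *≥0 (*≥0 (Λ₂≥0 n) (inv≥0 n)) (χ≥0 (good? N (x ÷ n)))

  goodSum : ℕ → ℕ → ℕ → ℚ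
  goodSum N x v = Σ v (goodWeight N x)

  goodSum-mono : ∀ N x {u v} → u ≤ⁿ v → goodSum N x u ≤ goodSum N x v
  goodSum-mono N x h = Σ-grow (goodWeight N x) h (λ i _ _ → goodWeight≥0 N x i)

  ψ₂-hi : ∀ {v u} → v ≤ⁿ u → u <ⁿ X → ψ₂ v ≤ ι 2 * (ι v * ℓ u) + ι 20 * ι v
  ψ₂-hi {zero} {u} _ _ = ≤-reflexive (sym (r (ℓ u)))
    where
    r : ∀ l → ι 2 * (0ℚ * l) + ι 20 * 0ℚ ≡ 0ℚ
    r = solve-∀ ℚR
  ψ₂-hi {suc v} {u} h hX = r (ψ₂ m) (ι m) (ℓ m) (ℓ u) (proj₂ (ψ₂-abs {m} z<s (ℕP.≤-<-trans h hX)))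
      (ι≥0 m ·≤ ℓ-mono z<s h (ℕP.<⇒≤ hX))
    where
    m = suc v
    r : ∀ a m l l′ → a - ι 2 * (m * l) ≤ ι 20 * m → m * l ≤ m * l′ → a ≤ ι 2 * (m * l′) + ι 20 * m
    r a m l l′ p q = lin (p +≤ (ι≥0 2 ·≤ q)) (solve (a ∷ m ∷ l ∷ l′ ∷ []) ℚR)

  -- The range `(v , u]` consists of `n` with `x ÷ n` in a good interval and has length at least
  -- `u / (10 N) - 1`. By `ψ₂-abs` and `ψ₂-hi` its mass is at least `2 ℓ(u) / (10 N) - 42`; here 42
  -- collects 20 from each end and 2 from the rounding.
  block : ∀ {N y x} → 1 ≤ⁿ N → suc (4 *ⁿ N) ≤ⁿ y → K N *ⁿ y ≤ⁿ x → x <ⁿ X →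
    ∃ λ u → (x ÷ (K N *ⁿ y) ≤ⁿ u) × (u ≤ⁿ x) × (goodSum N x (x ÷ suc (K N *ⁿ y)) +
        (ι 2 * inv (10 *ⁿ N) * ℓ u - ι 42) ≤ goodSum N x (x ÷ suc y))
  block {N} {y} {x} hN hy hK hX = go (good-interval {N} {y} hN (ℕP.≤-trans z<s hy) (ℕP.≤-<-trans hK hX))
    where
    Result = ∃ λ u → (x ÷ (K N *ⁿ y) ≤ⁿ u) × (u ≤ⁿ x) × (goodSum N x (x ÷ suc (K N *ⁿ y)) +
        (ι 2 * inv (10 *ⁿ N) * ℓ u - ι 42) ≤ goodSum N x (x ÷ suc y))
    go : (∃ λ a → ∃ λ d → (y ≤ⁿ a) × (a +ⁿ d ≤ⁿ K N *ⁿ y) × (a ≤ⁿ 4 *ⁿ N *ⁿ suc d) ×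
        (∀ u → a <ⁿ u → u ≤ⁿ a +ⁿ d → Good N u)) → Result
    go (a , zero , ya , ad , aN , gd) = ⊥-elim (ℕP.<⇒≱ (ℕP.≤-trans hy ya)
        (subst (a ≤ⁿ_) (ℕP.*-identityʳ (4 *ⁿ N)) aN))
    go (a , d@(suc d₀) , ya , ad , aN , gd) = u , ÷-anti x z<s sa≤ , ÷≤ x (suc a) ,
        ≤-trans (goodSum-mono N x (÷-anti x {suc (a +ⁿ d)} z<s (s≤s ad)) +≤
            ≤-refl {ι 2 * inv (10 *ⁿ N) * ℓ u - ι 42}) (≤-trans main
            (goodSum-mono N x (÷-anti x {suc y} z<s (s≤s ya))))
      where
      sa≤ : suc a ≤ⁿ K N *ⁿ y
      sa≤ = ℕP.≤-trans (subst (suc a ≤ⁿ_) (sym (ℕP.+-suc a d₀)) (s≤s (ℕP.m≤m+n a d₀))) ad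
      u = x ÷ suc a
      v = x ÷ suc (a +ⁿ d)
      hu : 1 ≤ⁿ u
      hu = ÷-≥1 z<s (ℕP.≤-trans sa≤ hK)
      uX : u <ⁿ X
      uX = ℕP.≤-<-trans (÷≤ x (suc a)) hX
      v≤u : v ≤ⁿ u
      v≤u = ÷-anti x z<s (s≤s (ℕP.m≤m+n a d))
      isGood : ∀ n → v <ⁿ n → n ≤ⁿ u → Good N (x ÷ n)
      isGood n vn nu = gd (x ÷ n) (÷-glb hn (subst (_≤ⁿ x) (ℕP.*-comm (suc a) n) (÷-lub {x} {suc a} nu)))
          (ℕP.≮⇒≥ λ lt → ℕP.<⇒≱ vn (÷-glb {x} {suc (a +ⁿ d)} z<s
              (subst (_≤ⁿ x) (ℕP.*-comm n (suc (a +ⁿ d))) (÷-lub {x} {n} lt))))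
        where
        hn : 1 ≤ⁿ n
        hn = ℕP.≤-trans z<s vn
      term : ∀ n → v <ⁿ n → n ≤ⁿ u → Λ₂ n * inv u ≤ goodWeight N x n
      term n vn nu = ≤-trans (Λ₂≥0 n ·≤ inv-anti (ℕP.≤-trans z<s vn) nu)
          (≤-reflexive (sym (trans (cong (Λ₂ n * inv n *_) (χ-yes (good? N (x ÷ n)) (isGood n vn nu)))
          (*-identityʳ (Λ₂ n * inv n)))))
      rng : ψ₂ u * inv u - ψ₂ v * inv u ≤ goodSum N x u - goodSum N x v
      rng = subst (_≤ goodSum N x u - goodSum N x v) (cong₂ (λ a b → a - b) (Σ-*ʳ u (inv u) Λ₂)
          (Σ-*ʳ v (inv u) Λ₂)) (Σ-range (λ n → Λ₂ n * inv u) (goodWeight N x) v≤u term)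
      natN : suc a +ⁿ d ≤ⁿ 10 *ⁿ N *ⁿ d
      natN = ℕP.≤-trans (ℕP.+-monoˡ-≤ d (s≤s aN)) (nat N d₀ hN)
        where
        nat : ∀ N d₀ → 1 ≤ⁿ N → suc (4 *ⁿ N *ⁿ suc (suc d₀)) +ⁿ suc d₀ ≤ⁿ 10 *ⁿ N *ⁿ suc d₀
        nat (suc n) d₀ _ = subst (suc (4 *ⁿ suc n *ⁿ suc (suc d₀)) +ⁿ suc d₀ ≤ⁿ_) (e n d₀)
            (ℕP.m≤m+n _ (2 *ⁿ n +ⁿ 6 *ⁿ n *ⁿ d₀ +ⁿ 5 *ⁿ d₀))
          where
          e : ∀ n d₀ → suc (4 *ⁿ suc n *ⁿ suc (suc d₀)) +ⁿ suc d₀ +ⁿ (2 *ⁿ n +ⁿ 6 *ⁿ n *ⁿ d₀ +ⁿ 5 *ⁿ d₀) ≡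
              10 *ⁿ suc n *ⁿ suc d₀
          e = NS.solve-∀
      uv-nat : v *ⁿ (suc a +ⁿ d) ≤ⁿ suc a *ⁿ suc u
      uv-nat = ℕP.≤-trans (subst (_≤ⁿ x) (ℕP.*-comm (suc (a +ⁿ d)) v) (÷-lo x (suc (a +ⁿ d))))
          (ℕP.<⇒≤ (÷-hi x {suc a} z<s))
      M = 10 *ⁿ N
      hM : 1 ≤ⁿ M
      hM = ℕP.≤-trans hN (ℕP.m≤m+n N _)
      uv : ι d * ι u ≤ ι d * (ι M * (ι u + 1ℚ - ι v))
      uv = r (ι u) (ι v) (ι (suc a)) (ι d) (ι M) (subst₂ _≤_
          (trans (ι-* v (suc a +ⁿ d)) (cong (ι v *_) (ι-+ (suc a) d))) (ι-* (suc a) (suc u)) (ι-mono uv-nat))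
          (subst₂ _≤_ (ι-+ (suc a) d) (ι-* M d) (ι-mono natN)) (ι≥0 d) (ι-mono v≤u)
        where
        r : ∀ u v a d M → v * (a + d) ≤ a * (1ℚ + u) → a + d ≤ M * d → 0ℚ ≤ d → v ≤ u →
            d * u ≤ d * (M * (u + 1ℚ - v))
        r u v a d M p q z w = lin (p +≤ (+≥0 0≤1 (diff≥0 w) ·≤ q) +≤ z) (solve (u ∷ v ∷ a ∷ d ∷ M ∷ []) ℚR)
      uv′ : inv M * ι u ≤ ι u + 1ℚ - ι v
      uv′ = ι-cancelˡ hM (subst (_≤ ι M * (ι u + 1ℚ - ι v)) (sym (ι*inv* (ι u) hM)) (ι-cancelˡ {d} z<s uv))
      main : goodSum N x v + (ι 2 * inv M * ℓ u - ι 42) ≤ goodSum N x u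
      main = fin (goodSum N x u) (goodSum N x v) (ψ₂ u) (ψ₂ v) (inv u) (ι u) (ι v) (ℓ u) (inv M) rng
          (proj₁ (ψ₂-abs hu uX)) (ψ₂-hi v≤u uX) (inv≥0 u) (ι*inv hu) (ℓ≥0 u) uv′ (ι-mono v≤u)
          (ℓ-≤ hu (ℕP.<⇒≤ uX))
        where
        f0 : ∀ gu gv au av i u v l m → au * i - av * i ≤ gu - gv → - (ι 20 * u) ≤ au - ι 2 * (u * l) →
            av ≤ ι 2 * (v * l) + ι 20 * v → 0ℚ ≤ i → 0ℚ ≤ i * l → m * u ≤ u + 1ℚ - v → v ≤ u → l ≤ u →
            gv + (ι 2 * m * l * (u * i) - ι 42 * (u * i)) ≤ gu
        f0 gu gv au av i u v l m a b c hi hil d e f = lin (a +≤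
            (hi ·≤ (b +≤ c +≤ (ι≥0 20 ·≤ e) +≤ (ι≥0 2 ·≤ f))) +≤ (ι≥0 2 ·≤ (hil ·≤ d)))
            (solve (gu ∷ gv ∷ au ∷ av ∷ i ∷ u ∷ v ∷ l ∷ m ∷ []) ℚR)
        f1 : ∀ gv m l → gv + (ι 2 * m * l * 1ℚ - ι 42 * 1ℚ) ≡ gv + (ι 2 * m * l - ι 42)
        f1 = solve-∀ ℚR
        fin : ∀ gu gv au av i u v l m → au * i - av * i ≤ gu - gv → - (ι 20 * u) ≤ au - ι 2 * (u * l) →
            av ≤ ι 2 * (v * l) + ι 20 * v → 0ℚ ≤ i → u * i ≡ 1ℚ → 0ℚ ≤ l → m * u ≤ u + 1ℚ - v → v ≤ u →
            l ≤ u → gv + (ι 2 * m * l - ι 42) ≤ gu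
        fin gu gv au av i u v l m a b c hi ei hl d e f = subst (_≤ gu)
            (trans (cong (λ w → gv + (ι 2 * m * l * w - ι 42 * w)) ei) (f1 gv m l))
            (f0 gu gv au av i u v l m a b c hi (*≥0 hi hl) d e f)

  ℓ-grid : ∀ N j → ℓ (grid N j) ≡ ι j * ℓ (K N) + ℓ (suc (4 *ⁿ N))
  ℓ-grid N zero = trans (cong ℓ (ℕP.*-identityˡ (suc (4 *ⁿ N)))) (r (ℓ (K N)) (ℓ (suc (4 *ⁿ N))))
    where
    r : ∀ k l → l ≡ 0ℚ * k + l
    r = solve-∀ ℚR
  ℓ-grid N (suc j) = trans (cong ℓ (sym (grid-suc N j))) (trans (ℓ-* (K≥1 N) (grid-≥1 N j))
      (trans (cong (ℓ (K N) +_) (ℓ-grid N j)) (r (ι j) (ℓ (K N)) (ℓ (suc (4 *ⁿ N))))))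
    where
    r : ∀ j k l → k + (j * k + l) ≡ (1ℚ + j) * k + l
    r = solve-∀ ℚR

  -- Blocks at successive scales occupy disjoint ranges of `n`, so their masses add up; the varying
  -- `ℓ u` are all bounded below by the value at the largest scale.
  chain : ∀ {N x J} → 1 ≤ⁿ N → grid N J ≤ⁿ x → x <ⁿ X → ∀ j → j ≤ⁿ J →
    goodSum N x (x ÷ suc (grid N j)) + ι j * (ι 2 * inv (10 *ⁿ N) * ℓ (x ÷ grid N J) - ι 42) ≤ goodSum N x
        (x ÷ suc (grid N 0))
  chain {N} {x} {J} hN hJ hX zero _ = ≤-reflexive (r (goodSum N x (x ÷ suc (grid N 0)))
      (ι 2 * inv (10 *ⁿ N) * ℓ (x ÷ grid N J) - ι 42))
    where
    r : ∀ g w → g + 0ℚ * w ≡ g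
    r = solve-∀ ℚR
  chain {N} {x} {J} hN hJ hX (suc j) h = go (block {N} {grid N j} {x} hN (grid-≥ N j) Ky≤x hX)
    where
    Ky≤x : K N *ⁿ grid N j ≤ⁿ x
    Ky≤x = subst (_≤ⁿ x) (sym (grid-suc N j)) (ℕP.≤-trans (grid-mono N h) hJ)
    r : ∀ g′ g g₀ j m l lu → g′ + (ι 2 * m * lu - ι 42) ≤ g → g + j * (ι 2 * m * l - ι 42) ≤ g₀ → 0ℚ ≤ m →
        l ≤ lu → g′ + (1ℚ + j) * (ι 2 * m * l - ι 42) ≤ g₀
    r g′ g g₀ j m l lu a b c d = lin (a +≤ b +≤ (ι≥0 2 ·≤ (c ·≤ d)))
        (solve (g′ ∷ g ∷ g₀ ∷ j ∷ m ∷ l ∷ lu ∷ []) ℚR)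
    go : (∃ λ u → (x ÷ (K N *ⁿ grid N j) ≤ⁿ u) × (u ≤ⁿ x) × (goodSum N x (x ÷ suc (K N *ⁿ grid N j)) +
        (ι 2 * inv (10 *ⁿ N) * ℓ u - ι 42) ≤ goodSum N x (x ÷ suc (grid N j)))) → _
    go (u , xu , ux , blk) = r (goodSum N x (x ÷ suc (grid N (suc j)))) (goodSum N x (x ÷ suc (grid N j)))
        (goodSum N x (x ÷ suc (grid N 0))) (ι j) (inv (10 *ⁿ N)) (ℓ (x ÷ grid N J)) (ℓ u)
        (subst (λ z → goodSum N x (x ÷ suc z) + (ι 2 * inv (10 *ⁿ N) * ℓ u - ι 42) ≤ goodSum N x
            (x ÷ suc (grid N j))) (grid-suc N j) blk)
        (chain hN hJ hX j (ℕP.<⇒≤ h)) (inv≥0 (10 *ⁿ N))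
        (ℓ-mono (÷-≥1 (grid-≥1 N J) hJ) (ℕP.≤-trans (÷-anti x (grid-≥1 N (suc j)) (grid-mono N h))
            (subst (λ z → x ÷ z ≤ⁿ u) (grid-suc N j) xu)) (ℕP.≤-trans ux (ℕP.<⇒≤ hX)))

  -- `J` is a scale with square at most `x` whose successor has square beyond `x`. The first
  -- property keeps `ℓ (x ÷ grid N J)` at least `ℓ(x) / 2 - 1`, so each scale is worth
  -- `ℓ(x) / (2 * 10 N)`; the second gives `J ≥ ℓ(x) / (4 K)`, with `ℓ K ≤ K` used crudely. The two
  -- lower bounds on `ℓ x` absorb the additive constants.
  saving : ∀ {N x} → 1 ≤ⁿ N → K N *ⁿ K N ≤ⁿ x → suc (4 *ⁿ N) *ⁿ suc (4 *ⁿ N) ≤ⁿ x → x <ⁿ X →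
    ι (4 *ⁿ K N +ⁿ 4 *ⁿ suc (4 *ⁿ N) +ⁿ 2) ≤ ℓ x → ι (88 *ⁿ (10 *ⁿ N)) ≤ ℓ x →
        ℓ x * ℓ x ≤ ι (8 *ⁿ K N *ⁿ (10 *ⁿ N)) * goodSum N x x
  saving {N} {x} hN hK hy hX hL₁ hL₂ = go (transition (λ j → grid N j *ⁿ grid N j ℕP.≤? x) p₀ (suc x)
      (λ p → ℕP.<⇒≱ (ℕP.≤-trans (x<grid (suc x)) (ℕP.m≤m*n (grid N (suc x))
      (grid N (suc x)) {{>-nonZero (grid-≥1 N (suc x))}})) (ℕP.≤-trans p (ℕP.n≤1+n x))))
    where
    K≥2 : 2 ≤ⁿ K N
    K≥2 = ℕP.*-monoʳ-≤ 2 {1} {K₀ N *ⁿ K₀ N} (ℕP.*-mono-≤ (K₀≥1 N) (K₀≥1 N))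
    x<grid : ∀ j → j <ⁿ grid N j
    x<grid j = ℕP.≤-trans (k<p^k j K≥2) (ℕP.m≤m*n (K N ^ⁿ j) (suc (4 *ⁿ N)))
    p₀ : grid N 0 *ⁿ grid N 0 ≤ⁿ x
    p₀ = subst (λ z → z *ⁿ z ≤ⁿ x) (sym (ℕP.*-identityˡ (suc (4 *ⁿ N)))) hy
    M = 10 *ⁿ N
    hM : 1 ≤ⁿ M
    hM = ℕP.≤-trans hN (ℕP.m≤m+n N _)
    KX : K N ≤ⁿ X
    KX = ℕP.≤-trans (ℕP.m≤m*n (K N) (K N) {{>-nonZero (K≥1 N)}}) (ℕP.≤-trans hK (ℕP.<⇒≤ hX))
    yX : suc (4 *ⁿ N) ≤ⁿ X
    yX = ℕP.≤-trans (ℕP.m≤m*n (suc (4 *ⁿ N)) (suc (4 *ⁿ N))) (ℕP.≤-trans hy (ℕP.<⇒≤ hX))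
    go : (∃ λ J → (grid N J *ⁿ grid N J ≤ⁿ x) × ¬ (grid N (suc J) *ⁿ grid N (suc J) ≤ⁿ x)) →
        ℓ x * ℓ x ≤ ι (8 *ⁿ K N *ⁿ (10 *ⁿ N)) * goodSum N x x
    go (J , lo , ¬hi) = fin (ℓ x) (ι J) (ι (K N)) (inv M) (ι M) (goodSum N x x) (ℓ (x ÷ y)) bJ bw
        (≤-trans (r0 (goodSum N x (x ÷ suc y)) (ι J * (ι 2 * inv M * ℓ (x ÷ y) - ι 42))
        (Σ-≥0 (x ÷ suc y) (λ i _ _ → goodWeight≥0 N x i))) (≤-trans (chain hN y≤x hX J ℕP.≤-refl)
        (goodSum-mono N x (÷≤ x (suc (grid N 0))))))
        (ι≥0 J) (ι≥0 (K N)) (ι*inv hM) (ℓ≥0 x) (ι≥0 M) (inv≥0 M)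
            (trans (ι-* (8 *ⁿ K N) M) (cong (_* ι M) (ι-* 8 (K N))))
      where
      y = grid N J
      hyJ = grid-≥1 N J
      y≤x : y ≤ⁿ x
      y≤x = ℕP.≤-trans (ℕP.m≤m*n y y {{>-nonZero hyJ}}) lo
      r0 : ∀ g s → 0ℚ ≤ g → s ≤ g + s
      r0 g s p = lin p (solve (g ∷ s ∷ []) ℚR)
      yy : ℓ y + ℓ y ≤ ℓ x
      yy = subst (_≤ ℓ x) (ℓ-* hyJ hyJ) (ℓ-mono (ℕP.*-mono-≤ hyJ hyJ) lo (ℕP.<⇒≤ hX))
      bw0 : ℓ x - ι 2 ≤ ι 2 * ℓ (x ÷ y)
      bw0 = r (ℓ x) (ℓ (x ÷ y)) (ℓ y) (inv (x ÷ y)) (proj₂ (ℓ-÷-error hyJ y≤x hX)) (inv≤1 (x ÷ y)) yy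
        where
        r : ∀ lx lq ly i → lx - lq - ly ≤ i → i ≤ 1ℚ → ly + ly ≤ lx → lx - ι 2 ≤ ι 2 * lq
        r lx lq ly i a b c = lin ((ι≥0 2 ·≤ (a +≤ b)) +≤ c) (solve (lx ∷ lq ∷ ly ∷ i ∷ []) ℚR)
      88≤ : ι 88 ≤ inv M * ℓ x
      88≤ = ι-cancelˡ hM (subst₂ _≤_ (trans (ι-* 88 M) (*-comm (ι 88) (ι M))) (sym (ι*inv* (ℓ x) hM)) hL₂)
      bw : inv M * ℓ x ≤ ι 2 * (ι 2 * inv M * ℓ (x ÷ y) - ι 42)
      bw = r (inv M) (ℓ x) (ℓ (x ÷ y)) (inv≥0 M) bw0 88≤ (inv≤1 M)
        where
        r : ∀ j l q → 0ℚ ≤ j → l - ι 2 ≤ ι 2 * q → ι 88 ≤ j * l → j ≤ 1ℚ → j * l ≤ ι 2 * (ι 2 * j * q - ι 42)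
        r j l q z a b c = lin ((ι≥0 2 ·≤ (z ·≤ a)) +≤ b +≤ (ι≥0 4 ·≤ c)) (solve (j ∷ l ∷ q ∷ []) ℚR)
      KK = K N *ⁿ K N
      hKK : 1 ≤ⁿ KK
      hKK = ℕP.*-mono-≤ (K≥1 N) (K≥1 N)
      q≤yy : x ÷ KK ≤ⁿ y *ⁿ y
      q≤yy = ℕP.≮⇒≥ λ lt → ¬hi (subst (_≤ⁿ x) (trans (e (K N) y) (cong (λ z → z *ⁿ z) (grid-suc N J)))
          (÷-lub {x} {KK} (ℕP.<⇒≤ lt)))
        where
        e : ∀ k y → k *ⁿ k *ⁿ (y *ⁿ y) ≡ k *ⁿ y *ⁿ (k *ⁿ y)
        e = NS.solve-∀
      bJ : ℓ x ≤ ι 4 * (ι J * ι (K N))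
      bJ = r (ℓ x) (ℓ (x ÷ KK)) (ℓ KK) (ℓ (K N)) (inv (x ÷ KK)) (ℓ (y *ⁿ y)) (ℓ y) (ι J) (ι (K N)) (ι y₁)
          (ℓ y₁) (proj₂ (ℓ-÷-error hKK hK hX)) (inv≤1 (x ÷ KK))
          (ℓ-mono (÷-≥1 hKK hK) q≤yy (ℕP.≤-trans lo (ℕP.<⇒≤ hX))) (ℓ-* (K≥1 N) (K≥1 N)) (ℓ-* hyJ hyJ)
          (ℓ-grid N J) (ℓ-≤ (K≥1 N) KX) (ℓ-≤ z<s yX) (ι≥0 J)
            (subst (_≤ ℓ x) (trans (ι-+ (4 *ⁿ K N +ⁿ 4 *ⁿ y₁) 2)
                (cong (_+ ι 2) (trans (ι-+ (4 *ⁿ K N) (4 *ⁿ y₁)) (cong₂ _+_ (ι-* 4 (K N)) (ι-* 4 y₁))))) hL₁)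
        where
        y₁ = suc (4 *ⁿ N)
        r : ∀ lx lq lKK lK i lyy ly J k y₁ l₁ → lx - lq - lKK ≤ i → i ≤ 1ℚ → lq ≤ lyy → lKK ≡ lK + lK →
            lyy ≡ ly + ly → ly ≡ J * lK + l₁ → lK ≤ k → l₁ ≤ y₁ → 0ℚ ≤ J → ι 4 * k + ι 4 * y₁ + ι 2 ≤ lx →
            lx ≤ ι 4 * (J * k)
        r lx lq lKK lK i lyy ly J k y₁ l₁ a b c refl refl refl d e z f =
            lin ((ι≥0 2 ·≤ (a +≤ b +≤ c)) +≤ (ι≥0 4 ·≤ (d +≤ e +≤ (z ·≤ d))) +≤ f)
            (solve (lx ∷ lq ∷ lK ∷ i ∷ J ∷ k ∷ y₁ ∷ l₁ ∷ []) ℚR)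
      fin : ∀ l J k j m g q → l ≤ ι 4 * (J * k) → j * l ≤ ι 2 * (ι 2 * j * q - ι 42) →
          J * (ι 2 * j * q - ι 42) ≤ g → 0ℚ ≤ J → 0ℚ ≤ k → m * j ≡ 1ℚ → 0ℚ ≤ l → 0ℚ ≤ m → 0ℚ ≤ j →
          ι (8 *ⁿ K N *ⁿ (10 *ⁿ N)) ≡ ι 8 * k * m → l * l ≤ ι (8 *ⁿ K N *ⁿ (10 *ⁿ N)) * g
      fin l J k j m g q a b c zJ zk e zl zm zj eq = subst (λ z → l * l ≤ z * g) (sym eq)
          (subst (_≤ ι 8 * k * m * g) (trans (cong (λ z → z * (l * l)) e) (*-identityˡ (l * l)))
          (f0 l J k j m g q (*≥0 zm (*≥0 zj zl)) a (*≥0 zm (*≥0 zJ zk)) b (*≥0 zm zk) c))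
        where
        f0 : ∀ l J k j m g q → 0ℚ ≤ m * (j * l) → l ≤ ι 4 * (J * k) → 0ℚ ≤ m * (J * k) →
            j * l ≤ ι 2 * (ι 2 * j * q - ι 42) → 0ℚ ≤ m * k → J * (ι 2 * j * q - ι 42) ≤ g →
            m * j * (l * l) ≤ ι 8 * k * m * g
        f0 l J k j m g q z1 a z2 b z3 c = lin ((z1 ·≤ a) +≤ (ι≥0 4 ·≤ (z2 ·≤ b)) +≤ (ι≥0 8 ·≤ (z3 ·≤ c)))
            (solve (l ∷ J ∷ k ∷ j ∷ m ∷ g ∷ q ∷ []) ℚR)

  -- At good points the slope `α` may be replaced by `2 / N`, which by `saving` gains at least
  -- `(α - 2 / N) ℓ(x)² / C ≥ 2 ℓ(x)² / (N C)`. One half is kept. The other pays for the terms of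
  -- order `ℓ x`, with coefficients summing to `214 + 22 B`: 168 from `α * N₂` with `α ≤ 4`, 46 from
  -- `selberg`, and `22 B` from `B * ψ₂`.
  improve : ∀ {N B x} α → 1 ≤ⁿ N → ι 4 * inv N ≤ α → α ≤ ι 4 → (∀ m → m <ⁿ X → ∣ R m ∣≤ α * ι m + ι B) →
    K N *ⁿ K N ≤ⁿ x → suc (4 *ⁿ N) *ⁿ suc (4 *ⁿ N) ≤ⁿ x → x <ⁿ X →
    ι (4 *ⁿ K N +ⁿ 4 *ⁿ suc (4 *ⁿ N) +ⁿ 2) ≤ ℓ x → ι (88 *ⁿ (10 *ⁿ N)) ≤ ℓ x →
        ι (N *ⁿ C N *ⁿ (214 +ⁿ 22 *ⁿ B)) ≤ ℓ x → 1ℚ ≤ ℓ x →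
    ∣ R x ∣≤ (α - inv N * inv (C N)) * ι x
  improve {N} {B} {x} α hN α-lo α-hi hR hK hy hX hL₁ hL₂ hL₃ hL₄ = down , up
    where
    i = inv N
    c = inv (C N)
    β = α - i * c
    hx : 1 ≤ⁿ x
    hx = ℕP.≤-trans z<s hy
    U : ℕ → ℚ
    U m = (α - χ (good? N m) * (α - ι 2 * i)) * ι m + ι B
    R-i : ∀ m → R m ≡ i * (ι N * R m)
    R-i m = sym (trans (sym (*-assoc i (ι N) (R m))) (trans (cong (_* R m) (inv*ι hN)) (*-identityˡ (R m))))
    U-ok : ∀ m → m <ⁿ X → (d : Dec (Good N m)) → ∣ R m ∣≤ (α - χ d * (α - ι 2 * i)) * ι m + ι B
    U-ok m mX (yes g) = subst (∣_∣≤ (α - 1ℚ * (α - ι 2 * i)) * ι m + ι B) (sym (R-i m))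
        (abs-mono (abs-scale (inv≥0 N) g) (r α i (ι m) (ι B) (ι≥0 B)))
      where
      r : ∀ α i m b → 0ℚ ≤ b → i * (ι 2 * m) ≤ (α - 1ℚ * (α - ι 2 * i)) * m + b
      r α i m b p = lin p (solve (α ∷ i ∷ m ∷ b ∷ []) ℚR)
    U-ok m mX (no _) = subst (λ z → ∣ R m ∣≤ z * ι m + ι B) (sym (r α (α - ι 2 * i))) (hR m mX)
      where
      r : ∀ a b → a - 0ℚ * b ≡ a
      r = solve-∀ ℚR
    coef≥0 : ∀ m (d : Dec (Good N m)) → 0ℚ ≤ α - χ d * (α - ι 2 * i)
    coef≥0 m (yes _) = r α i (inv≥0 N)
      where
      r : ∀ α i → 0ℚ ≤ i → 0ℚ ≤ α - 1ℚ * (α - ι 2 * i)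
      r α i p = lin (ι≥0 2 ·≤ p) (solve (α ∷ i ∷ []) ℚR)
    coef≥0 m (no _) = r α i (inv≥0 N) α-lo
      where
      r : ∀ α i → 0ℚ ≤ i → ι 4 * i ≤ α → 0ℚ ≤ α - 0ℚ * (α - ι 2 * i)
      r α i p q = lin ((ι≥0 4 ·≤ p) +≤ q) (solve (α ∷ i ∷ []) ℚR)
    sel = selberg U hx hX (λ m _ mx → U-ok m (ℕP.≤-<-trans mx hX) (good? N m))
    g = goodSum N x x
    sum≤ : Σ x (λ n → Λ₂ n * U (x ÷ n)) ≤ α * (ι x * N₂ x) - (α - ι 2 * i) * (ι x * g) + ψ₂ x * ι B
    sum≤ = subst (Σ x (λ n → Λ₂ n * U (x ÷ n)) ≤_) split (Σ-mono x
        (λ n hn _ → Λ₂≥0 n ·≤ ((coef≥0 (x ÷ n) (good? N (x ÷ n)) ·≤ ÷-lo-ℚ x hn) +≤ ≤-refl {ι B})))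
      where
      r : ∀ l α χ t x i b → l * ((α - χ * t) * (x * i) + b) ≡ α * x * (l * i) - t * x * (l * i * χ) + l * b
      r = solve-∀ ℚR
      split : Σ x (λ n → Λ₂ n * ((α - χ (good? N (x ÷ n)) * (α - ι 2 * i)) * (ι x * inv n) + ι B)) ≡ α *
          (ι x * N₂ x) - (α - ι 2 * i) * (ι x * g) + ψ₂ x * ι B
      split = trans (Σ-cong x (λ n _ _ → r (Λ₂ n) α (χ (good? N (x ÷ n))) (α - ι 2 * i) (ι x) (inv n) (ι B)))
        (trans (Σ-+ x _ _) (cong₂ _+_ (trans (Σ-- x _ _) (cong₂ (λ a b → a - b)
            (trans (Σ-*ˡ x (α * ι x) (λ n → Λ₂ n * inv n)) (*-assoc α (ι x) (N₂ x)))
            (trans (Σ-*ˡ x ((α - ι 2 * i) * ι x) (goodWeight N x)) (*-assoc (α - ι 2 * i) (ι x) g))))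
            (Σ-*ʳ x (ι B) Λ₂)))
    g≥ : c * (ℓ x * ℓ x) ≤ g
    g≥ = ι-cancelˡ (C≥1 hN) (subst (_≤ ι (C N) * g) (sym (ι*inv* (ℓ x * ℓ x) (C≥1 hN)))
        (saving hN hK hy hX hL₁ hL₂))
    L₃ : ι 214 + ι 22 * ι B ≤ i * (c * ℓ x)
    L₃ = ι-cancelˡ hN (ι-cancelˡ (C≥1 hN) (subst₂ _≤_ e1 e2 hL₃))
      where
      ra : ∀ n c b → n * c * b ≡ c * (n * b)
      ra = solve-∀ ℚR
      e1 : ι (N *ⁿ C N *ⁿ (214 +ⁿ 22 *ⁿ B)) ≡ ι (C N) * (ι N * (ι 214 + ι 22 * ι B))
      e1 = trans (ι-* (N *ⁿ C N) (214 +ⁿ 22 *ⁿ B)) (trans (cong₂ _*_ (ι-* N (C N))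
          (trans (ι-+ 214 (22 *ⁿ B)) (cong (ι 214 +_) (ι-* 22 B)))) (ra (ι N) (ι (C N)) (ι 214 + ι 22 * ι B)))
      e2 : ℓ x ≡ ι (C N) * (ι N * (i * (c * ℓ x)))
      e2 = sym (trans (cong (ι (C N) *_) (ι*inv* (c * ℓ x) hN)) (ι*inv* (ℓ x) (C≥1 hN)))
    bound : Σ x (λ n → Λ₂ n * U (x ÷ n)) + (ι 30 * (ι x * ℓ x) + ι 16 * ι x) ≤ ℓ x * ℓ x * (β * ι x)
    bound = ≤-trans (sum≤ +≤ ≤-refl {ι 30 * (ι x * ℓ x) + ι 16 * ι x})
      (fin α i c (ι x) (ℓ x) (N₂ x) g (ψ₂ x) (ι B) (*≥0 α≥0 (ι≥0 x)) (N₂-hi hx hX)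
          (*≥0 (diff≥0 2i≤) (ι≥0 x)) g≥ (ι≥0 B) (proj₂ (ψ₂-abs hx hX))
          (*≥0 (*≥0 (ι≥0 x) c≥0) (*≥0 (ℓ≥0 x) (ℓ≥0 x))) α-lo (*≥0 (ι≥0 x) (ℓ≥0 x)) L₃ (ι≥0 x) hL₄ α-hi
          (*≥0 (ι≥0 B) (ι≥0 x)))
      where
      c≥0 = inv≥0 (C N)
      α≥0 : 0ℚ ≤ α
      α≥0 = ≤-trans (*≥0 (ι≥0 4) (inv≥0 N)) α-lo
      2i≤ : ι 2 * i ≤ α
      2i≤ = r i α (inv≥0 N) α-lo
        where
        r : ∀ i α → 0ℚ ≤ i → ι 4 * i ≤ α → ι 2 * i ≤ α
        r i α p q = lin (q +≤ (ι≥0 2 ·≤ p)) (solve (i ∷ α ∷ []) ℚR)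
      fin : ∀ α i c x l n g a b → 0ℚ ≤ α * x → n ≤ l * l + ι 22 * l + ι 20 → 0ℚ ≤ (α - ι 2 * i) * x →
          c * (l * l) ≤ g → 0ℚ ≤ b → a - ι 2 * (x * l) ≤ ι 20 * x → 0ℚ ≤ x * c * (l * l) → ι 4 * i ≤ α →
          0ℚ ≤ x * l → ι 214 + ι 22 * b ≤ i * (c * l) → 0ℚ ≤ x → 1ℚ ≤ l → α ≤ ι 4 → 0ℚ ≤ b * x →
        α * (x * n) - (α - ι 2 * i) * (x * g) + a * b + (ι 30 * (x * l) + ι 16 * x) ≤ l * l *
            ((α - i * c) * x)
      fin α i c x l n g a b z1 h1 z2 h2 zb h3 z3 h4 z4 h5 zx h6 h7 zbx =
          lin ((z1 ·≤ h1) +≤ (z2 ·≤ h2) +≤ (zb ·≤ h3) +≤ (z3 ·≤ h4) +≤ (z4 ·≤ h5) +≤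
          (+≥0 (*≥0 (ι≥0 22) z4) (*≥0 (ι≥0 20) zx) ·≤ h7) +≤ (ι≥0 96 ·≤ (zx ·≤ h6)) +≤
          (ι≥0 20 ·≤ (zbx ·≤ h6))) (solve (α ∷ i ∷ c ∷ x ∷ l ∷ n ∷ g ∷ a ∷ b ∷ []) ℚR)
    all : ∣ ℓ x * ℓ x * R x ∣≤ ℓ x * ℓ x * (β * ι x)
    all = abs-mono sel bound
    1≤ℓℓ : 1ℚ ≤ ℓ x * ℓ x
    1≤ℓℓ = subst (_≤ ℓ x * ℓ x) (*-identityˡ 1ℚ) (*-mono 0≤1 hL₄ 0≤1 hL₄)
    up : R x ≤ β * ι x
    up = cancel-≤ 1≤ℓℓ (proj₂ all)
    down : - (β * ι x) ≤ R x
    down = cancel-≤ 1≤ℓℓ (subst (_≤ ℓ x * ℓ x * R x) (r (ℓ x * ℓ x) (β * ι x)) (proj₁ all))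
      where
      r : ∀ a b → - (a * b) ≡ a * - b
      r = solve-∀ ℚR

  -- From ψ to odd primes

  -- `ℓ m` exceeds `ℓ (m ÷ M) + ℓ M` by at most 1, and `ℓ k ≤ k`; below `M` the constant alone
  -- suffices.
  sublinear : ∀ {M m} → 1 ≤ⁿ M → 1 ≤ⁿ m → m <ⁿ X → ℓ m ≤ ι m * inv M + ι (M +ⁿ 2)
  sublinear {M} {m} hM hm mX = go (M ℕP.≤? m)
    where
    r : ∀ l lq lM i q M z → l - lq - lM ≤ i → i ≤ 1ℚ → lq ≤ q → lM ≤ M → q ≤ z → l ≤ z + (M + ι 2)
    r l lq lM i q M z a b c d e = lin (a +≤ b +≤ c +≤ d +≤ e +≤ 0≤1)
        (solve (l ∷ lq ∷ lM ∷ i ∷ q ∷ M ∷ z ∷ []) ℚR)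
    go : Dec (M ≤ⁿ m) → ℓ m ≤ ι m * inv M + ι (M +ⁿ 2)
    go (yes p) = subst (λ z → ℓ m ≤ ι m * inv M + z) (sym (ι-+ M 2))
        (r (ℓ m) (ℓ (m ÷ M)) (ℓ M) (inv (m ÷ M)) (ι (m ÷ M)) (ι M) (ι m * inv M) (proj₂ (ℓ-÷-error hM p mX))
        (inv≤1 (m ÷ M)) (ℓ-≤ (÷-≥1 hM p) (ℕP.≤-trans (÷≤ m M) (ℕP.<⇒≤ mX)))
        (ℓ-≤ hM (ℕP.≤-trans p (ℕP.<⇒≤ mX))) (÷-lo-ℚ m hM))
    go (no ¬p) = ≤-trans (ℓ-≤ hm (ℕP.<⇒≤ mX)) (subst (_≤ ι m * inv M + ι (M +ⁿ 2)) (+-identityˡ (ι m))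
        (*≥0 (ι≥0 m) (inv≥0 M) +≤ ι-mono (ℕP.≤-trans (ℕP.<⇒≤ (ℕP.≰⇒> ¬p)) (ℕP.m≤m+n M 2))))

  w : ℕ → ℚ
  w k = o k * ℓ k

  -- Chebyshev's function θ without the prime 2.
  W : ℕ → ℚ
  W y = Σ y w

  w≥0 : ∀ k → 0ℚ ≤ w k
  w≥0 k = *≥0 (o≥0 k) (ℓ≥0 k)

  powers : ℕ → ℕ → ℚ
  powers p y = Σ y (λ k → χ (p ^ⁿ k ℕP.≤? y))

  ψ-powers : ∀ y → ψ y ≡ Σ y (λ p → π? p * ℓ p * powers p y)
  ψ-powers y = trans (Σ-cong y (λ d _ _ → sym (*-identityʳ (Λ d))))
      (trans (Σ-Λ y (λ _ → 1ℚ)) (Σ-cong y (λ p _ _ → trans (Σ-*ˡ y (π? p * ℓ p)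
      (λ k → Σ y (λ d → χ (p ^ⁿ k ℕP.≟ d) * 1ℚ))) (go p (prime? p)))))
    where
    inner : ∀ q → 1 ≤ⁿ q → (c : Dec (q ≤ⁿ y)) → Σ y (λ d → χ (q ℕP.≟ d) * 1ℚ) ≡ χ c
    inner q hq (yes h) = trans (Σ-single (λ d → χ (q ℕP.≟ d) * 1ℚ) hq h
        (λ i ne → cong (_* 1ℚ) (χ-no (q ℕP.≟ i) (λ e → ne (sym e))))) (cong (_* 1ℚ) (χ-yes (q ℕP.≟ q) refl))
    inner q hq (no ¬h) = trans (Σ-cong y (λ d _ dy → cong (_* 1ℚ) (χ-no (q ℕP.≟ d) (λ { refl → ¬h dy }))))
        (Σ-0 y)
    zero-both : ∀ a b c → 0ℚ * a * b ≡ 0ℚ * a * c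
    zero-both = solve-∀ ℚR
    go : ∀ p (c : Dec (Prime p)) → χ c * ℓ p * Σ y (λ k → Σ y (λ d → χ (p ^ⁿ k ℕP.≟ d) * 1ℚ)) ≡
        χ c * ℓ p * powers p y
    go p (yes pr) = cong (1ℚ * ℓ p *_) (Σ-cong y (λ k _ _ → inner (p ^ⁿ k) (1≤p^k k (prime≥1 pr))
        (p ^ⁿ k ℕP.≤? y)))
    go p (no _) = zero-both (ℓ p) (Σ y (λ k → Σ y (λ d → χ (p ^ⁿ k ℕP.≟ d) * 1ℚ))) (powers p y)

  Σχ≤ : ∀ n c → Σ n (λ k → χ (k ℕP.≤? c)) ≤ ι c
  Σχ≤ n c = go (c ℕP.≤? n)
    where
    go : Dec (c ≤ⁿ n) → Σ n (λ k → χ (k ℕP.≤? c)) ≤ ι c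
    go (yes p) = ≤-reflexive (trans (Σ-cong n (λ k _ _ → sym (*-identityʳ (χ (k ℕP.≤? c)))))
        (trans (sym (Σ-trunc (λ _ → 1ℚ) p)) (trans (Σ-const c 1ℚ) (*-identityʳ (ι c)))))
    go (no ¬p) = ≤-trans (Σ-mono n (λ k _ _ → χ≤1 (k ℕP.≤? c)))
        (≤-trans (≤-reflexive (trans (Σ-const n 1ℚ) (*-identityʳ (ι n)))) (ι-mono (ℕP.<⇒≤ (ℕP.≰⇒> ¬p))))

  powers-≤ : ∀ {p y} c → (∀ k → c <ⁿ k → ¬ (p ^ⁿ k ≤ⁿ y)) → powers p y ≤ ι c
  powers-≤ {p} {y} c h = ≤-trans (Σ-mono y (λ k _ _ → go k (k ℕP.≤? c))) (Σχ≤ y c)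
    where
    go : ∀ k (d : Dec (k ≤ⁿ c)) → χ (p ^ⁿ k ℕP.≤? y) ≤ χ d
    go k (yes _) = χ≤1 (p ^ⁿ k ℕP.≤? y)
    go k (no ¬p) = ≤-reflexive (χ-no (p ^ⁿ k ℕP.≤? y) (h k (ℕP.≰⇒> ¬p)))

  ℓ-^ : ∀ {p} c → 1 ≤ⁿ p → ℓ (p ^ⁿ c) ≡ ι c * ℓ p
  ℓ-^ {p} zero h = trans ℓ-1 (sym (*-zeroˡ (ℓ p)))
  ℓ-^ {p} (suc c) h = trans (ℓ-* h (1≤p^k c h)) (trans (cong (ℓ p +_) (ℓ-^ c h)) (r (ℓ p) (ι c)))
    where
    r : ∀ l c → l + c * l ≡ (1ℚ + c) * l
    r = solve-∀ ℚR

  ℓ-powers : ∀ {p y} → Prime p → 1 ≤ⁿ y → y ≤ⁿ X → ℓ p * powers p y ≤ ℓ y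
  ℓ-powers {p} {y} pr hy yX = go (transition (λ k → p ^ⁿ k ℕP.≤? y) hy y (ℕP.<⇒≱ (k<p^k y (prime≥2 pr))))
    where
    hp = prime≥1 pr
    go : (∃ λ c → (p ^ⁿ c ≤ⁿ y) × ¬ (p ^ⁿ suc c ≤ⁿ y)) → ℓ p * powers p y ≤ ℓ y
    go (c , lo , ¬hi) = ≤-trans (ℓ≥0 p ·≤ powers-≤ {p} {y} c
        (λ k ck le → ¬hi (ℕP.≤-trans (ℕP.^-monoʳ-≤ p {{>-nonZero hp}} ck) le)))
        (subst (_≤ ℓ y) (trans (ℓ-^ c hp) (*-comm (ι c) (ℓ p))) (ℓ-mono (1≤p^k c hp) lo yX))

  term-hi : ∀ {s y p} → 2 ≤ⁿ s → y <ⁿ suc s *ⁿ suc s → 1 ≤ⁿ y → y ≤ⁿ X → π? p * ℓ p * powers p y ≤ w p + χ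
      (p ℕP.≤? s) * ℓ y
  term-hi {s} {y} {p} hs ys hy yX = go (prime? p) (oddPrime? p) (p ℕP.≤? s)
    where
    r0 : ∀ l c → 0ℚ * l * c ≡ 0ℚ
    r0 = solve-∀ ℚR
    r1 : ∀ a l c y → 0ℚ ≤ a → l * c ≤ y → 1ℚ * l * c ≤ a + 1ℚ * y
    r1 a l c y p q = lin (p +≤ q) (solve (a ∷ l ∷ c ∷ y ∷ []) ℚR)
    r2 : ∀ l c y → l * c ≤ l * ι 1 → 1ℚ * l * c ≤ 1ℚ * l + 0ℚ * y
    r2 l c y p = lin p (solve (l ∷ c ∷ y ∷ []) ℚR)
    go : (d : Dec (Prime p)) (e : Dec ((3 ≤ⁿ p) × Prime p)) (f : Dec (p ≤ⁿ s)) → χ d * ℓ p * powers p y ≤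
        χ e * ℓ p + χ f * ℓ y
    go (no _) e f = subst (_≤ χ e * ℓ p + χ f * ℓ y) (sym (r0 (ℓ p) (powers p y)))
        (+≥0 (*≥0 (χ≥0 e) (ℓ≥0 p)) (*≥0 (χ≥0 f) (ℓ≥0 y)))
    go (yes pr) e (yes ps) = r1 (χ e * ℓ p) (ℓ p) (powers p y) (ℓ y) (*≥0 (χ≥0 e) (ℓ≥0 p)) (ℓ-powers pr hy yX)
    go (yes pr) (no ¬e) (no ¬f) = ⊥-elim (¬e (ℕP.≤-trans (s≤s hs) (ℕP.≰⇒> ¬f) , pr))
    go (yes pr) (yes _) (no ¬f) = r2 (ℓ p) (powers p y) (ℓ y) (ℓ≥0 p ·≤ powers-≤ {p} {y} 1 big)
      where
      big : ∀ k → 1 <ⁿ k → ¬ (p ^ⁿ k ≤ⁿ y)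
      big k hk le = ℕP.<⇒≱ ys (ℕP.≤-trans (ℕP.*-mono-≤ (ℕP.≰⇒> ¬f)
          (ℕP.≤-trans (ℕP.≰⇒> ¬f) (ℕP.≤-reflexive (sym (ℕP.*-identityʳ p)))))
          (ℕP.≤-trans (ℕP.^-monoʳ-≤ p {{>-nonZero (prime≥1 pr)}} hk) le))

  term-lo : ∀ {y p} → 1 ≤ⁿ p → p ≤ⁿ y → w p ≤ π? p * ℓ p * powers p y
  term-lo {y} {p} hp py = go (prime? p) (oddPrime? p)
    where
    r1 : ∀ l c → l * 1ℚ ≤ l * c → 1ℚ * l ≤ 1ℚ * l * c
    r1 l c p = lin p (solve (l ∷ c ∷ []) ℚR)
    powers≥1 : 1ℚ ≤ powers p y
    powers≥1 = subst (_≤ powers p y) (χ-yes (p ^ⁿ 1 ℕP.≤? y) (subst (_≤ⁿ y) (sym (ℕP.*-identityʳ p)) py))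
        (Σ-term {y} {1} (λ k → χ (p ^ⁿ k ℕP.≤? y)) z<s (ℕP.≤-trans hp py) (λ k → χ≥0 (p ^ⁿ k ℕP.≤? y)))
    powers≥0 : 0ℚ ≤ powers p y
    powers≥0 = ≤-trans 0≤1 powers≥1
    go : (d : Dec (Prime p)) (e : Dec ((3 ≤ⁿ p) × Prime p)) → χ e * ℓ p ≤ χ d * ℓ p * powers p y
    go d (no _) = subst (_≤ χ d * ℓ p * powers p y) (sym (*-zeroˡ (ℓ p))) (*≥0 (*≥0 (χ≥0 d) (ℓ≥0 p)) powers≥0)
    go (no ¬d) (yes (_ , pr)) = ⊥-elim (¬d pr)
    go (yes _) (yes _) = r1 (ℓ p) (powers p y) (ℓ≥0 p ·≤ powers≥1)

  W≤ψ : ∀ y → W y ≤ ψ y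
  W≤ψ y = subst (W y ≤_) (sym (ψ-powers y)) (Σ-mono y (λ p hp py → term-lo hp py))

  -- A prime above `s ≥ 2` is odd and has no higher power up to `y < (s + 1)²`. Each of the at most
  -- `s` primes up to `s`, the prime 2 included, accounts for no more than `ℓ y`.
  ψ≤W : ∀ {s y} → 2 ≤ⁿ s → y <ⁿ suc s *ⁿ suc s → 1 ≤ⁿ y → y ≤ⁿ X → ψ y ≤ W y + ι s * ℓ y
  ψ≤W {s} {y} hs ys hy yX = subst (_≤ W y + ι s * ℓ y) (sym (ψ-powers y))
      (≤-trans (Σ-mono y (λ p _ _ → term-hi {s} {y} {p} hs ys hy yX))
    (≤-trans (≤-reflexive (trans (Σ-+ y w (λ p → χ (p ℕP.≤? s) * ℓ y))
        (cong (W y +_) (Σ-*ʳ y (ℓ y) (λ p → χ (p ℕP.≤? s))))))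
        (≤-refl {W y} +≤ *-monoʳ (ℓ y) (ℓ≥0 y) (Σχ≤ y s))))

  W≤4 : ∀ {y} → y <ⁿ X → W y ≤ ι 4 * ι y
  W≤4 {y} h = ≤-trans (W≤ψ y) (ψ-≤ h)

  W-grow : ∀ {y z} → y ≤ⁿ z → W y ≤ W z
  W-grow h = Σ-grow w h (λ i _ _ → w≥0 i)

  Π : ℕ → ℚ
  Π y = Σ y o

  Π≥0 : ∀ y → 0ℚ ≤ Π y
  Π≥0 y = Σ-≥0 y (λ i _ _ → o≥0 i)

  Π-grow : ∀ {y z} → y ≤ⁿ z → Π y ≤ Π z
  Π-grow h = Σ-grow o h (λ i _ _ → o≥0 i)

  Π-hi : ∀ {M j} → 1 ≤ⁿ M → j <ⁿ X → Π j ≤ ι (z₀ M) + ι j * inv M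
  Π-hi {M} {j} hM jX = ι-cancelˡ hM (ι-cancelˡ {4} z<s (fin (ι M) (Π j) (ι z) (ι j) (inv M)
      (Σ j (λ p → χ (p ℕP.≤? z))) (W j) main (Σχ≤ j z) (W≤4 jX) (ι≥0 M) (ι*inv hM)))
    where
    z = z₀ M
    4M≤ : ι 4 * ι M ≤ ℓ z
    4M≤ = ι-cancelˡ {2} z<s (subst (_≤ ι 2 * ℓ z) (trans (ι-* 8 M) (r (ι M))) (ℓ-2^ (8 *ⁿ M)))
      where
      r : ∀ m → ι 8 * m ≡ ι 2 * (ι 4 * m)
      r = solve-∀ ℚR
    r1 : ∀ m c l → 0ℚ ≤ c * m → m * 0ℚ ≤ c * m + 0ℚ * l
    r1 m c l p = lin p (solve (m ∷ c ∷ l ∷ []) ℚR)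
    r2 : ∀ m l → 0ℚ ≤ l → m * 1ℚ ≤ 1ℚ * m + 1ℚ * l
    r2 m l p = lin p (solve (m ∷ l ∷ []) ℚR)
    r3 : ∀ m l → m ≤ l → m * 1ℚ ≤ 0ℚ * m + 1ℚ * l
    r3 m l p = lin p (solve (m ∷ l ∷ []) ℚR)
    term : ∀ p → p ≤ⁿ j → (d : Dec ((3 ≤ⁿ p) × Prime p)) (e : Dec (p ≤ⁿ z)) → ι 4 * ι M * χ d ≤ χ e *
        (ι 4 * ι M) + χ d * ℓ p
    term p pj (no _) e = r1 (ι 4 * ι M) (χ e) (ℓ p) (*≥0 (χ≥0 e) (*≥0 (ι≥0 4) (ι≥0 M)))
    term p pj (yes _) (yes _) = r2 (ι 4 * ι M) (ℓ p) (ℓ≥0 p)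
    term p pj (yes _) (no ¬e) = r3 (ι 4 * ι M) (ℓ p) (≤-trans 4M≤
        (ℓ-mono (1≤p^k (8 *ⁿ M) z<s) (ℕP.<⇒≤ (ℕP.≰⇒> ¬e)) (ℕP.≤-trans pj (ℕP.<⇒≤ jX))))
    main : ι 4 * ι M * Π j ≤ Σ j (λ p → χ (p ℕP.≤? z)) * (ι 4 * ι M) + W j
    main = subst₂ _≤_ (Σ-*ˡ j (ι 4 * ι M) o) (trans (Σ-+ j (λ p → χ (p ℕP.≤? z) * (ι 4 * ι M)) w)
        (cong (_+ W j) (Σ-*ʳ j (ι 4 * ι M) (λ p → χ (p ℕP.≤? z)))))
        (Σ-mono j (λ p _ pj → term p pj (oddPrime? p) (p ℕP.≤? z)))
    f0 : ∀ m q z j c W → ι 4 * m * q ≤ c * (ι 4 * m) + W → c ≤ z → W ≤ ι 4 * j → 0ℚ ≤ m →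
        ι 4 * (m * q) ≤ ι 4 * (m * z + j * 1ℚ)
    f0 m q z j c W a b d e = lin (a +≤ (*≥0 (ι≥0 4) e ·≤ b) +≤ d) (solve (m ∷ q ∷ z ∷ j ∷ c ∷ W ∷ []) ℚR)
    rr : ∀ m z j i → ι 4 * (m * z + j * (m * i)) ≡ ι 4 * (m * (z + j * i))
    rr = solve-∀ ℚR
    fin : ∀ m q z j i c W → ι 4 * m * q ≤ c * (ι 4 * m) + W → c ≤ z → W ≤ ι 4 * j → 0ℚ ≤ m → m * i ≡ 1ℚ →
        ι 4 * (m * q) ≤ ι 4 * (m * (z + j * i))
    fin m q z j i c W a b d e ei = subst (ι 4 * (m * q) ≤_) (trans
        (cong (λ u → ι 4 * (m * z + j * u)) (sym ei)) (rr m z j i)) (f0 m q z j c W a b d e)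

  -- The loss when every weight `ℓ p` is replaced by `ℓ n`, that is `ℓ n * Π n - W n` (see `LΠ`).
  -- From `m` to `m + 1` it grows by at most `Π m / m`, which `Π-hi` bounds by `z₀ M / m + 1 / M`.
  logDefect : ℕ → ℚ
  logDefect n = Σ n (λ p → o p * (ℓ n - ℓ p))

  logDefect-shift : ∀ n l l′ → Σ n (λ p → o p * (l′ - ℓ p)) ≡ Σ n (λ p → o p * (l - ℓ p)) + Π n * (l′ - l)
  logDefect-shift n l l′ = trans (Σ-cong n (λ i _ _ → r (o i) l l′ (ℓ i)))
      (trans (Σ-+ n (λ i → o i * (l - ℓ i)) (λ i → o i * (l′ - l)))
      (cong (Σ n (λ i → o i * (l - ℓ i)) +_) (Σ-*ʳ n (l′ - l) o)))
    where
    r : ∀ a l l′ b → a * (l′ - b) ≡ a * (l - b) + a * (l′ - l)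
    r = solve-∀ ℚR

  logDefect-hi : ∀ {M} n → 1 ≤ⁿ M → suc n <ⁿ X → logDefect (suc n) ≤ ι n * inv M + ι (z₀ M) * H n
  logDefect-hi {M} zero hM _ = r (o 1) (ℓ 1) (inv M) (ι (z₀ M))
    where
    r : ∀ a l i z → 0ℚ + a * (l - l) ≤ 0ℚ * i + z * 0ℚ
    r a l i z = ≤-reflexive (solve (a ∷ l ∷ i ∷ z ∷ []) ℚR)
  logDefect-hi {M} (suc n) hM h = fin (Σ m (λ p → o p * (ℓ (suc m) - ℓ p))) (logDefect m) (Π m) (ℓ m)
      (ℓ (suc m)) (inv m) (o (suc m)) (ι n) (inv M) (ι (z₀ M)) (H n) (logDefect-shift m (ℓ m) (ℓ (suc m)))
      (logDefect-hi n hM (ℕP.<-trans (ℕP.n<1+n m) h)) (*≥0 (Π≥0 m) (diff≥0 (ℓ-hi {m} z<s (ℕP.<⇒≤ h))))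
      (*-monoʳ (inv m) (inv≥0 m) (Π-hi {M} {m} hM (ℕP.<-trans (ℕP.n<1+n m) h))) (ι*inv {m} z<s)
    where
    m = suc n
    f0 : ∀ d q l l′ im a n i z h → d ≤ n * i + z * h → 0ℚ ≤ q * (l + im - l′) →
        q * im ≤ (z + (1ℚ + n) * i) * im → d + q * (l′ - l) + a * (l′ - l′) ≤ n * i + z * h + z * im + i *
        ((1ℚ + n) * im)
    f0 d q l l′ im a n i z h p s t = lin (p +≤ s +≤ t) (solve (d ∷ q ∷ l ∷ l′ ∷ im ∷ a ∷ n ∷ i ∷ z ∷ h ∷ [])
        ℚR)
    rr : ∀ n i z h im → n * i + z * h + z * im + i * 1ℚ ≡ (1ℚ + n) * i + z * (h + im)
    rr = solve-∀ ℚR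
    fin : ∀ s d q l l′ im a n i z h → s ≡ d + q * (l′ - l) → d ≤ n * i + z * h → 0ℚ ≤ q * (l + im - l′) →
        q * im ≤ (z + (1ℚ + n) * i) * im → (1ℚ + n) * im ≡ 1ℚ → s + a * (l′ - l′) ≤ (1ℚ + n) * i + z *
        (h + im)
    fin s d q l l′ im a n i z h refl p b c e = subst (d + q * (l′ - l) + a * (l′ - l′) ≤_)
        (trans (cong (λ u → n * i + z * h + z * im + i * u) e) (rr n i z h im))
        (f0 d q l l′ im a n i z h p b c)

  -- `sublinear` bounds `H n` at precision `M * z₀ M`, so that multiplication by `z₀ M` leaves
  -- `n / M`; the remainder is `C₂ M`.
  logDefect-end : ∀ {M x} → 1 ≤ⁿ M → 1 ≤ⁿ x → x <ⁿ X → logDefect x ≤ ι 2 * (ι x * inv M) + ι (C₂ M)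
  logDefect-end {M} {suc n} hM _ h = ≤-trans (logDefect-hi n hM h)
      (fin (ι n) (inv M) (ι z) (H n) (inv (M *ⁿ z)) (ι (M *ⁿ z +ⁿ 3)) (ι (C₂ M)) (inv≥0 M) Hn (ι≥0 z)
      (trans (cong (λ j → ι z * inv j) (ℕP.*-comm M z)) (ι*inv-* hz hM)) (ι-* z (M *ⁿ z +ⁿ 3)))
    where
    z = z₀ M
    hz : 1 ≤ⁿ z
    hz = 1≤p^k (8 *ⁿ M) z<s
    hMz : 1 ≤ⁿ M *ⁿ z
    hMz = ℕP.*-mono-≤ hM hz
    Hn : H n ≤ ι n * inv (M *ⁿ z) + ι (M *ⁿ z +ⁿ 3)
    Hn = go n h
      where
      r : ∀ h l a k → h ≤ l + 1ℚ → l ≤ a + (k + ι 2) → h ≤ a + (k + ι 3)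
      r h l a k p q = lin (p +≤ q) (solve (h ∷ l ∷ a ∷ k ∷ []) ℚR)
      go : ∀ n → suc n <ⁿ X → H n ≤ ι n * inv (M *ⁿ z) + ι (M *ⁿ z +ⁿ 3)
      go zero _ = +≥0 (*≥0 (ι≥0 0) (inv≥0 (M *ⁿ z))) (ι≥0 (M *ⁿ z +ⁿ 3))
      go (suc n) h = subst (λ u → H (suc n) ≤ ι (suc n) * inv (M *ⁿ z) + u) (sym (ι-+ (M *ⁿ z) 3))
          (r (H (suc n)) (ℓ (suc n)) (ι (suc n) * inv (M *ⁿ z)) (ι (M *ⁿ z)) (H≤ℓ+1 z<s (ℕP.<⇒≤ n<X))
          (subst (λ u → ℓ (suc n) ≤ ι (suc n) * inv (M *ⁿ z) + u) (ι-+ (M *ⁿ z) 2) (sublinear hMz z<s n<X)))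
        where
        n<X : suc n <ⁿ X
        n<X = ℕP.<-trans (ℕP.n<1+n (suc n)) h
    f0 : ∀ n i z h j k → 0ℚ ≤ i → h ≤ n * j + k → 0ℚ ≤ z → n * i + z * h ≤ n * i + n * (z * j) + z * k +
        ι 2 * i
    f0 n i z h j k p q s = lin ((s ·≤ q) +≤ (ι≥0 2 ·≤ p)) (solve (n ∷ i ∷ z ∷ h ∷ j ∷ k ∷ []) ℚR)
    rr : ∀ n i c → n * i + n * i + c + ι 2 * i ≡ ι 2 * ((1ℚ + n) * i) + c
    rr = solve-∀ ℚR
    fin : ∀ n i z h j k c → 0ℚ ≤ i → h ≤ n * j + k → 0ℚ ≤ z → z * j ≡ i → c ≡ z * k →
        n * i + z * h ≤ ι 2 * ((1ℚ + n) * i) + c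
    fin n i z h j k c p q s refl refl = subst (n * (z * j) + z * h ≤_) (rr n (z * j) (z * k))
        (f0 n (z * j) z h j k p q s)

  LΠ : ∀ x → ℓ x * Π x ≡ W x + logDefect x
  LΠ x = sym (trans (sym (Σ-+ x w (λ p → o p * (ℓ x - ℓ p))))
      (trans (Σ-cong x (λ p _ _ → r (o p) (ℓ p) (ℓ x))) (Σ-*ˡ x (ℓ x) o)))
    where
    r : ∀ a l L → a * l + a * (L - l) ≡ L * a
    r = solve-∀ ℚR

  -- `ℓ x ≤ 2 ℓ (s + 1)`, which `sublinear` bounds by `2 (s + 1) / M + c` with `c = 2 (M + 2)`. The
  -- product `s c` is at most `x / M` once `s ≥ M c`, and at most `M c c = C₁ M` before.
  sqrt-ℓ : ∀ {M x s} → 1 ≤ⁿ M → 1 ≤ⁿ s → 1 ≤ⁿ x → s *ⁿ s ≤ⁿ x → x <ⁿ suc s *ⁿ suc s → suc s *ⁿ suc s <ⁿ X →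
      ι s * ℓ x ≤ ι 5 * (ι x * inv M) + ι (C₁ M)
  sqrt-ℓ {M} {x} {s} hM hs hx lo hi hX = fin (ι s) (ι x) (inv M) (ℓ x) (ℓ (suc s)) (ι c) (ι (M +ⁿ 2))
      (ι (C₁ M)) ℓx (sublinear hM z<s (ℕP.≤-<-trans (ℕP.m≤m*n (suc s) (suc s)) hX))
      (subst (_≤ ι x) (ι-* s s) (ι-mono lo)) (ι-mono hs) (ι≥0 s) (inv≥0 M) (ι-* 2 (M +ⁿ 2))
      (sc (M *ⁿ c ℕP.≤? s))
    where
    c = 2 *ⁿ (M +ⁿ 2)
    ℓx : ℓ x ≤ ℓ (suc s) + ℓ (suc s)
    ℓx = subst (ℓ x ≤_) (ℓ-* {suc s} {suc s} z<s z<s) (ℓ-mono hx (ℕP.<⇒≤ hi) (ℕP.<⇒≤ hX))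
    sc : Dec (M *ⁿ c ≤ⁿ s) → ι s * ι c ≤ ι x * inv M + ι (C₁ M)
    sc (yes p) = subst (_≤ ι x * inv M + ι (C₁ M)) (+-identityʳ (ι s * ι c))
        (ι-cancelˡ hM (subst₂ _≤_ e1 e2 (ι-mono (ℕP.≤-trans (ℕP.*-monoˡ-≤ s p) lo))) +≤ ι≥0 (C₁ M))
      where
      e1 : ι (M *ⁿ c *ⁿ s) ≡ ι M * (ι s * ι c)
      e1 = trans (cong ι (e M c s)) (trans (ι-* M (s *ⁿ c)) (cong (ι M *_) (ι-* s c)))
        where
        e : ∀ M c s → M *ⁿ c *ⁿ s ≡ M *ⁿ (s *ⁿ c)
        e = NS.solve-∀
      e2 : ι x ≡ ι M * (ι x * inv M)
      e2 = sym (trans (cong (ι M *_) (*-comm (ι x) (inv M))) (ι*inv* (ι x) hM))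
    sc (no ¬p) = ≤-trans (subst (_≤ ι (C₁ M)) (ι-* s c) (ι-mono (ℕP.*-monoˡ-≤ c (ℕP.<⇒≤ (ℕP.≰⇒> ¬p)))))
        (r (ι x * inv M) (ι (C₁ M)) (*≥0 (ι≥0 x) (inv≥0 M)))
      where
      r : ∀ a b → 0ℚ ≤ a → b ≤ a + b
      r a b p = lin p (solve (a ∷ b ∷ []) ℚR)
    f0 : ∀ s x i l l′ m2 k → l ≤ l′ + l′ → l′ ≤ (1ℚ + s) * i + m2 → s * s ≤ x → 1ℚ ≤ s → 0ℚ ≤ s → 0ℚ ≤ i →
        s * (ι 2 * m2) ≤ x * i + k → s * l ≤ ι 5 * (x * i) + k
    f0 s x i l l′ m2 k a b c d e f g = lin ((e ·≤ (a +≤ b +≤ b)) +≤ (*≥0 (ι≥0 4) f ·≤ c) +≤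
        (*≥0 (ι≥0 2) (*≥0 e f) ·≤ d) +≤ g) (solve (s ∷ x ∷ i ∷ l ∷ l′ ∷ m2 ∷ k ∷ []) ℚR)
    fin : ∀ s x i l l′ c m2 k → l ≤ l′ + l′ → l′ ≤ (1ℚ + s) * i + m2 → s * s ≤ x → 1ℚ ≤ s → 0ℚ ≤ s → 0ℚ ≤ i →
        c ≡ ι 2 * m2 → s * c ≤ x * i + k → s * l ≤ ι 5 * (x * i) + k
    fin s x i l l′ c m2 k a b d e f g refl h = f0 s x i l l′ m2 k a b d e f g h

  -- Pairs of odd primes

  -- The 9 is 4 from the hypothesis plus 5 from `sqrt-ℓ`. The root `s` is that of `x`, which makes
  -- the bound uniform in `y ≤ x`.
  W-abs : ∀ {M B x s} → 1 ≤ⁿ M → (∀ m → m <ⁿ X → ∣ R m ∣≤ ι 4 * inv M * ι m + ι B) → 2 ≤ⁿ s → s *ⁿ s ≤ⁿ x →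
      x <ⁿ suc s *ⁿ suc s → suc s *ⁿ suc s <ⁿ X →
    ∀ y → y ≤ⁿ x → ∣ W y - ι y ∣≤ ι 9 * (ι x * inv M) + (ι B + ι (C₁ M))
  W-abs {M} {B} {x} {s} hM hR hs lo hi hX zero _ = abs-nonneg ≤-refl
      (+≥0 (*≥0 (ι≥0 9) (*≥0 (ι≥0 x) (inv≥0 M))) (+≥0 (ι≥0 B) (ι≥0 (C₁ M))))
  W-abs {M} {B} {x} {s} hM hR hs lo hi hX y@(suc _) yx = subst (∣_∣≤ ι 9 * (ι x * inv M) + (ι B + ι (C₁ M)))
      (sym (e (W y) (ψ y) (ι y)))
      (abs-mono (abs-- (hR y yX) (abs-nonneg (diff≥0 (W≤ψ y))
          (gap (ψ y) (W y) (ι s * ℓ y) (ψ≤W hs (ℕP.≤-<-trans yx hi) z<s (ℕP.<⇒≤ yX)))))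
          (fin (ι s * ℓ y) (ι s * ℓ x) (ι x * inv M) (ι B) (ι (C₁ M)) (ι 4 * inv M * ι y)
          (ι≥0 s ·≤ ℓ-mono z<s yx (ℕP.<⇒≤ xX)) (sqrt-ℓ hM (ℕP.≤-trans z<s hs) (ℕP.≤-trans z<s yx) lo hi hX)
          four))
    where
    xX : x <ⁿ X
    xX = ℕP.<-trans hi hX
    yX : y <ⁿ X
    yX = ℕP.≤-<-trans yx xX
    e : ∀ w p y → w - y ≡ p - y - (p - w)
    e = solve-∀ ℚR
    gap : ∀ p w z → p ≤ w + z → p - w ≤ z
    gap p w z h = lin h (solve (p ∷ w ∷ z ∷ []) ℚR)
    four : ι 4 * inv M * ι y ≤ ι 4 * (ι x * inv M)
    four = ≤-trans (*≥0 (ι≥0 4) (inv≥0 M) ·≤ ι-mono yx) (≤-reflexive (r (inv M) (ι x)))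
      where
      r : ∀ i x → ι 4 * i * x ≡ ι 4 * (x * i)
      r = solve-∀ ℚR
    fin : ∀ a a′ r b c d → a ≤ a′ → a′ ≤ ι 5 * r + c → d ≤ ι 4 * r → d + b + a ≤ ι 9 * r + (b + c)
    fin a a′ r b c d p q s = lin (p +≤ q +≤ s) (solve (a ∷ a′ ∷ r ∷ b ∷ c ∷ d ∷ []) ℚR)

  module _ {x : ℕ} (hx : 1 ≤ⁿ x) (xX : x <ⁿ X) where

    private
      L = ℓ x

    ℓ≤L : ∀ p → 1 ≤ⁿ p → p ≤ⁿ x → 0ℚ ≤ L - ℓ p
    ℓ≤L p hp h = diff≥0 (ℓ-mono hp h (ℕP.<⇒≤ xX))

    gap-Σ : ∀ y → L * Π y - W y ≡ Σ y (λ q → o q * (L - ℓ q))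
    gap-Σ y = sym (trans (Σ-cong y (λ q _ _ → r (o q) L (ℓ q)))
        (trans (Σ-- y (λ q → L * o q) w) (cong (_- W y) (Σ-*ˡ y L o))))
      where
      r : ∀ a L l → a * (L - l) ≡ L * a - a * l
      r = solve-∀ ℚR

    gap≥0 : ∀ y → y ≤ⁿ x → 0ℚ ≤ L * Π y - W y
    gap≥0 y yx = subst (0ℚ ≤_) (sym (gap-Σ y)) (Σ-≥0 y (λ q hq qy →
        *≥0 (o≥0 q) (ℓ≤L q hq (ℕP.≤-trans qy yx))))

    gap≤ : ∀ y → y ≤ⁿ x → L * Π y - W y ≤ logDefect x
    gap≤ y yx = subst (_≤ logDefect x) (sym (gap-Σ y)) (Σ-grow (λ q → o q * (L - ℓ q)) yx
        (λ q yq qx → *≥0 (o≥0 q) (ℓ≤L q (ℕP.≤-trans z<s yq) qx)))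

    LΠ≤ : ∀ y → y ≤ⁿ x → L * Π y ≤ L * Π x
    LΠ≤ y yx = ℓ≥0 x ·≤ Π-grow yx

    LΠ≥0 : ∀ y → 0ℚ ≤ L * Π y
    LΠ≥0 y = *≥0 (ℓ≥0 x) (Π≥0 y)

    logDefect≥0 : 0ℚ ≤ logDefect x
    logDefect≥0 = ≤-trans (gap≥0 0 z≤n) (gap≤ 0 z≤n)

    -- `L² - ℓ p ℓ q = (L - ℓ p) L + ℓ p (L - ℓ q)`; both terms are nonnegative, and each sums to at
    -- most `logDefect x * (L * Π x)`.
    pairSum-compare : ∀ y → y ≤ⁿ x → (pairSum w w y ≤ L * L * pairSum o o y) ×
        (L * L * pairSum o o y ≤ pairSum w w y + ι 2 * (logDefect x * (L * Π x)))
    pairSum-compare y yx = subst (pairSum w w y ≤_) scale (Σ-mono y lo) , subst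
        (_≤ pairSum w w y + ι 2 * (logDefect x * (L * Π x))) scale (≤-trans (Σ-mono y hi) total)
      where
      scale : Σ y (λ p → L * L * (o p * Π (y ∸ⁿ p))) ≡ L * L * pairSum o o y
      scale = Σ-*ˡ y (L * L) (λ p → o p * Π (y ∸ⁿ p))
      sub : ∀ p → y ∸ⁿ p ≤ⁿ x
      sub p = ℕP.≤-trans (ℕP.m∸n≤m y p) yx
      r1 : ∀ a l L q w → 0ℚ ≤ a * (L - l) * (L * q) → 0ℚ ≤ a * l * (L * q - w) → a * l * w ≤ L * L * (a * q)
      r1 a l L q w p s = lin (p +≤ s) (solve (a ∷ l ∷ L ∷ q ∷ w ∷ []) ℚR)
      lo : ∀ p → 1 ≤ⁿ p → p ≤ⁿ y → w p * W (y ∸ⁿ p) ≤ L * L * (o p * Π (y ∸ⁿ p))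
      lo p hp py = r1 (o p) (ℓ p) L (Π (y ∸ⁿ p)) (W (y ∸ⁿ p))
          (*≥0 (*≥0 (o≥0 p) (ℓ≤L p hp (ℕP.≤-trans py yx))) (LΠ≥0 (y ∸ⁿ p)))
          (*≥0 (w≥0 p) (gap≥0 (y ∸ⁿ p) (sub p)))
      r2 : ∀ a l L q w Q D → 0ℚ ≤ a * (L - l) → L * q ≤ Q → 0ℚ ≤ a * l → L * q - w ≤ D →
          0ℚ ≤ a * (L - l) * D → L * L * (a * q) ≤ a * l * w + (a * (L - l) * Q + a * (L * D))
      r2 a l L q w Q D z1 h1 z2 h2 z3 = lin ((z1 ·≤ h1) +≤ (z2 ·≤ h2) +≤ z3)
          (solve (a ∷ l ∷ L ∷ q ∷ w ∷ Q ∷ D ∷ []) ℚR)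
      hi : ∀ p → 1 ≤ⁿ p → p ≤ⁿ y → L * L * (o p * Π (y ∸ⁿ p)) ≤ w p * W (y ∸ⁿ p) +
          (o p * (L - ℓ p) * (L * Π x) + o p * (L * logDefect x))
      hi p hp py = r2 (o p) (ℓ p) L (Π (y ∸ⁿ p)) (W (y ∸ⁿ p)) (L * Π x) (logDefect x) nn
          (LΠ≤ (y ∸ⁿ p) (sub p)) (w≥0 p) (gap≤ (y ∸ⁿ p) (sub p)) (*≥0 nn logDefect≥0)
        where
        nn : 0ℚ ≤ o p * (L - ℓ p)
        nn = *≥0 (o≥0 p) (ℓ≤L p hp (ℕP.≤-trans py yx))
      r3 : ∀ s g q L D Q → g ≤ D → 0ℚ ≤ L * Q → q ≤ Q → 0ℚ ≤ L * D → s + (g * (L * Q) + q * (L * D)) ≤ s +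
          ι 2 * (D * (L * Q))
      r3 s g q L D Q h1 z1 h2 z2 = lin ((z1 ·≤ h1) +≤ (z2 ·≤ h2)) (solve (s ∷ g ∷ q ∷ L ∷ D ∷ Q ∷ []) ℚR)
      total : Σ y (λ p → w p * W (y ∸ⁿ p) + (o p * (L - ℓ p) * (L * Π x) + o p * (L * logDefect x))) ≤
          pairSum w w y + ι 2 * (logDefect x * (L * Π x))
      total = ≤-trans (≤-reflexive (trans (Σ-+ y (λ p → w p * W (y ∸ⁿ p))
          (λ p → o p * (L - ℓ p) * (L * Π x) + o p * (L * logDefect x)))
          (cong (pairSum w w y +_) (trans (Σ-+ y (λ p → o p * (L - ℓ p) * (L * Π x))
          (λ p → o p * (L * logDefect x))) (cong₂ _+_ (Σ-*ʳ y (L * Π x) (λ p → o p * (L - ℓ p)))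
          (Σ-*ʳ y (L * logDefect x) o))))))
        (r3 (pairSum w w y) (Σ y (λ p → o p * (L - ℓ p))) (Π y) L (logDefect x) (Π x)
            (subst (_≤ logDefect x) (gap-Σ y) (gap≤ y yx)) (LΠ≥0 x) (Π-grow yx) (*≥0 (ℓ≥0 x) logDefect≥0))

  Σ-pred : ∀ y → ι 2 * Σ y (λ j → ι (pred j)) ≡ ι y * ι y - ι y
  Σ-pred zero = refl
  Σ-pred (suc y) = trans (*-distribˡ-+ (ι 2) (Σ y (λ j → ι (pred j))) (ι y))
      (trans (cong (_+ ι 2 * ι y) (Σ-pred y)) (r (ι y)))
    where
    r : ∀ a → a * a - a + ι 2 * a ≡ (1ℚ + a) * (1ℚ + a) - (1ℚ + a)
    r = solve-∀ ℚR

  Σ-abel : ∀ (f : ℕ → ℚ) x → Σ x (λ p → f p * ι (x ∸ⁿ p)) ≡ Σ x (λ j → Σ (pred j) f)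
  Σ-abel f zero = refl
  Σ-abel f (suc x) = trans (cong₂ _+_ (Σ-cong x term) (trans (cong (λ z → f (suc x) * ι z) (ℕP.n∸n≡0 x))
      (*-zeroʳ (f (suc x))))) (trans (+-identityʳ _) (trans (Σ-+ x (λ p → f p * ι (x ∸ⁿ p)) f)
      (cong (_+ Σ x f) (Σ-abel f x))))
    where
    r : ∀ a b → a * (1ℚ + b) ≡ a * b + a
    r = solve-∀ ℚR
    term : ∀ p → 1 ≤ⁿ p → p ≤ⁿ x → f p * ι (suc x ∸ⁿ p) ≡ f p * ι (x ∸ⁿ p) + f p
    term p _ h = trans (cong (λ z → f p * ι z) (suc-∸ h)) (r (f p) (ι (x ∸ⁿ p)))

  -- `W (y - p)` is replaced by `y - p` at cost `δ * W y`, partial summation turns the result into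
  -- the sum of `W (j - 1)` over `j ≤ y`, and replacing these by `j - 1` costs `δ * y`. With
  -- `W y ≤ 4 x` the doubled cost is `10 δ x`.
  pairSum-w : ∀ {x δ} → x <ⁿ X → (∀ y → y ≤ⁿ x → ∣ W y - ι y ∣≤ δ) → ∀ y → y ≤ⁿ x → ∣ ι 2 * pairSum w w y -
      (ι y * ι y - ι y) ∣≤ ι 10 * (δ * ι x)
  pairSum-w {x} {δ} xX hW y yx = subst (∣_∣≤ ι 10 * (δ * ι x)) (sym e)
      (abs-mono (abs-+ (abs-scale (ι≥0 2) first-bound) (abs-scale (ι≥0 2) second))
      (fin (W y) (ι y) (ι x) δ (≤-trans (W-grow yx) (W≤4 xX)) (ι-mono yx) δ≥0))
    where
    δ≥0 : 0ℚ ≤ δ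
    δ≥0 = abs-≥0 (hW 0 z≤n)
    V₀ = Σ y (λ j → W (pred j))
    Z = Σ y (λ j → ι (pred j))
    r1 : ∀ a b c → a * b - a * c ≡ a * (b - c)
    r1 = solve-∀ ℚR
    first-bound : ∣ pairSum w w y - V₀ ∣≤ W y * δ
    first-bound = subst₂ ∣_∣≤_ (trans (Σ-cong y (λ p _ _ → sym (r1 (w p) (W (y ∸ⁿ p)) (ι (y ∸ⁿ p)))))
        (trans (Σ-- y (λ p → w p * W (y ∸ⁿ p)) (λ p → w p * ι (y ∸ⁿ p)))
        (cong (λ z → pairSum w w y - z) (Σ-abel w y)))) (Σ-*ʳ y δ w)
      (abs-Σ y (λ p _ _ → abs-scale (w≥0 p) (hW (y ∸ⁿ p) (ℕP.≤-trans (ℕP.m∸n≤m y p) yx))))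
    second : ∣ V₀ - Z ∣≤ ι y * δ
    second = subst₂ ∣_∣≤_ (Σ-- y (λ j → W (pred j)) (λ j → ι (pred j))) (Σ-const y δ)
        (abs-Σ y (λ j _ jy → hW (pred j) (ℕP.≤-trans (ℕP.pred[n]≤n) (ℕP.≤-trans jy yx))))
    r2 : ∀ p v z → ι 2 * p - ι 2 * z ≡ ι 2 * (p - v) + ι 2 * (v - z)
    r2 = solve-∀ ℚR
    e : ι 2 * pairSum w w y - (ι y * ι y - ι y) ≡ ι 2 * (pairSum w w y - V₀) + ι 2 * (V₀ - Z)
    e = trans (cong (λ z → ι 2 * pairSum w w y - z) (sym (Σ-pred y))) (r2 (pairSum w w y) V₀ Z)
    fin : ∀ w y x d → w ≤ ι 4 * x → y ≤ x → 0ℚ ≤ d → ι 2 * (w * d) + ι 2 * (y * d) ≤ ι 10 * (d * x)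
    fin w y x d a b z = lin ((*≥0 (ι≥0 2) z ·≤ a) +≤ (*≥0 (ι≥0 2) z ·≤ b)) (solve (w ∷ y ∷ x ∷ d ∷ []) ℚR)

  -- With `r = x / M` and `ℓ x * Π x ≤ 7 x`, the constant is `213 = 10 * 10 + 1 + 4 * 3 * 7 + 2 * 2
  -- * 7`: the error of `pairSum-w` for `δ ≤ 10
  -- r`, its linear term, the defect in `pairSum-compare`, and the diagonal in `pairs`.
  card-approx : ∀ {n x M δ} → x ≡ n +ⁿ n → 1 ≤ⁿ x → x <ⁿ X → (∀ y → y ≤ⁿ x → ∣ W y - ι y ∣≤ δ) →
      δ ≤ ι 10 * (ι x * inv M) → logDefect x ≤ ι 3 * (ι x * inv M) → ℓ x ≤ ι 2 * (ι x * inv M) →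
      1ℚ ≤ ι x * inv M →
    ∀ t → t ≤ⁿ n → ∣ ι 4 * (ℓ x * ℓ x * ι (card t) - ι t * ι t) ∣≤ ι 213 * (ι x * inv M * ι x)
  card-approx {n} {x} {M} {δ} refl hx xX hW hδ hD hL h1 t tn = abs-mono
      ( lo (ι t) (ι (t +ⁿ t)) (ℓ x * ℓ x) (pairSum o o (t +ⁿ t)) (pairSum w w (t +ⁿ t)) (Π t) (ι (card t))
          (ι x) (ι 10 * (δ * ι x)) (ι 4 * (logDefect x * Q) + ι 2 * (ℓ x * Q)) (ι-+ t t) (pairs t)
          (proj₁ cmp) (proj₁ ww) (*≥0 (*≥0 (ℓ≥0 x) (ℓ≥0 x)) (Π≥0 t)) (ι-mono yx) pos
      , hi (ι t) (ι (t +ⁿ t)) (ℓ x) (pairSum o o (t +ⁿ t)) (pairSum w w (t +ⁿ t)) (Π t) (ι (card t)) (ι x)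
          (ι 10 * (δ * ι x)) (logDefect x) Q (ι-+ t t) (pairs t) (proj₂ cmp) (proj₂ ww)
          (ℓ≥0 x ·≤ LΠ≤ hx xX t tx) (ι≥0 (t +ⁿ t)) (ι≥0 x))
      (fin (ι x * inv M) (ι x) δ (logDefect x) (ℓ x) (ℓ x * Π x) (W x) hδ hD hL h1 (LΠ x) (W≤4 xX) (ι≥0 x)
          (logDefect≥0 hx xX) r≤x (ℓ≥0 x) (LΠ≥0 hx xX x))
    where
    yx : t +ⁿ t ≤ⁿ n +ⁿ n
    yx = ℕP.+-mono-≤ tn tn
    tx : t ≤ⁿ n +ⁿ n
    tx = ℕP.≤-trans tn (ℕP.m≤m+n n n)
    Q = ℓ x * Π x
    cmp = pairSum-compare hx xX (t +ⁿ t) yx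
    ww = pairSum-w xX hW (t +ⁿ t) yx
    pos : 0ℚ ≤ ι 4 * (logDefect x * Q) + ι 2 * (ℓ x * Q)
    pos = +≥0 (*≥0 (ι≥0 4) (*≥0 (logDefect≥0 hx xX) (LΠ≥0 hx xX x)))
        (*≥0 (ι≥0 2) (*≥0 (ℓ≥0 x) (LΠ≥0 hx xX x)))
    r≤x : ι x * inv M ≤ ι x
    r≤x = subst (ι x * inv M ≤_) (*-identityʳ (ι x)) (ι≥0 x ·≤ inv≤1 M)
    re : ∀ L p q c t → p + q ≡ ι 2 * c → ι 4 * (L * c - t * t) ≡ ι 2 * (L * p) + ι 2 * (L * q) - (t + t) *
        (t + t)
    re L p q c t h = trans (r0 L c t) (trans (cong (λ z → ι 2 * (L * z) - (t + t) * (t + t)) (sym h))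
        (r1 L p q t))
      where
      r0 : ∀ L c t → ι 4 * (L * c - t * t) ≡ ι 2 * (L * (ι 2 * c)) - (t + t) * (t + t)
      r0 = solve-∀ ℚR
      r1 : ∀ L p q t → ι 2 * (L * (p + q)) - (t + t) * (t + t) ≡ ι 2 * (L * p) + ι 2 * (L * q) - (t + t) *
          (t + t)
      r1 = solve-∀ ℚR
    lo0 : ∀ y L p ww q x d e → ww ≤ L * p → - d ≤ ι 2 * ww - (y * y - y) → 0ℚ ≤ L * q → y ≤ x → 0ℚ ≤ e →
        - (d + x + e) ≤ ι 2 * (L * p) + ι 2 * (L * q) - y * y
    lo0 y L p ww q x d e h1 h2 h3 h4 h5 = lin ((ι≥0 2 ·≤ (h1 +≤ h3)) +≤ h2 +≤ h4 +≤ h5)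
        (solve (y ∷ L ∷ p ∷ ww ∷ q ∷ x ∷ d ∷ e ∷ []) ℚR)
    lo : ∀ t y L p ww q c x d e → y ≡ t + t → p + q ≡ ι 2 * c → ww ≤ L * p → - d ≤ ι 2 * ww - (y * y - y) →
        0ℚ ≤ L * q → y ≤ x → 0ℚ ≤ e → - (d + x + e) ≤ ι 4 * (L * c - t * t)
    lo t y L p ww q c x d e refl h h1 h2 h3 h4 h5 = subst (- (d + x + e) ≤_) (sym (re L p q c t h))
        (lo0 (t + t) L p ww q x d e h1 h2 h3 h4 h5)
    hi0 : ∀ y l p ww q x d D Q → l * l * p ≤ ww + ι 2 * (D * Q) → ι 2 * ww - (y * y - y) ≤ d →
        l * (l * q) ≤ l * Q → 0ℚ ≤ y → 0ℚ ≤ x → ι 2 * (l * l * p) + ι 2 * (l * l * q) - y * y ≤ d + x +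
        (ι 4 * (D * Q) + ι 2 * (l * Q))
    hi0 y l p ww q x d D Q h1 h2 h3 h4 h5 = lin ((ι≥0 2 ·≤ (h1 +≤ h3)) +≤ h2 +≤ h4 +≤ h5)
        (solve (y ∷ l ∷ p ∷ ww ∷ q ∷ x ∷ d ∷ D ∷ Q ∷ []) ℚR)
    hi : ∀ t y l p ww q c x d D Q → y ≡ t + t → p + q ≡ ι 2 * c → l * l * p ≤ ww + ι 2 * (D * Q) →
        ι 2 * ww - (y * y - y) ≤ d → l * (l * q) ≤ l * Q → 0ℚ ≤ y → 0ℚ ≤ x → ι 4 * (l * l * c - t * t) ≤ d +
        x + (ι 4 * (D * Q) + ι 2 * (l * Q))
    hi t y l p ww q c x d D Q refl h h1 h2 h3 h4 h5 = subst (_≤ d + x + (ι 4 * (D * Q) + ι 2 * (l * Q)))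
        (sym (re (l * l) p q c t h)) (hi0 (t + t) l p ww q x d D Q h1 h2 h3 h4 h5)
    fin : ∀ r x d D l Q W → d ≤ ι 10 * r → D ≤ ι 3 * r → l ≤ ι 2 * r → 1ℚ ≤ r → Q ≡ W + D → W ≤ ι 4 * x →
        0ℚ ≤ x → 0ℚ ≤ D → r ≤ x → 0ℚ ≤ l → 0ℚ ≤ Q → ι 10 * (d * x) + x + (ι 4 * (D * Q) + ι 2 * (l * Q)) ≤
        ι 213 * (r * x)
    fin r x d D l Q W h1 h2 h3 h4 e h5 zx zD h6 zl zQ = f1 r x d D l Q (zx ·≤ h1) (zx ·≤ h4)
        (*-mono zD h2 zQ Q≤) (*-mono zl h3 zQ Q≤)
      where
      rQ : ∀ W D x r → W ≤ ι 4 * x → D ≤ ι 3 * r → r ≤ x → W + D ≤ ι 7 * x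
      rQ W D x r a b c = lin (a +≤ b +≤ (ι≥0 3 ·≤ c)) (solve (W ∷ D ∷ x ∷ r ∷ []) ℚR)
      Q≤ : Q ≤ ι 7 * x
      Q≤ = subst (_≤ ι 7 * x) (sym e) (rQ W D x r h5 h2 h6)
      f1 : ∀ r x d D l Q → x * d ≤ x * (ι 10 * r) → x * 1ℚ ≤ x * r → D * Q ≤ ι 3 * r * (ι 7 * x) →
          l * Q ≤ ι 2 * r * (ι 7 * x) → ι 10 * (d * x) + x + (ι 4 * (D * Q) + ι 2 * (l * Q)) ≤ ι 213 * (r * x)
      f1 r x d D l Q a b c e = lin ((ι≥0 10 ·≤ a) +≤ b +≤ (ι≥0 4 ·≤ c) +≤ (ι≥0 2 ·≤ e))
          (solve (r ∷ x ∷ d ∷ D ∷ l ∷ Q ∷ []) ℚR)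

-- The prime number theorem

-- Quantifying over all logarithms makes B independent of X.
ψ-Bound : ℚ → ℕ → Set
ψ-Bound α B = ∀ {X} (S : LogSystem X) (2≤X : 2 ≤ⁿ X) m → m <ⁿ X → ∣ Estimates.R S 2≤X m ∣≤ α * ι m + ι B

ψ-Bound-mono : ∀ {α β B} → α ≤ β → ψ-Bound α B → ψ-Bound β B
ψ-Bound-mono {α} {β} {B} h p S 2≤X m mX = abs-mono (p S 2≤X m mX) (*-monoʳ (ι m) (ι≥0 m) h +≤ ≤-refl {ι B})

η : ℕ → ℚ
η N = inv N * inv (C N)

-- Below `x₁` the trivial bound `4 m` is absorbed into the new constant `4 x₁`. From `x₁` on,
-- `m ≥ 2 ^ (2 L)` gives `ℓ m ≥ L`, which covers all thresholds of `improve` for every logarithm at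
-- once.
improve-bound : ∀ {N B} α → 1 ≤ⁿ N → ι 4 * inv N ≤ α → α ≤ ι 4 → ψ-Bound α B → ∃ λ B′ → ψ-Bound (α - η N) B′
improve-bound {N} {B} α hN α-lo α-hi hP = 4 *ⁿ x₁ , λ S 2≤X m mX → go S 2≤X m mX (x₁ ℕP.≤? m)
  where
  a₁ = 4 *ⁿ K N +ⁿ 4 *ⁿ suc (4 *ⁿ N) +ⁿ 2
  a₂ = 88 *ⁿ (10 *ⁿ N)
  a₃ = N *ⁿ C N *ⁿ (214 +ⁿ 22 *ⁿ B)
  L = a₁ +ⁿ a₂ +ⁿ a₃ +ⁿ 1
  x₁ = 2 ^ⁿ (2 *ⁿ L) +ⁿ K N *ⁿ K N +ⁿ suc (4 *ⁿ N) *ⁿ suc (4 *ⁿ N)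
  β≥0 : 0ℚ ≤ α - η N
  β≥0 = r α (inv N) (inv (C N)) α-lo (inv≥0 N) (inv≤1 (C N))
    where
    r : ∀ a i c → ι 4 * i ≤ a → 0ℚ ≤ i → c ≤ 1ℚ → 0ℚ ≤ a - i * c
    r a i c p q s = lin (p +≤ (ι≥0 3 ·≤ q) +≤ (q ·≤ s)) (solve (a ∷ i ∷ c ∷ []) ℚR)
  go : ∀ {X} (S : LogSystem X) (2≤X : 2 ≤ⁿ X) m → m <ⁿ X → Dec (x₁ ≤ⁿ m) → ∣ Estimates.R S 2≤X m ∣≤
      (α - η N) * ι m + ι (4 *ⁿ x₁)
  go S 2≤X m mX (no ¬p) = abs-mono (Estimates.R-abs S 2≤X mX)
      (≤-trans (subst (_≤ ι (4 *ⁿ x₁)) (ι-* 4 m) (ι-mono (ℕP.*-monoʳ-≤ 4 (ℕP.<⇒≤ (ℕP.≰⇒> ¬p)))))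
      (subst (_≤ (α - η N) * ι m + ι (4 *ⁿ x₁)) (+-identityˡ (ι (4 *ⁿ x₁)))
      (*≥0 β≥0 (ι≥0 m) +≤ ≤-refl {ι (4 *ⁿ x₁)})))
  go {X} S 2≤X m mX (yes p) = abs-mono (Estimates.improve S 2≤X {N} {B} {m} α hN α-lo α-hi (hP S 2≤X)
      (ℕP.≤-trans (ℕP.≤-trans (ℕP.m≤n+m (K N *ⁿ K N) (2 ^ⁿ (2 *ⁿ L)))
      (ℕP.m≤m+n _ (suc (4 *ⁿ N) *ⁿ suc (4 *ⁿ N)))) p) (ℕP.≤-trans
      (ℕP.m≤n+m (suc (4 *ⁿ N) *ⁿ suc (4 *ⁿ N)) (2 ^ⁿ (2 *ⁿ L) +ⁿ K N *ⁿ K N)) p) mX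
      (≤-trans (ι-mono {a₁} {L} (ℕP.≤-trans (ℕP.m≤m+n a₁ a₂)
          (ℕP.≤-trans (ℕP.m≤m+n (a₁ +ⁿ a₂) a₃) (ℕP.m≤m+n (a₁ +ⁿ a₂ +ⁿ a₃) 1)))) L≤)
      (≤-trans (ι-mono {a₂} {L} (ℕP.≤-trans (ℕP.m≤n+m a₂ a₁)
          (ℕP.≤-trans (ℕP.m≤m+n (a₁ +ⁿ a₂) a₃) (ℕP.m≤m+n (a₁ +ⁿ a₂ +ⁿ a₃) 1)))) L≤)
      (≤-trans (ι-mono {a₃} {L} (ℕP.≤-trans (ℕP.m≤n+m a₃ (a₁ +ⁿ a₂)) (ℕP.m≤m+n (a₁ +ⁿ a₂ +ⁿ a₃) 1))) L≤)
      (≤-trans (ι-mono {1} {L} (ℕP.m≤n+m 1 (a₁ +ⁿ a₂ +ⁿ a₃))) L≤))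
      (subst (_≤ (α - η N) * ι m + ι (4 *ⁿ x₁)) (+-identityʳ ((α - η N) * ι m))
          (≤-refl {(α - η N) * ι m} +≤ ι≥0 (4 *ⁿ x₁)))
    where
    open LogSystem S
    2^≤m : 2 ^ⁿ (2 *ⁿ L) ≤ⁿ m
    2^≤m = ℕP.≤-trans (ℕP.≤-trans (ℕP.m≤m+n _ (K N *ⁿ K N)) (ℕP.m≤m+n _ (suc (4 *ⁿ N) *ⁿ suc (4 *ⁿ N)))) p
    L≤ : ι L ≤ ℓ m
    L≤ = ≤-trans (ι-cancelˡ {2} z<s (subst (_≤ ι 2 * ℓ (2 ^ⁿ (2 *ⁿ L))) (ι-* 2 L)
        (Estimates.ℓ-2^ S 2≤X (2 *ⁿ L)))) (Estimates.ℓ-mono S 2≤X (1≤p^k (2 *ⁿ L) z<s) 2^≤m (ℕP.<⇒≤ mX))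

-- The gain `η N = 1 / (N C)` does not depend on the slope, so `4 N C` steps down from Chebyshev's 4
-- would reach 0. The slope `4 / N` is therefore attained by then; once attained, it is kept as the
-- first case of `State`.
prime-number-theorem : ∀ N → 1 ≤ⁿ N → ∃ λ B → ψ-Bound (ι 4 * inv N) B
prime-number-theorem N hN = finish (descend (4 *ⁿ (N *ⁿ C N)))
  where
  η≥0 : 0ℚ ≤ η N
  η≥0 = *≥0 (inv≥0 N) (inv≥0 (C N))
  State : ℕ → Set
  State k = (∃ λ B → ψ-Bound (ι 4 * inv N) B) ⊎ (∃ λ B → ψ-Bound (ι 4 - ι k * η N) B)
  r0 : ∀ e → ι 4 ≤ ι 4 - 0ℚ * e
  r0 e = ≤-reflexive (solve (e ∷ []) ℚR)
  r1 : ∀ k e → ι 4 - k * e - e ≤ ι 4 - (1ℚ + k) * e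
  r1 k e = ≤-reflexive (solve (k ∷ e ∷ []) ℚR)
  r2 : ∀ k → 0ℚ ≤ k → ι 4 - k ≤ ι 4
  r2 k p = lin p (solve (k ∷ []) ℚR)
  start : ψ-Bound (ι 4) 0
  start S 2≤X m mX = abs-mono (Estimates.R-abs S 2≤X mX) (≤-reflexive (sym (+-identityʳ (ι 4 * ι m))))
  descend : ∀ k → State k
  descend zero = inj₂ (0 , ψ-Bound-mono {B = 0} (r0 (η N)) start)
  descend (suc k) = go (descend k)
    where
    α = ι 4 - ι k * η N
    go₂ : (∃ λ B → ψ-Bound α B) → Dec (ι 4 * inv N ≤ α) → State (suc k)
    go₂ (B , p) (no ¬q) = inj₁ (B , ψ-Bound-mono {B = B} (<⇒≤ (≰⇒> ¬q)) p)
    go₂ (B , p) (yes q) = wrap (improve-bound {N} {B} α hN q (r2 (ι k * η N) (*≥0 (ι≥0 k) η≥0)) p)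
      where
      wrap : (∃ λ B → ψ-Bound (α - η N) B) → State (suc k)
      wrap (B′ , p′) = inj₂ (B′ , ψ-Bound-mono {B = B′} (r1 (ι k) (η N)) p′)
    go : State k → State (suc k)
    go (inj₁ p) = inj₁ p
    go (inj₂ p) = go₂ p (ι 4 * inv N ≤? α)
  last≤ : ι 4 - ι (4 *ⁿ (N *ⁿ C N)) * η N ≤ ι 4 * inv N
  last≤ = subst (_≤ ι 4 * inv N) (sym e) (*≥0 (ι≥0 4) (inv≥0 N))
    where
    r : ∀ n c i j → ι 4 - ι 4 * (n * c) * (i * j) ≡ ι 4 - ι 4 * ((n * i) * (c * j))
    r = solve-∀ ℚR
    e : ι 4 - ι (4 *ⁿ (N *ⁿ C N)) * η N ≡ 0ℚ
    e = trans (cong (λ z → ι 4 - z * η N) (trans (ι-* 4 (N *ⁿ C N)) (cong (ι 4 *_) (ι-* N (C N)))))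
        (trans (r (ι N) (ι (C N)) (inv N) (inv (C N))) (cong₂ (λ a b → ι 4 - ι 4 * (a * b)) (ι*inv hN)
        (ι*inv (C≥1 hN))))
  finish : State (4 *ⁿ (N *ⁿ C N)) → ∃ λ B → ψ-Bound (ι 4 * inv N) B
  finish (inj₁ p) = p
  finish (inj₂ (B , p)) = B , ψ-Bound-mono {B = B} last≤ p

-- Mean and variance

open import Data.Integer using (+_)

-- `L` is `ℓ(2n)²` for a logarithm that changes with `n`; it stays anonymous because it cancels in
-- the quotients formed later. Uniformity in `t ≤ n` is what summation by parts consumes.
SquareLaw : ℕ → ℕ → Set
SquareLaw M n = ∃ λ L → ∀ t → t ≤ⁿ n → ∣ L * ι (card t) - ι t * ι t ∣≤ ι 213 * (ι n * ι n * inv M)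

card-square : ∀ M → 1 ≤ⁿ M → ∃ λ n₀ → ∀ n → n₀ ≤ⁿ n → SquareLaw M n
card-square M hM = go (prime-number-theorem M hM)
  where
  go : (∃ λ B → ψ-Bound (ι 4 * inv M) B) → ∃ λ n₀ → ∀ n → n₀ ≤ⁿ n → SquareLaw M n
  go (B , hB) = x₀ , λ n hn → main n hn
    where
    -- For `n ≥ M * k` every additive constant of the estimates, and 1 itself, is at most
    -- `r = x / M`.
    k = B +ⁿ C₁ M +ⁿ C₂ M +ⁿ (M +ⁿ 2) +ⁿ 1
    x₀ = M *ⁿ k +ⁿ 4
    main : ∀ n → x₀ ≤ⁿ n → SquareLaw M n
    main n hn = withRoot (isqrt x)
      where
      x = n +ⁿ n
      -- `W-abs` asks for `(s + 1)² < X`, and `s + 1 ≤ x` for the integer root `s` of `x`.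
      X = 2 +ⁿ x *ⁿ x
      S = Build.logSystem X
      2≤X : 2 ≤ⁿ X
      2≤X = s≤s z<s
      open LogSystem S
      x₀≤x : x₀ ≤ⁿ x
      x₀≤x = ℕP.≤-trans hn (ℕP.m≤m+n n n)
      4≤x : 4 ≤ⁿ x
      4≤x = ℕP.≤-trans (ℕP.m≤n+m 4 (M *ⁿ k)) x₀≤x
      hx : 1 ≤ⁿ x
      hx = ℕP.≤-trans z<s 4≤x
      r = ι x * inv M
      k≤r : ι k ≤ r
      k≤r = ι-cancelˡ hM (subst₂ _≤_ (ι-* M k) (sym (trans (cong (ι M *_) (*-comm (ι x) (inv M)))
          (ι*inv* (ι x) hM))) (ι-mono (ℕP.≤-trans (ℕP.m≤m+n (M *ⁿ k) 4) x₀≤x)))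
      ιk : ι k ≡ ι B + ι (C₁ M) + ι (C₂ M) + ι (M +ⁿ 2) + ι 1
      ιk = trans (ι-+ (B +ⁿ C₁ M +ⁿ C₂ M +ⁿ (M +ⁿ 2)) 1) (cong (_+ ι 1)
          (trans (ι-+ (B +ⁿ C₁ M +ⁿ C₂ M) (M +ⁿ 2)) (cong (_+ ι (M +ⁿ 2))
          (trans (ι-+ (B +ⁿ C₁ M) (C₂ M)) (cong (_+ ι (C₂ M)) (ι-+ B (C₁ M)))))))
      xX : x <ⁿ X
      xX = s≤s (ℕP.m≤n⇒m≤1+n (ℕP.m≤m*n x x {{>-nonZero hx}}))
      withRoot : (∃ λ s → (s *ⁿ s ≤ⁿ x) × (x <ⁿ suc s *ⁿ suc s)) → SquareLaw M n
      withRoot (s , lo , hi) = ℓ x * ℓ x , λ t tn → quarter (ℓ x * ℓ x * ι (card t) - ι t * ι t) (ι n)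
          (inv M) (subst (λ z → ∣ ι 4 * (ℓ x * ℓ x * ι (card t) - ι t * ι t) ∣≤ ι 213 * (z * inv M * z))
          (ι-+ n n) (Estimates.card-approx S 2≤X {n} {x} {M} refl hx xX W-δ δ≤ logDefect≤ ℓ≤ 1≤r t tn))
        where
        2≤s : 2 ≤ⁿ s
        2≤s = ℕP.≮⇒≥ λ lt → ℕP.<⇒≱ hi (ℕP.≤-trans (ℕP.*-mono-≤ lt lt) 4≤x)
        s<x : suc s ≤ⁿ x
        s<x = ℕP.≤-trans (ℕP.m<m*n s s {{>-nonZero (ℕP.≤-trans z<s 2≤s)}} 2≤s) lo
        ssX : suc s *ⁿ suc s <ⁿ X
        ssX = s≤s (ℕP.m≤n⇒m≤1+n (ℕP.*-mono-≤ s<x s<x))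
        W-δ = Estimates.W-abs S 2≤X {M} {B} {x} {s} hM (hB S 2≤X) 2≤s lo hi ssX
        pick : ∀ a b c d r → 0ℚ ≤ a → 0ℚ ≤ b → 0ℚ ≤ c → 0ℚ ≤ d → a + b + c + d + ι 1 ≤ r →
            (a + b ≤ r) × (c ≤ r) × (d ≤ r) × (1ℚ ≤ r)
        pick a b c d r za zb zc zd h = lin (h +≤ zc +≤ zd +≤ 0≤1) (solve (a ∷ b ∷ c ∷ d ∷ r ∷ []) ℚR) , lin
            (h +≤ za +≤ zb +≤ zd +≤ 0≤1) (solve (a ∷ b ∷ c ∷ d ∷ r ∷ []) ℚR) , lin
            (h +≤ za +≤ zb +≤ zc +≤ 0≤1) (solve (a ∷ b ∷ c ∷ d ∷ r ∷ []) ℚR) , lin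
            (h +≤ za +≤ zb +≤ zc +≤ zd) (solve (a ∷ b ∷ c ∷ d ∷ r ∷ []) ℚR)
        picked = pick (ι B) (ι (C₁ M)) (ι (C₂ M)) (ι (M +ⁿ 2)) r (ι≥0 B) (ι≥0 (C₁ M)) (ι≥0 (C₂ M))
            (ι≥0 (M +ⁿ 2)) (subst (_≤ r) ιk k≤r)
        1≤r : 1ℚ ≤ r
        1≤r = proj₂ (proj₂ (proj₂ picked))
        r9 : ∀ r c → c ≤ r → ι 9 * r + c ≤ ι 10 * r
        r9 r c h = lin h (solve (r ∷ c ∷ []) ℚR)
        δ≤ : ι 9 * r + (ι B + ι (C₁ M)) ≤ ι 10 * r
        δ≤ = r9 r (ι B + ι (C₁ M)) (proj₁ picked)
        r2 : ∀ r c d → d ≤ ι 2 * r + c → c ≤ r → d ≤ ι 3 * r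
        r2 r c d h k = lin (h +≤ k) (solve (r ∷ c ∷ d ∷ []) ℚR)
        logDefect≤ = r2 r (ι (C₂ M)) (Estimates.logDefect S 2≤X x) (Estimates.logDefect-end S 2≤X hM hx xX)
            (proj₁ (proj₂ picked))
        r1 : ∀ r c d → d ≤ r + c → c ≤ r → d ≤ ι 2 * r
        r1 r c d h k = lin (h +≤ k) (solve (r ∷ c ∷ d ∷ []) ℚR)
        ℓ≤ = r1 r (ι (M +ⁿ 2)) (ℓ x) (Estimates.sublinear S 2≤X hM hx xX) (proj₁ (proj₂ (proj₂ picked)))
        quarter : ∀ z n i → ∣ ι 4 * z ∣≤ ι 213 * ((n + n) * i * (n + n)) → ∣ z ∣≤ ι 213 * (n * n * i)
        quarter z n i (a , b) = ι-cancelˡ {4} z<s (lin a (solve (z ∷ n ∷ i ∷ []) ℚR)) , ι-cancelˡ {4} z<s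
            (lin b (solve (z ∷ n ∷ i ∷ []) ℚR))

moment₁-abel : ∀ (q : ℕ → ℚ) n → Σ n (λ k → ι k * q k) + Σ n (λ j → Σ (pred j) q) ≡ ι n * Σ n q
moment₁-abel q zero = refl
moment₁-abel q (suc n) = trans (r (Σ n (λ k → ι k * q k)) (Σ n (λ j → Σ (pred j) q)) (ι n) (q (suc n))
    (Σ n q)) (trans (cong (_+ (Σ n q + (1ℚ + ι n) * q (suc n))) (moment₁-abel q n))
    (r2 (ι n) (Σ n q) (q (suc n))))
  where
  r : ∀ a b n q c → a + (1ℚ + n) * q + (b + c) ≡ a + b + (c + (1ℚ + n) * q)
  r = solve-∀ ℚR
  r2 : ∀ n c q → n * c + (c + (1ℚ + n) * q) ≡ (1ℚ + n) * (c + q)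
  r2 = solve-∀ ℚR

-- The weight `2 (j - 1) + 1` is the difference `j² - (j - 1)²`.
moment₂-abel : ∀ (q : ℕ → ℚ) n → Σ n (λ k → ι k * ι k * q k) + Σ n
    (λ j → (ι 2 * ι (pred j) + 1ℚ) * Σ (pred j) q) ≡ ι n * ι n * Σ n q
moment₂-abel q zero = refl
moment₂-abel q (suc n) = trans (r (Σ n (λ k → ι k * ι k * q k))
    (Σ n (λ j → (ι 2 * ι (pred j) + 1ℚ) * Σ (pred j) q)) (ι n) (q (suc n)) (Σ n q))
    (trans (cong (_+ ((ι 2 * ι n + 1ℚ) * Σ n q + (1ℚ + ι n) * (1ℚ + ι n) * q (suc n))) (moment₂-abel q n))
    (r2 (ι n) (Σ n q) (q (suc n))))
  where
  r : ∀ a b n q c → a + (1ℚ + n) * (1ℚ + n) * q + (b + (ι 2 * n + 1ℚ) * c) ≡ a + b +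
      ((ι 2 * n + 1ℚ) * c + (1ℚ + n) * (1ℚ + n) * q)
  r = solve-∀ ℚR
  r2 : ∀ n c q → n * n * c + ((ι 2 * n + 1ℚ) * c + (1ℚ + n) * (1ℚ + n) * q) ≡ (1ℚ + n) * (1ℚ + n) * (c + q)
  r2 = solve-∀ ℚR

Σ-squares : ∀ n → ι 6 * Σ n (λ j → ι (pred j) * ι (pred j)) ≡ ι 2 * (ι n * ι n * ι n) - ι 3 * (ι n * ι n) +
    ι n
Σ-squares zero = refl
Σ-squares (suc n) = trans (*-distribˡ-+ (ι 6) (Σ n (λ j → ι (pred j) * ι (pred j))) (ι n * ι n))
    (trans (cong (_+ ι 6 * (ι n * ι n)) (Σ-squares n)) (r (ι n)))
  where
  r : ∀ n → ι 2 * (n * n * n) - ι 3 * (n * n) + n + ι 6 * (n * n) ≡ ι 2 *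
      ((1ℚ + n) * (1ℚ + n) * (1ℚ + n)) - ι 3 * ((1ℚ + n) * (1ℚ + n)) + (1ℚ + n)
  r = solve-∀ ℚR

Σ-cubes : ∀ n → ι 6 * Σ n (λ j → (ι 2 * ι (pred j) + 1ℚ) * (ι (pred j) * ι (pred j))) ≡ ι 3 *
    (ι n * ι n * (ι n * ι n)) - ι 4 * (ι n * ι n * ι n) + ι n
Σ-cubes zero = refl
Σ-cubes (suc n) = trans (*-distribˡ-+ (ι 6) (Σ n (λ j → (ι 2 * ι (pred j) + 1ℚ) * (ι (pred j) * ι (pred j))))
    ((ι 2 * ι n + 1ℚ) * (ι n * ι n))) (trans (cong (_+ ι 6 * ((ι 2 * ι n + 1ℚ) * (ι n * ι n))) (Σ-cubes n))
    (r (ι n)))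
  where
  r : ∀ n → ι 3 * (n * n * (n * n)) - ι 4 * (n * n * n) + n + ι 6 * ((ι 2 * n + 1ℚ) * (n * n)) ≡ ι 3 *
      ((1ℚ + n) * (1ℚ + n) * ((1ℚ + n) * (1ℚ + n))) - ι 4 * ((1ℚ + n) * (1ℚ + n) * (1ℚ + n)) + (1ℚ + n)
  r = solve-∀ ℚR

Σ-odd : ∀ n → Σ n (λ j → ι 2 * ι (pred j) + 1ℚ) ≡ ι n * ι n
Σ-odd zero = refl
Σ-odd (suc n) = trans (cong (_+ (ι 2 * ι n + 1ℚ)) (Σ-odd n)) (r (ι n))
  where
  r : ∀ n → n * n + (ι 2 * n + 1ℚ) ≡ (1ℚ + n) * (1ℚ + n)
  r = solve-∀ ℚR

moment-1 : ∀ n → ι (moment 1 n) ≡ Σ n (λ k → ι k * ι (Q₂ k))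
moment-1 n = trans (moment-Σ 1 n) (Σ-cong n (λ k _ _ → trans (ι-* (k ^ⁿ 1) (Q₂ k))
    (cong (λ z → ι z * ι (Q₂ k)) (ℕP.*-identityʳ k))))

moment-2 : ∀ n → ι (moment 2 n) ≡ Σ n (λ k → ι k * ι k * ι (Q₂ k))
moment-2 n = trans (moment-Σ 2 n) (Σ-cong n (λ k _ _ → trans (ι-* (k ^ⁿ 2) (Q₂ k))
    (cong (_* ι (Q₂ k)) (trans (cong (λ z → ι (k *ⁿ z)) (ℕP.*-identityʳ k)) (ι-* k k)))))

module _ {n : ℕ} {L b : ℚ} (hn : 1 ≤ⁿ n) (hb : ∀ t → t ≤ⁿ n → ∣ L * ι (card t) - ι t * ι t ∣≤ b) where

  private
    q : ℕ → ℚ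
    q k = ι (Q₂ k)
    N = ι n
    c = ι (card n)
    E₀ = L * c - N * N
    low : ∀ {j} → j ≤ⁿ n → pred j ≤ⁿ n
    low h = ℕP.≤-trans ℕP.pred[n]≤n h

  -- By parts, `L` times the moment is `N (L c)` minus the sum of `L * card (j - 1)`. The former is
  -- near `N³` and the latter near `N³ / 3`, which leaves `2/3`, or 4 out of 6. Comparison with
  -- `N (L c)` instead of `N³` prepares the division by `card n`.
  moment₁-approx : ∣ ι 6 * (L * ι (moment 1 n)) - ι 4 * (N * (L * c)) ∣≤ ι 8 * (N * b) + ι 3 * (N * N)
  moment₁-approx = subst (∣_∣≤ ι 8 * (N * b) + ι 3 * (N * N)) (sym id)
      (abs-mono (abs-+ (abs-- (abs-scale (*≥0 (ι≥0 2) (ι≥0 n)) (hb n ℕP.≤-refl)) (abs-scale (ι≥0 6) E₁))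
      tail) (≤-reflexive (r9 N b)))
    where
    E₁ : ∣ L * Σ n (λ j → Σ (pred j) q) - Σ n (λ j → ι (pred j) * ι (pred j)) ∣≤ N * b
    E₁ = subst₂ ∣_∣≤_ (trans (Σ-- n _ _) (cong (_- Σ n (λ j → ι (pred j) * ι (pred j)))
        (Σ-*ˡ n L (λ j → Σ (pred j) q)))) (Σ-const n b)
      (abs-Σ n {λ j → L * Σ (pred j) q - ι (pred j) * ι (pred j)}
          (λ j _ jn → subst (λ z → ∣ L * z - ι (pred j) * ι (pred j) ∣≤ b) (card-Σ (pred j))
          (hb (pred j) (low jn))))
    tail : ∣ ι 3 * (N * N) - N ∣≤ ι 3 * (N * N)
    tail = abs-nonneg (r N (ι-mono hn)) (r′ N (ι≥0 n))
      where
      r : ∀ n → 1ℚ ≤ n → 0ℚ ≤ ι 3 * (n * n) - n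
      r n h = lin (*≥0 (≤-trans 0≤1 h) (diff≥0 h) +≤ (ι≥0 2 ·≤ *≥0 (≤-trans 0≤1 h) (≤-trans 0≤1 h)))
          (solve (n ∷ []) ℚR)
      r′ : ∀ n → 0ℚ ≤ n → ι 3 * (n * n) - n ≤ ι 3 * (n * n)
      r′ n h = lin h (solve (n ∷ []) ℚR)
    r0 : ∀ L m s N C Z → m + s ≡ N * C → ι 6 * Z ≡ ι 2 * (N * N * N) - ι 3 * (N * N) + N →
        ι 6 * (L * m) - ι 4 * (N * (L * C)) ≡ ι 2 * N * (L * C - N * N) - ι 6 * (L * s - Z) +
        (ι 3 * (N * N) - N)
    r0 L m s N C Z h k = trans (a₁ L m s N C) (trans (cong (λ z → ι 6 * (L * z) - ι 6 * (L * s) - ι 4 *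
        (N * (L * C))) h) (trans (a₂ L s N C Z) (trans (cong
        (λ z → ι 2 * N * (L * C) - ι 6 * (L * s - Z) - z) k) (a₃ N (L * C) (ι 6 * (L * s - Z))))))
      where
      a₁ : ∀ L m s N C → ι 6 * (L * m) - ι 4 * (N * (L * C)) ≡ ι 6 * (L * (m + s)) - ι 6 * (L * s) - ι 4 *
          (N * (L * C))
      a₁ = solve-∀ ℚR
      a₂ : ∀ L s N C Z → ι 6 * (L * (N * C)) - ι 6 * (L * s) - ι 4 * (N * (L * C)) ≡ ι 2 * N *
          (L * C) - ι 6 * (L * s - Z) - ι 6 * Z
      a₂ = solve-∀ ℚR
      a₃ : ∀ N D e → ι 2 * N * D - e - (ι 2 * (N * N * N) - ι 3 * (N * N) + N) ≡ ι 2 * N * (D - N * N) - e +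
          (ι 3 * (N * N) - N)
      a₃ = solve-∀ ℚR
    id : ι 6 * (L * ι (moment 1 n)) - ι 4 * (N * (L * c)) ≡ ι 2 * N * E₀ - ι 6 *
        (L * Σ n (λ j → Σ (pred j) q) - Σ n (λ j → ι (pred j) * ι (pred j))) + (ι 3 * (N * N) - N)
    id = r0 L (ι (moment 1 n)) (Σ n (λ j → Σ (pred j) q)) N c (Σ n (λ j → ι (pred j) * ι (pred j)))
        (trans (cong (_+ Σ n (λ j → Σ (pred j) q)) (moment-1 n))
        (trans (moment₁-abel q n) (cong (N *_) (sym (card-Σ n))))) (Σ-squares n)
    r9 : ∀ n b → ι 2 * n * b + ι 6 * (n * b) + ι 3 * (n * n) ≡ ι 8 * (n * b) + ι 3 * (n * n)
    r9 = solve-∀ ℚR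

  -- As for the first moment, but with weights `2 (j - 1) + 1`, whose sum against `(j - 1)²` is near
  -- `N⁴ / 2`; this leaves 3 out of 6.
  moment₂-approx : ∣ ι 6 * (L * ι (moment 2 n)) - ι 3 * (N * N * (L * c)) ∣≤ ι 9 * (N * N * b) + ι 4 *
      (N * N * N)
  moment₂-approx = subst (∣_∣≤ ι 9 * (N * N * b) + ι 4 * (N * N * N)) (sym id)
      (abs-mono (abs-+ (abs-- (abs-scale (*≥0 (ι≥0 3) (*≥0 (ι≥0 n) (ι≥0 n))) (hb n ℕP.≤-refl))
      (abs-scale (ι≥0 6) E₂)) tail) (≤-reflexive (r9 N b)))
    where
    d : ℕ → ℚ
    d j = ι 2 * ι (pred j) + 1ℚ
    d≥0 : ∀ j → 0ℚ ≤ d j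
    d≥0 j = +≥0 (*≥0 (ι≥0 2) (ι≥0 (pred j))) 0≤1
    r1 : ∀ d L s z → d * (L * s - z) ≡ L * (d * s) - d * z
    r1 = solve-∀ ℚR
    E₂ : ∣ L * Σ n (λ j → d j * Σ (pred j) q) - Σ n (λ j → d j * (ι (pred j) * ι (pred j))) ∣≤ N * N * b
    E₂ = subst₂ ∣_∣≤_ (trans (Σ-cong n (λ j _ _ → r1 (d j) L (Σ (pred j) q) (ι (pred j) * ι (pred j))))
        (trans (Σ-- n _ _) (cong (_- Σ n (λ j → d j * (ι (pred j) * ι (pred j))))
        (Σ-*ˡ n L (λ j → d j * Σ (pred j) q))))) (trans (Σ-*ʳ n b d) (cong (_* b) (Σ-odd n)))
      (abs-Σ n {λ j → d j * (L * Σ (pred j) q - ι (pred j) * ι (pred j))}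
          (λ j _ jn → abs-scale (d≥0 j) (subst (λ z → ∣ L * z - ι (pred j) * ι (pred j) ∣≤ b)
          (card-Σ (pred j)) (hb (pred j) (low jn)))))
    tail : ∣ ι 4 * (N * N * N) - N ∣≤ ι 4 * (N * N * N)
    tail = abs-nonneg (r N (ι-mono hn)) (r′ N (ι≥0 n))
      where
      r : ∀ n → 1ℚ ≤ n → 0ℚ ≤ ι 4 * (n * n * n) - n
      r n h = lin (*≥0 (*≥0 zn zn) (diff≥0 h) +≤ *≥0 zn (diff≥0 h) +≤ (ι≥0 3 ·≤ *≥0 (*≥0 zn zn) zn))
          (solve (n ∷ []) ℚR)
        where
        zn : 0ℚ ≤ n
        zn = ≤-trans 0≤1 h
      r′ : ∀ n → 0ℚ ≤ n → ι 4 * (n * n * n) - n ≤ ι 4 * (n * n * n)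
      r′ n h = lin h (solve (n ∷ []) ℚR)
    r0 : ∀ L m s N C Z → m + s ≡ N * N * C → ι 6 * Z ≡ ι 3 * (N * N * (N * N)) - ι 4 * (N * N * N) + N →
        ι 6 * (L * m) - ι 3 * (N * N * (L * C)) ≡ ι 3 * (N * N) * (L * C - N * N) - ι 6 * (L * s - Z) +
        (ι 4 * (N * N * N) - N)
    r0 L m s N C Z h k = trans (a₁ L m s N C) (trans (cong (λ z → ι 6 * (L * z) - ι 6 * (L * s) - ι 3 *
        (N * N * (L * C))) h) (trans (a₂ L s N C Z) (trans (cong
        (λ z → ι 3 * (N * N) * (L * C) - ι 6 * (L * s - Z) - z) k) (a₃ N (L * C) (ι 6 * (L * s - Z))))))
      where
      a₁ : ∀ L m s N C → ι 6 * (L * m) - ι 3 * (N * N * (L * C)) ≡ ι 6 * (L * (m + s)) - ι 6 *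
          (L * s) - ι 3 * (N * N * (L * C))
      a₁ = solve-∀ ℚR
      a₂ : ∀ L s N C Z → ι 6 * (L * (N * N * C)) - ι 6 * (L * s) - ι 3 * (N * N * (L * C)) ≡ ι 3 * (N * N) *
          (L * C) - ι 6 * (L * s - Z) - ι 6 * Z
      a₂ = solve-∀ ℚR
      a₃ : ∀ N D e → ι 3 * (N * N) * D - e - (ι 3 * (N * N * (N * N)) - ι 4 * (N * N * N) + N) ≡ ι 3 *
          (N * N) * (D - N * N) - e + (ι 4 * (N * N * N) - N)
      a₃ = solve-∀ ℚR
    id : ι 6 * (L * ι (moment 2 n)) - ι 3 * (N * N * (L * c)) ≡ ι 3 * (N * N) * E₀ - ι 6 *
        (L * Σ n (λ j → d j * Σ (pred j) q) - Σ n (λ j → d j * (ι (pred j) * ι (pred j)))) +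
        (ι 4 * (N * N * N) - N)
    id = r0 L (ι (moment 2 n)) (Σ n (λ j → d j * Σ (pred j) q)) N c
        (Σ n (λ j → d j * (ι (pred j) * ι (pred j)))) (trans
        (cong (_+ Σ n (λ j → d j * Σ (pred j) q)) (moment-2 n))
        (trans (moment₂-abel q n) (cong (N * N *_) (sym (card-Σ n))))) (Σ-cubes n)
    r9 : ∀ n b → ι 3 * (n * n) * b + ι 6 * (n * n * b) + ι 4 * (n * n * n) ≡ ι 9 * (n * n * b) + ι 4 *
        (n * n * n)
    r9 = solve-∀ ℚR

-- Division as used in the statement, and the limits

ι≡/1 : ∀ n → ι n ≡ + n / 1
ι≡/1 zero = refl
ι≡/1 (suc n) = trans (cong (λ z → 1ℚ + z) (ι≡/1 n)) (ℚP.toℚᵘ-injective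
    (ℚᵘP.≃-trans (ℚP.toℚᵘ-homo-+ 1ℚ (+ n / 1)) (ℚᵘP.≃-trans (ℚᵘP.+-congʳ ℚᵘ.1ℚᵘ
    (ℚP.toℚᵘ-fromℚᵘ (ℚᵘ.mkℚᵘ (+ n) 0))) (ℚᵘP.≃-trans (ℚᵘ.*≡* (e n))
    (ℚᵘP.≃-sym (ℚP.toℚᵘ-fromℚᵘ (ℚᵘ.mkℚᵘ (+ suc n) 0)))))))
  where
  e : ∀ n → (+ 1 ℤ.* + 1 ℤ.+ + n ℤ.* + 1) ℤ.* + 1 ≡ + suc n ℤ.* (+ 1 ℤ.* + 1)
  e n = cong (ℤ._* + 1) (cong (λ z → + 1 ℤ.+ z) (ℤP.*-identityʳ (+ n)))

-- `_/_` reduces fractions, so the equation is multiplied by the denominator and checked on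
-- unnormalised rationals.
/-inv : ∀ a d → + a / suc d ≡ ι a * inv (suc d)
/-inv a d = trans (sym (trans (*-assoc p (ι (suc d)) (inv (suc d)))
    (trans (cong (p *_) (ι*inv {suc d} z<s)) (*-identityʳ p)))) (cong (_* inv (suc d)) e)
  where
  p = + a / suc d
  e : p * ι (suc d) ≡ ι a
  e = trans (cong (p *_) (ι≡/1 (suc d))) (trans (ℚP.toℚᵘ-injective
      (ℚᵘP.≃-trans (ℚP.toℚᵘ-homo-* p (+ suc d / 1)) (ℚᵘP.≃-trans
      (ℚᵘP.*-cong (ℚP.toℚᵘ-fromℚᵘ (ℚᵘ.mkℚᵘ (+ a) d)) (ℚP.toℚᵘ-fromℚᵘ (ℚᵘ.mkℚᵘ (+ suc d) 0)))
      (ℚᵘP.≃-trans (ℚᵘ.*≡* z) (ℚᵘP.≃-sym (ℚP.toℚᵘ-fromℚᵘ (ℚᵘ.mkℚᵘ (+ a) 0))))))) (sym (ι≡/1 a)))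
    where
    z : (+ a ℤ.* + suc d) ℤ.* + 1 ≡ + a ℤ.* (+ suc d ℤ.* + 1)
    z = ℤP.*-assoc (+ a) (+ suc d) (+ 1)

÷ℕ-inv : ∀ a c → a ÷ℕ c ≡ ι a * inv c
÷ℕ-inv a zero = sym (*-zeroʳ (ι a))
÷ℕ-inv a (suc d) = /-inv a d

/ℕ-inv : ∀ q n → q /ℕ n ≡ q * inv n
/ℕ-inv q zero = sym (*-zeroʳ q)
/ℕ-inv q (suc n) = cong (q *_) (trans (/-inv 1 n) (trans (cong (_* inv (suc n)) (+-identityʳ 1ℚ))
    (*-identityˡ (inv (suc n)))))

-- The numerator of a positive rational is at least 1, so its denominator serves as `D`.
archimedean : ∀ ε → 0ℚ < ε → ∃ λ D → (1 ≤ⁿ D) × (inv D ≤ ε)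
archimedean ε h = ℚ.↧ₙ ε , s≤s z≤n , go ε h
  where
  go : ∀ ε → 0ℚ < ε → inv (ℚ.↧ₙ ε) ≤ ε
  go ε@(ℚ.mkℚ (+ suc a) d cop) h = subst (inv (suc d) ≤_) (trans (sym (/-inv (suc a) d)) (ℚP.fromℚᵘ-toℚᵘ ε))
      (subst (_≤ ι (suc a) * inv (suc d)) (*-identityˡ (inv (suc d)))
      (*-monoʳ (inv (suc d)) (inv≥0 (suc d)) (ι-mono {1} {suc a} z<s)))
  go (ℚ.mkℚ (+ zero) d cop) (ℚ.*<* (ℤ.+<+ ()))
  go (ℚ.mkℚ ℤ.-[1+ a ] d cop) (ℚ.*<* ())

∣∣-< : ∀ {u a ε} → ∣ u ∣≤ a → a < ε → ℚ.∣ u ∣ < ε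
∣∣-< {u} {a} {ε} (p , q) h = go (ℚP.∣p∣≡p∨∣p∣≡-p u)
  where
  r : ∀ u a → - a ≤ u → - u ≤ a
  r u a p = lin p (solve (u ∷ a ∷ []) ℚR)
  go : ℚ.∣ u ∣ ≡ u ⊎ ℚ.∣ u ∣ ≡ - u → ℚ.∣ u ∣ < ε
  go (inj₁ e) = subst (_< ε) (sym e) (≤-<-trans q h)
  go (inj₂ e) = subst (_< ε) (sym e) (≤-<-trans (r u a p) h)

-- The error `8 N b + 3 N²` of `moment₁-approx`, with `b = 213 N² / M` and `N² ≤ N³ / M`, divided by
-- `N (L c) ≥ N³ / 2`. In the same way `k₂` comes from `moment₂-approx`.
k₁ : ℕ
k₁ = 2 *ⁿ (8 *ⁿ 213 +ⁿ 3)

k₂ : ℕ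
k₂ = 2 *ⁿ (9 *ⁿ 213 +ⁿ 4)

ι-affine : ∀ a b c → ι (2 *ⁿ (a *ⁿ b +ⁿ c)) ≡ ι 2 * (ι a * ι b + ι c)
ι-affine a b c = trans (ι-* 2 (a *ⁿ b +ⁿ c)) (cong (ι 2 *_) (trans (ι-+ (a *ⁿ b) c)
    (cong (_+ ι c) (ι-* a b))))

ι*inv-≤ : ∀ {k m D} → 1 ≤ⁿ m → k ≤ⁿ m → 1 ≤ⁿ D → ι k * inv (m *ⁿ D) ≤ inv D
ι*inv-≤ {k} {m} {D} hm km hD = ≤-trans (*-monoʳ (inv (m *ⁿ D)) (inv≥0 (m *ⁿ D)) (ι-mono km))
    (≤-reflexive (ι*inv-* hm hD))

meanRatio : ℕ → ℚ
meanRatio n = ι (moment 1 n) * inv (card n) * inv n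

squareRatio : ℕ → ℚ
squareRatio n = ι (moment 2 n) * inv (card n) * (inv n * inv n)

abs-cancel : ∀ {c z a} → 1ℚ ≤ c → ∣ c * z ∣≤ c * a → ∣ z ∣≤ a
abs-cancel {c} {z} {a} h (p , q) = cancel-≤ h (subst (_≤ c * z) (r c a) p) , cancel-≤ h q
  where
  r : ∀ c a → - (c * a) ≡ c * - a
  r = solve-∀ ℚR

-- The case `t = n` with the bound on `inv M` gives `L c ≥ N² / 2`, so `card n` is positive, and the
-- two claims may be multiplied by `2 N (L c)` and `2 N² (L c)`. Both factors are at least 1, as
-- `abs-cancel` requires.
ratios : ∀ {M n L} → 1 ≤ⁿ M → ι 2 * (ι 213 * inv M) ≤ 1ℚ → M ≤ⁿ n →
    (∀ t → t ≤ⁿ n → ∣ L * ι (card t) - ι t * ι t ∣≤ ι 213 * (ι n * ι n * inv M)) →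
  ∣ ι 6 * meanRatio n - ι 4 ∣≤ ι k₁ * inv M × ∣ ι 6 * squareRatio n - ι 3 ∣≤ ι k₂ * inv M
ratios {M} {n} {L} hM small Mn hb = withCard (card n) refl
  where
  hn : 1 ≤ⁿ n
  hn = ℕP.≤-trans hM Mn
  N = ι n
  i = inv M
  1≤N : 1ℚ ≤ N
  1≤N = ι-mono hn
  1≤Ni : 1ℚ ≤ N * i
  1≤Ni = subst (_≤ N * i) (ι*inv hM) (*-monoʳ i (inv≥0 M) (ι-mono Mn))
  half : N * N ≤ ι 2 * (L * ι (card n))
  half = r N i (L * ι (card n)) (proj₁ (hb n ℕP.≤-refl)) (*≥0 (ι≥0 n) (ι≥0 n) ·≤ small)
    where
    r : ∀ n i c → - (ι 213 * (n * n * i)) ≤ c - n * n → n * n * (ι 2 * (ι 213 * i)) ≤ n * n * 1ℚ →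
        n * n ≤ ι 2 * c
    r n i c p q = lin ((ι≥0 2 ·≤ p) +≤ q) (solve (n ∷ i ∷ c ∷ []) ℚR)
  1≤NN : 1ℚ ≤ N * N
  1≤NN = subst (_≤ N * N) (*-identityˡ 1ℚ) (*-mono 0≤1 1≤N 0≤1 1≤N)
  withCard : ∀ m → card n ≡ m → ∣ ι 6 * meanRatio n - ι 4 ∣≤ ι k₁ * i × ∣ ι 6 * squareRatio n - ι 3 ∣≤
      ι k₂ * i
  withCard zero e = ⊥-elim (ℚP.<-irrefl refl (<-≤-trans 0<1 (≤-trans 1≤NN
      (≤-trans half (≤-reflexive (trans (cong (λ z → ι 2 * (L * ι z)) e) (r L)))))))
    where
    r : ∀ L → ι 2 * (L * 0ℚ) ≡ 0ℚ
    r = solve-∀ ℚR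
  withCard (suc m) e =
      abs-cancel {ι 2 * (N * (L * c))} 1≤c₁ (subst₂ ∣_∣≤_ (sym (id₁ N L c (inv (card n)) (inv n) m₁ cc nn))
          refl (abs-mono (abs-scale (ι≥0 2) (moment₁-approx {n} {L} hn hb))
          (fin₁ N i (L * c) (ι 213) (ι k₁) (ι-affine 8 213 3) 1≤Ni (*≥0 (ι≥0 n) (ι≥0 n))
          (*≥0 (ι≥0 n) (inv≥0 M)) half (ι≥0 213))))
    , abs-cancel {ι 2 * (N * N * (L * c))} 1≤c₂ (subst₂ ∣_∣≤_
        (sym (id₂ N L c (inv (card n)) (inv n) m₂ cc nn)) refl
        (abs-mono (abs-scale (ι≥0 2) (moment₂-approx {n} {L} hn hb))
        (fin₂ N i (L * c) (ι 213) (ι k₂) (ι-affine 9 213 4) 1≤Ni (*≥0 (*≥0 (ι≥0 n) (ι≥0 n)) (ι≥0 n))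
        (*≥0 (*≥0 (ι≥0 n) (ι≥0 n)) (inv≥0 M)) half (ι≥0 213))))
    where
    c = ι (card n)
    m₁ = ι (moment 1 n)
    m₂ = ι (moment 2 n)
    cc : c * inv (card n) ≡ 1ℚ
    cc = ι*inv {card n} (subst (1 ≤ⁿ_) (sym e) z<s)
    nn : N * inv n ≡ 1ℚ
    nn = ι*inv hn
    1≤c₁ : 1ℚ ≤ ι 2 * (N * (L * c))
    1≤c₁ = r N (L * c) 1≤NN (diff≥0 1≤N) half (ι≥0 n)
      where
      r : ∀ n z → 1ℚ ≤ n * n → 0ℚ ≤ n - 1ℚ → n * n ≤ ι 2 * z → 0ℚ ≤ n → 1ℚ ≤ ι 2 * (n * z)
      r n z p q s t = lin (p +≤ *≥0 (*≥0 t t) q +≤ (t ·≤ s)) (solve (n ∷ z ∷ []) ℚR)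
    1≤c₂ : 1ℚ ≤ ι 2 * (N * N * (L * c))
    1≤c₂ = r N (L * c) 1≤NN (diff≥0 1≤NN) half (*≥0 (ι≥0 n) (ι≥0 n))
      where
      r : ∀ n z → 1ℚ ≤ n * n → 0ℚ ≤ n * n - 1ℚ → n * n ≤ ι 2 * z → 0ℚ ≤ n * n → 1ℚ ≤ ι 2 * (n * n * z)
      r n z p q s t = lin (p +≤ *≥0 t q +≤ (t ·≤ s)) (solve (n ∷ z ∷ []) ℚR)
    id₁ : ∀ n L c ic jn m → c * ic ≡ 1ℚ → n * jn ≡ 1ℚ → ι 2 * (n * (L * c)) * (ι 6 * (m * ic * jn) - ι 4) ≡
        ι 2 * (ι 6 * (L * m) - ι 4 * (n * (L * c)))
    id₁ n L c ic jn m e₁ e₂ = trans (a₁ n L c ic jn m) (trans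
        (cong₂ (λ u v → ι 2 * (ι 6 * (L * m * (u * v)) - ι 4 * (n * (L * c)))) e₁ e₂) (a₂ n L c m))
      where
      a₁ : ∀ n L c ic jn m → ι 2 * (n * (L * c)) * (ι 6 * (m * ic * jn) - ι 4) ≡ ι 2 *
          (ι 6 * (L * m * (c * ic * (n * jn))) - ι 4 * (n * (L * c)))
      a₁ = solve-∀ ℚR
      a₂ : ∀ n L c m → ι 2 * (ι 6 * (L * m * (1ℚ * 1ℚ)) - ι 4 * (n * (L * c))) ≡ ι 2 *
          (ι 6 * (L * m) - ι 4 * (n * (L * c)))
      a₂ = solve-∀ ℚR
    id₂ : ∀ n L c ic jn m → c * ic ≡ 1ℚ → n * jn ≡ 1ℚ → ι 2 * (n * n * (L * c)) *
        (ι 6 * (m * ic * (jn * jn)) - ι 3) ≡ ι 2 * (ι 6 * (L * m) - ι 3 * (n * n * (L * c)))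
    id₂ n L c ic jn m e₁ e₂ = trans (a₁ n L c ic jn m) (trans
        (cong₂ (λ u v → ι 2 * (ι 6 * (L * m * (u * (v * v))) - ι 3 * (n * n * (L * c)))) e₁ e₂) (a₂ n L c m))
      where
      a₁ : ∀ n L c ic jn m → ι 2 * (n * n * (L * c)) * (ι 6 * (m * ic * (jn * jn)) - ι 3) ≡ ι 2 *
          (ι 6 * (L * m * (c * ic * (n * jn * (n * jn)))) - ι 3 * (n * n * (L * c)))
      a₁ = solve-∀ ℚR
      a₂ : ∀ n L c m → ι 2 * (ι 6 * (L * m * (1ℚ * (1ℚ * 1ℚ))) - ι 3 * (n * n * (L * c))) ≡ ι 2 *
          (ι 6 * (L * m) - ι 3 * (n * n * (L * c)))
      a₂ = solve-∀ ℚR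
    f₁ : ∀ n i z g → 1ℚ ≤ n * i → 0ℚ ≤ n * n → 0ℚ ≤ n * i → n * n ≤ ι 2 * z → 0ℚ ≤ g →
        ι 2 * (ι 8 * (n * (g * (n * n * i))) + ι 3 * (n * n)) ≤ ι 2 * (n * z) * (ι 2 * (ι 8 * g + ι 3) * i)
    f₁ n i z g p q s t zg = lin ((ι≥0 6 ·≤ (q ·≤ p)) +≤ (*≥0 (+≥0 (*≥0 (ι≥0 8) zg) (ι≥0 3)) (ι≥0 2) ·≤
        (s ·≤ t))) (solve (n ∷ i ∷ z ∷ g ∷ []) ℚR)
    fin₁ : ∀ n i z g k → k ≡ ι 2 * (ι 8 * g + ι 3) → 1ℚ ≤ n * i → 0ℚ ≤ n * n → 0ℚ ≤ n * i → n * n ≤ ι 2 * z →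
        0ℚ ≤ g → ι 2 * (ι 8 * (n * (g * (n * n * i))) + ι 3 * (n * n)) ≤ ι 2 * (n * z) * (k * i)
    fin₁ n i z g k refl p q s t zg = f₁ n i z g p q s t zg
    f₂ : ∀ n i z g → 1ℚ ≤ n * i → 0ℚ ≤ n * n * n → 0ℚ ≤ n * n * i → n * n ≤ ι 2 * z → 0ℚ ≤ g →
        ι 2 * (ι 9 * (n * n * (g * (n * n * i))) + ι 4 * (n * n * n)) ≤ ι 2 * (n * n * z) *
        (ι 2 * (ι 9 * g + ι 4) * i)
    f₂ n i z g p q s t zg = lin ((ι≥0 8 ·≤ (q ·≤ p)) +≤ (*≥0 (+≥0 (*≥0 (ι≥0 9) zg) (ι≥0 4)) (ι≥0 2) ·≤
        (s ·≤ t))) (solve (n ∷ i ∷ z ∷ g ∷ []) ℚR)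
    fin₂ : ∀ n i z g k → k ≡ ι 2 * (ι 9 * g + ι 4) → 1ℚ ≤ n * i → 0ℚ ≤ n * n * n → 0ℚ ≤ n * n * i →
        n * n ≤ ι 2 * z → 0ℚ ≤ g → ι 2 * (ι 9 * (n * n * (g * (n * n * i))) + ι 4 * (n * n * n)) ≤ ι 2 *
        (n * n * z) * (k * i)
    fin₂ n i z g k refl p q s t zg = f₂ n i z g p q s t zg

ratio-limits : ∀ D → 1 ≤ⁿ D → ∃ λ n₀ → ∀ n → n₀ ≤ⁿ n → (1 ≤ⁿ n) × ∣ ι 6 * meanRatio n - ι 4 ∣≤
    inv D × ∣ ι 6 * squareRatio n - ι 3 ∣≤ inv D
ratio-limits D hD = go (card-square M hM)
  where
  m = k₁ +ⁿ k₂
  M = m *ⁿ D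
  hm : 1 ≤ⁿ m
  hm = s≤s z≤n
  hM : 1 ≤ⁿ M
  hM = ℕP.*-mono-≤ hm hD
  b₁ : ι k₁ * inv M ≤ inv D
  b₁ = ι*inv-≤ {k₁} {m} hm (ℕP.m≤m+n k₁ k₂) hD
  b₂ : ι k₂ * inv M ≤ inv D
  b₂ = ι*inv-≤ {k₂} {m} hm (ℕP.m≤n+m k₂ k₁) hD
  small : ι 2 * (ι 213 * inv M) ≤ 1ℚ
  small = ≤-trans (≤-reflexive (trans (sym (*-assoc (ι 2) (ι 213) (inv M)))
      (cong (_* inv M) (sym (ι-* 2 213))))) (≤-trans (ι*inv-≤ {2 *ⁿ 213} {m} hm (ℕP.≤ᵇ⇒≤ (2 *ⁿ 213) m _) hD)
      (inv≤1 D))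
  go : (∃ λ n₀ → ∀ n → n₀ ≤ⁿ n → SquareLaw M n) → ∃ λ n₀ → ∀ n → n₀ ≤ⁿ n →
      (1 ≤ⁿ n) × ∣ ι 6 * meanRatio n - ι 4 ∣≤ inv D × ∣ ι 6 * squareRatio n - ι 3 ∣≤ inv D
  go (n₀ , f) = n₀ +ⁿ M , λ n hn → fin n hn (f n (ℕP.≤-trans (ℕP.m≤m+n n₀ M) hn))
    where
    fin : ∀ n → n₀ +ⁿ M ≤ⁿ n → (SquareLaw M n) → (1 ≤ⁿ n) × ∣ ι 6 * meanRatio n - ι 4 ∣≤
        inv D × ∣ ι 6 * squareRatio n - ι 3 ∣≤ inv D
    fin n hn (L , hb) = ℕP.≤-trans hM Mn , abs-mono (proj₁ rt) b₁ , abs-mono (proj₂ rt) b₂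
      where
      Mn : M ≤ⁿ n
      Mn = ℕP.≤-trans (ℕP.m≤n+m M n₀) hn
      rt = ratios {M} {n} {L} hM small Mn hb

mean-eq : ∀ n → 𝔼G n /ℕ n ≡ meanRatio n
mean-eq n = trans (/ℕ-inv (𝔼G n) n) (cong (_* inv n) (÷ℕ-inv (moment 1 n) (card n)))

var-eq : ∀ {n} → 1 ≤ⁿ n → VarG n /ℕ (n *ⁿ n) ≡ squareRatio n - meanRatio n * meanRatio n
var-eq {n} hn = trans (/ℕ-inv (VarG n) (n *ⁿ n)) (trans (cong₂ (λ a b → a * b)
    (cong₂ (λ a b → a - b * b) (÷ℕ-inv (moment 2 n) (card n)) (÷ℕ-inv (moment 1 n) (card n))) (inv-* hn hn))
    (r (ι (moment 2 n) * inv (card n)) (ι (moment 1 n) * inv (card n)) (inv n)))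
  where
  r : ∀ a b j → (a - b * b) * (j * j) ≡ a * (j * j) - b * j * (b * j)
  r = solve-∀ ℚR

½ε : ∀ {ε} → 0ℚ < ε → inv 2 * ε < ε
½ε {ε} h = subst₂ _<_ (+-identityʳ (inv 2 * ε)) (r ε) (ℚP.+-monoʳ-< (inv 2 * ε)
    (subst (_< inv 2 * ε) (*-zeroʳ (inv 2)) (ℚP.*-monoʳ-<-pos (inv 2) h)))
  where
  r : ∀ e → inv 2 * e + inv 2 * e ≡ e
  r = solve-∀ ℚR

theorem1 : ConvergesTo (λ n → 𝔼G n /ℕ n) (+ 2 / 3)
         × ConvergesTo (λ n → VarG n /ℕ (n *ⁿ n)) (+ 1 / 18)
theorem1 = mean , var
  where
  mean : ConvergesTo (λ n → 𝔼G n /ℕ n) (+ 2 / 3)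
  mean ε hε = go (archimedean ε hε)
    where
    r : ∀ u j e → ∣ ι 6 * u - ι 4 ∣≤ j → j ≤ e → 0ℚ ≤ e → ∣ u - + 2 / 3 ∣≤ inv 2 * e
    r u j e (p , q) h z = ι-cancelˡ {6} z<s (lin (p +≤ h +≤ (ι≥0 2 ·≤ z)) (solve (u ∷ j ∷ e ∷ []) ℚR)) ,
        ι-cancelˡ {6} z<s (lin (q +≤ h +≤ (ι≥0 2 ·≤ z)) (solve (u ∷ j ∷ e ∷ []) ℚR))
    go : (∃ λ D → (1 ≤ⁿ D) × (inv D ≤ ε)) → ∃ λ N → ∀ n → N ≤ⁿ n → ℚ.∣ 𝔼G n /ℕ n - + 2 / 3 ∣ < ε
    go (D , hD , jε) = proj₁ lim , λ n hn → subst (λ z → ℚ.∣ z - + 2 / 3 ∣ < ε) (sym (mean-eq n))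
        (∣∣-< (r (meanRatio n) (inv D) ε (proj₁ (proj₂ (proj₂ lim n hn))) jε (<⇒≤ hε)) (½ε hε))
      where
      lim = ratio-limits D hD
  var : ConvergesTo (λ n → VarG n /ℕ (n *ⁿ n)) (+ 1 / 18)
  var ε hε = go (archimedean ε hε)
    where
    -- In terms of `v = 6 u - 4` and `h = 6 a - 3` the deviation of `a - u²` from `1/18` is
    -- `(6 h - v² - 8 v) / 36`, at most `15/36` of a common bound `j ≤ 1` for `v` and `h`.
    id : ∀ a u → ι 36 * (a - u * u - + 1 / 18) ≡ ι 6 * (ι 6 * a - ι 3) - (ι 6 * u - ι 4) *
        (ι 6 * u - ι 4) - ι 8 * (ι 6 * u - ι 4)
    id = solve-∀ ℚR
    b : ∀ v h j → ∣ v ∣≤ j → ∣ h ∣≤ j → j ≤ 1ℚ → ∣ ι 6 * h - v * v - ι 8 * v ∣≤ ι 15 * j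
    b v h j hv hh hj = abs-mono (abs-- (abs-- (abs-scale (ι≥0 6) hh) (abs-* (abs-mono hv hj) hv))
        (abs-scale (ι≥0 8) hv)) (≤-reflexive (r j))
      where
      r : ∀ j → ι 6 * j + 1ℚ * j + ι 8 * j ≡ ι 15 * j
      r = solve-∀ ℚR
    r : ∀ z j e → ∣ ι 36 * z ∣≤ ι 15 * j → j ≤ e → 0ℚ ≤ e → ∣ z ∣≤ inv 2 * e
    r z j e (p , q) h k = ι-cancelˡ {36} z<s (lin (p +≤ (ι≥0 15 ·≤ h) +≤ (ι≥0 3 ·≤ k))
        (solve (z ∷ j ∷ e ∷ []) ℚR)) , ι-cancelˡ {36} z<s (lin (q +≤ (ι≥0 15 ·≤ h) +≤ (ι≥0 3 ·≤ k))
        (solve (z ∷ j ∷ e ∷ []) ℚR))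
    go : (∃ λ D → (1 ≤ⁿ D) × (inv D ≤ ε)) → ∃ λ N → ∀ n → N ≤ⁿ n → ℚ.∣ VarG n /ℕ (n *ⁿ n) - + 1 / 18 ∣ < ε
    go (D , hD , jε) = proj₁ lim , λ n hn → subst (λ z → ℚ.∣ z - + 1 / 18 ∣ < ε)
        (sym (var-eq (proj₁ (proj₂ lim n hn)))) (∣∣-< (r (squareRatio n - meanRatio n * meanRatio n - +
        1 / 18) (inv D) ε (subst (∣_∣≤ ι 15 * inv D) (sym (id (squareRatio n) (meanRatio n)))
        (b (ι 6 * meanRatio n - ι 4) (ι 6 * squareRatio n - ι 3) (inv D) (proj₁ (proj₂ (proj₂ lim n hn)))
        (proj₂ (proj₂ (proj₂ lim n hn))) (inv≤1 D))) jε (<⇒≤ hε)) (½ε hε))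
      where
      lim = ratio-limits D hD
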